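{- (1) For every integer $r \geq 3$, $$(r+2)n + o(n) \leq \mathrm{tsat}(n,K_r) \leq (r+3)n+o(n)$$ as $n \to \infty$. (2) For $r=3$, $$\left(5+\tfrac{2}{3}\right)n + o(n) \leq \mathrm{tsat}(n,K_3) \leq 6n+o(n)$$ as $n\to\infty$.
   Context: All graphs are finite and simple. Two distinct vertices $v,w$ are twins if they have the same (open) neighbourhood; a graph is twin-free if it has no pair of twins. A graph $G$ is $K_r$-saturated if $G$ contains no $K_r$ but adding any missing edge to $G$ creates a $K_r$. For integers $r\ge 3$ and sufficiently large $n$ (such graphs exist for all large $n$), $\mathrm{tsat}(n,K_r)$ is the minimum number of edges in a twin-free $K_r$-saturated graph on $n$ vertices. The $o(n)$ terms are for fixed $r$ as $n\to\infty$. -}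

module Defs where

open import Data.Nat using (ℕ; zero; suc; _+_; _*_; _<_; _≤_)
open import Data.Bool using (Bool; true; false; if_then_else_; _∧_; _∨_)
open import Data.Fin using (Fin; toℕ; _<?_)
open import Data.Product using (Σ; _×_; _,_; ∃)
open import Relation.Nullary using (¬_; does)
open import Relation.Binary.PropositionalEquality using (_≡_; _≢_)
open import Function.Definitions using (Injective)

record Graph (n : ℕ) : Set where
  field
    adj    : Fin n → Fin n → Bool
    sym    : ∀ i j → adj i j ≡ adj j i
    irrefl : ∀ i → adj i i ≡ false
open Graph public

count : (n : ℕ) → (Fin n → Bool) → ℕ
count zero    f = 0
count (suc n) f = (if f Data.Fin.zero then 1 else 0) + count n (λ x → f (Data.Fin.suc x))

sumF : (m : ℕ) → (Fin m → ℕ) → ℕ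
sumF zero    g = 0
sumF (suc m) g = g Data.Fin.zero + sumF m (λ x → g (Data.Fin.suc x))

edges : ∀ {n} → Graph n → ℕ
edges {n} G = sumF n (λ i → count n (λ j → does (i <? j) ∧ adj G i j))

ContainsK : ∀ {n} → ℕ → (Fin n → Fin n → Bool) → Set
ContainsK {n} r a =
  Σ (Fin r → Fin n) λ f → Injective _≡_ _≡_ f × (∀ x y → x ≢ y → a (f x) (f y) ≡ true)

addEdge : ∀ {n} → Graph n → Fin n → Fin n → Fin n → Fin n → Bool
addEdge G u v x y =
  adj G x y ∨ ((does (x Data.Fin.≟ u) ∧ does (y Data.Fin.≟ v))
             ∨ (does (x Data.Fin.≟ v) ∧ does (y Data.Fin.≟ u)))

KSaturated : ∀ {n} → ℕ → Graph n → Set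
KSaturated r G =
  ¬ ContainsK r (adj G) ×
  (∀ u v → u ≢ v → adj G u v ≡ false → ContainsK r (addEdge G u v))

Twins : ∀ {n} → Graph n → Fin n → Fin n → Set
Twins G v w = v ≢ w × (∀ x → adj G v x ≡ adj G w x)

TwinFree : ∀ {n} → Graph n → Set
TwinFree {n} G = ∀ (v w : Fin n) → ¬ Twins G v w

{-# OPTIONS --safe #-}
module Submission where

-- Upper bound. For r = 3 the graph consists of a hub joined to almost all vertices, each of which has five more
-- neighbours in a core with o(n) edges: a cell of a grid with its row and its column, and an antipodal pair
-- of a crown. A dominating vertex passes from r to r + 1.
--
-- Lower bound. Split the vertices into low degree, high degree (the core) and a negligible middle range. The trace
-- of a low vertex is its neighbourhood in the core; saturation makes traces dominate all but boundedly many
-- vertices, and twin-freeness bounds the number of vertices with a given trace. Many traces share a clique Q of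
-- size r - 2, and traces exceeding Q by at most three vertices number O(|core|): otherwise every element of some
-- trace {x, y, z} ∪ Q lies in many others, and the resulting crowns contain a triangle over an (r - 3)-clique of Q.
-- So almost all traces have at least r + 2 elements.
--
-- For r = 3, almost all vertices with five core neighbours share a hub, and those without further neighbours give
-- four-element maximal independent sets of a triangle-free graph on m core vertices. Such a set dominates,
-- and a discharging argument shows that a core vertex of degree d lies in at most m - d + O(1) of them; together
-- these force the core to have at least 2/3 as many edges as there are sets, up to lower order terms.

open import Defs
open import Data.Nat using (ℕ; zero; suc; pred; _+_; _*_; _^_; _≤_; _<_; _≥_; z≤n; s≤s; _≤?_) renaming (_≟_ to _≟ℕ_)
open import Data.Nat.Properties hiding (_≟_; _<?_; _≤?_; 0≢1+n; suc-injective)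
open import Data.Nat.Properties using () renaming (suc-injective to ℕ-suc-injective)
open import Data.Nat.Tactic.RingSolver using (solve-∀)
open import Data.Bool using (Bool; true; false; if_then_else_; _∧_; _∨_; not)
open import Data.Bool.Properties using (∨-comm; ∨-identityʳ) renaming (_≟_ to _≟ᵇ_)
open import Data.Fin using (Fin; zero; suc; _≟_; punchIn; punchOut; toℕ; _↑ˡ_; _↑ʳ_; splitAt; join; combine; remQuot; inject≤) renaming (_<?_ to _<ᶠ?_)
open import Data.Fin.Properties using (any?; all?; suc-injective; 0≢1+n; punchInᵢ≢i; punchIn-punchOut; punchIn-injective; injective⇒≤; toℕ-injective) renaming (<-cmp to <ᶠ-cmp)
open import Data.Fin.Properties using (splitAt-↑ˡ; splitAt-↑ʳ; join-splitAt; remQuot-combine; combine-remQuot; inject≤-injective)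
open import Data.List using (List; []; _∷_; length; map; take; allFin; _++_; cartesianProductWith; lookup; tabulate)
open import Data.List.Properties using (length-map; length-take; length-++; length-tabulate)
open import Data.List.Relation.Unary.All as All using (All; []; _∷_)
open import Data.List.Relation.Unary.All.Properties as AllP using ()
open import Data.List.Relation.Unary.Any using (here; there)
open import Data.List.Relation.Unary.AllPairs as AP using (AllPairs; []; _∷_)
open import Data.List.Relation.Unary.AllPairs.Properties as APP using ()
open import Data.List.Membership.Propositional using (_∈_)
open import Data.List.Membership.Propositional.Properties using (∈-map⁺; ∈-lookup; ∈-allFin; ∈-cartesianProductWith⁺; ∈-++⁺ˡ; ∈-++⁺ʳ)
open import Data.List.Relation.Binary.Sublist.Propositional using (_⊆_; []; _∷ʳ_; _∷_; ⊆-trans; minimum)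
open import Data.List.Relation.Binary.Sublist.Propositional.Properties using (All-resp-⊆)
open import Data.Product using (Σ; ∃; _×_; _,_; proj₁; proj₂)
open import Data.Sum using (_⊎_; inj₁; inj₂; [_,_]′; swap; map₁; map₂)
open import Data.Unit using (⊤; tt)
open import Data.Empty using (⊥; ⊥-elim)
open import Function using (_∘_; id)
open import Relation.Nullary using (¬_; Dec; yes; no; does)
open import Relation.Nullary.Decidable using (dec-true; dec-false; _×-dec_; ¬?; from-yes)
open import Relation.Binary.Definitions using (tri<; tri≈; tri>)
open import Relation.Binary.PropositionalEquality using (_≡_; _≢_; refl; trans; cong; cong₂; subst; subst₂; module ≡-Reasoning) renaming (sym to ≡sym)

-- Boolean predicates

-- The number K of vertices that a trace may fail to dominate grows with the lower degree cutoff,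
-- and the number of vertices with short traces is bounded by a huge function of K times the size of
-- the core. So the core must be smaller than n by a factor that depends on the lower cutoff. This
-- forces wide gaps between the cutoffs, and a pigeonhole over a tower of disjoint gaps finds one
-- whose total degree is negligible.
--
-- Genericity is one-sided: later members of a sequence avoid the exceptional sets of earlier ones,
-- not conversely. Where a cyclic pattern is needed, K + 1 candidates are prepared so that the last
-- choice cannot spoil all of them.
--
-- For r = 3 let b count the low vertices of degree five. The edges at low vertices number about 6n
-- - b, and the core adds about 2b/3, so b ≤ n gives 17n/3. The 2/3 arises as follows: the four
-- elements of a set dominate m vertices, so they have degree m/4 on average; an element of degree
-- m/4 is in about 3m/4 sets at most; hence 4b incidences need 16b/(3m) elements, of total degree
-- 4b/3.

clash : ∀ {b} → b ≡ true → b ≡ false → ⊥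
clash refl ()

¬true⇒false : ∀ {b} → ¬ (b ≡ true) → b ≡ false
¬true⇒false {true}  p = ⊥-elim (p refl)
¬true⇒false {false} p = refl

decide : ∀ b → (b ≡ true) ⊎ (b ≡ false)
decide true  = inj₁ refl
decide false = inj₂ refl

∧-i : ∀ {a b} → a ≡ true → b ≡ true → a ∧ b ≡ true
∧-i refl refl = refl

∧-l : ∀ {a b} → a ∧ b ≡ true → a ≡ true
∧-l {true} p = refl

∧-r : ∀ {a b} → a ∧ b ≡ true → b ≡ true
∧-r {true} p = p

∨-l : ∀ {a b} → a ≡ true → a ∨ b ≡ true
∨-l refl = refl

∨-r : ∀ {a b} → b ≡ true → a ∨ b ≡ true
∨-r {true}  p = refl
∨-r {false} p = p

∨-e : ∀ {a b} → a ∨ b ≡ true → a ≡ true ⊎ b ≡ true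
∨-e {true}  p = inj₁ refl
∨-e {false} p = inj₂ p

not-i : ∀ {a} → a ≡ false → not a ≡ true
not-i refl = refl

not-e : ∀ {a} → not a ≡ true → a ≡ false
not-e {false} p = refl

does-e : ∀ {P : Set} (d : Dec P) → does d ≡ true → P
does-e (yes p) _ = p

does-i : ∀ {P : Set} (d : Dec P) → P → does d ≡ true
does-i = dec-true

does-ne : ∀ {P : Set} (d : Dec P) → does d ≡ false → ¬ P
does-ne (no p) _ = p

does-ni : ∀ {P : Set} (d : Dec P) → ¬ P → does d ≡ false
does-ni = dec-false

bool-ext : ∀ {a b} → (a ≡ true → b ≡ true) → (b ≡ true → a ≡ true) → a ≡ b
bool-ext {true}  {true}  f g = refl
bool-ext {true}  {false} f g = ≡sym (f refl)
bool-ext {false} {true}  f g = g refl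
bool-ext {false} {false} f g = refl

opaque
  anyB : ∀ {m} → (Fin m → Bool) → Bool
  anyB f = does (any? (λ i → f i ≟ᵇ true))

  anyB-e : ∀ {m} {f : Fin m → Bool} → anyB f ≡ true → ∃ λ i → f i ≡ true
  anyB-e {f = f} = does-e (any? (λ i → f i ≟ᵇ true))

  anyB-i : ∀ {m} {f : Fin m → Bool} i → f i ≡ true → anyB f ≡ true
  anyB-i {f = f} i p = does-i (any? (λ i → f i ≟ᵇ true)) (i , p)

anyB-ne : ∀ {m} {f : Fin m → Bool} → anyB f ≡ false → ∀ i → f i ≡ false
anyB-ne {f = f} p i = ¬true⇒false (λ q → clash (anyB-i {f = f} i q) p)

-- Finite sums

ind : Bool → ℕ
ind b = if b then 1 else 0

interchange : ∀ a b c d → (a + b) + (c + d) ≡ (a + c) + (b + d)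
interchange = solve-∀

without : ∀ {m} → Fin m → (Fin m → ℕ) → Fin m → ℕ
without i f j = if does (j ≟ i) then 0 else f j

without-≢ : ∀ {m} {i j : Fin m} (f : Fin m → ℕ) → j ≢ i → without i f j ≡ f j
without-≢ {i = i} {j} f q rewrite does-ni (j ≟ i) q = refl

without-suc : ∀ {m} (i : Fin m) (f : Fin (suc m) → ℕ) j → without (suc i) f (suc j) ≡ without i (f ∘ suc) j
without-suc i f j with j ≟ i
... | yes refl = refl
... | no _ = refl

elems : ∀ {m} → (Fin m → Bool) → List (Fin m)
elems {zero}  f = []
elems {suc m} f = if f zero then zero ∷ map suc (elems (f ∘ suc)) else map suc (elems (f ∘ suc))

opaque
  ∑ : ∀ {m : ℕ} → (Fin m → ℕ) → ℕ
  ∑ {m} f = sumF m f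

  # : ∀ {m : ℕ} → (Fin m → Bool) → ℕ
  # {m} f = count m f

  ∑-def : ∀ {m} (f : Fin m → ℕ) → ∑ f ≡ sumF m f
  ∑-def f = refl

  #-def : ∀ {m} (f : Fin m → Bool) → # f ≡ count m f
  #-def f = refl

  sum-cong : ∀ {m} {f g : Fin m → ℕ} → (∀ i → f i ≡ g i) → ∑ f ≡ ∑ g
  sum-cong {zero}  p = refl
  sum-cong {suc m} p = cong₂ _+_ (p zero) (sum-cong (p ∘ suc))

  sum-mono : ∀ {m} {f g : Fin m → ℕ} → (∀ i → f i ≤ g i) → ∑ f ≤ ∑ g
  sum-mono {zero}  p = z≤n
  sum-mono {suc m} p = +-mono-≤ (p zero) (sum-mono (p ∘ suc))

  sum-strict : ∀ {m} {f g : Fin m → ℕ} → (∀ i → f i ≤ g i) → ∀ i → f i < g i → ∑ f < ∑ g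
  sum-strict p zero    q = +-mono-<-≤ q (sum-mono (p ∘ suc))
  sum-strict p (suc i) q = +-mono-≤-< (p zero) (sum-strict (p ∘ suc) i q)

  sum-+ : ∀ {m} (f g : Fin m → ℕ) → ∑ (λ i → f i + g i) ≡ ∑ f + ∑ g
  sum-+ {zero}  f g = refl
  sum-+ {suc m} f g = trans (cong (f zero + g zero +_) (sum-+ (f ∘ suc) (g ∘ suc)))
                            (interchange (f zero) (g zero) _ _)

  sum-* : ∀ {m} c (f : Fin m → ℕ) → ∑ (λ i → c * f i) ≡ c * ∑ f
  sum-* {zero}  c f = ≡sym (*-zeroʳ c)
  sum-* {suc m} c f = trans (cong (c * f zero +_) (sum-* c (f ∘ suc))) (≡sym (*-distribˡ-+ c (f zero) _))

  sum-*ʳ : ∀ {m} c (f : Fin m → ℕ) → ∑ (λ i → f i * c) ≡ ∑ f * c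
  sum-*ʳ c f = trans (sum-cong (λ i → *-comm (f i) c)) (trans (sum-* c f) (*-comm c _))

  sum-const : ∀ m c → ∑ {m} (λ _ → c) ≡ m * c
  sum-const zero    c = refl
  sum-const (suc m) c = cong (c +_) (sum-const m c)

  sum-swap : ∀ {m k} (f : Fin m → Fin k → ℕ) →
    ∑ (λ i → ∑ (λ j → f i j)) ≡ ∑ (λ j → ∑ (λ i → f i j))
  sum-swap {zero}  {k} f = ≡sym (trans (sum-const k 0) (*-zeroʳ k))
  sum-swap {suc m} {k} f = trans (cong (∑ (f zero) +_) (sum-swap (f ∘ suc)))
                                 (≡sym (sum-+ (f zero) (λ j → ∑ (λ i → f (suc i) j))))

  term≤sum : ∀ {m} (f : Fin m → ℕ) i → f i ≤ ∑ f
  term≤sum f zero    = m≤m+n _ _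
  term≤sum f (suc i) = ≤-trans (term≤sum (f ∘ suc) i) (m≤n+m _ _)

  sum-remove : ∀ {m} (f : Fin m → ℕ) i → ∑ f ≡ f i + ∑ (without i f)
  sum-remove f zero    = refl
  sum-remove {suc m} f (suc i) = begin
    f zero + ∑ (f ∘ suc)                            ≡⟨ cong (f zero +_) (sum-remove (f ∘ suc) i) ⟩
    f zero + (f (suc i) + ∑ (without i (f ∘ suc)))  ≡⟨ swap3 (f zero) (f (suc i)) _ ⟩
    f (suc i) + (f zero + ∑ (without i (f ∘ suc)))  ≡⟨ cong (λ s → f (suc i) + (f zero + s)) (sum-cong (λ j → ≡sym (without-suc i f j))) ⟩
    f (suc i) + (f zero + ∑ (without (suc i) f ∘ suc)) ∎
    where
    open ≡-Reasoning
    swap3 : ∀ a b c → a + (b + c) ≡ b + (a + c)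
    swap3 = solve-∀

  #-sum : ∀ {m} (f : Fin m → Bool) → # f ≡ ∑ (ind ∘ f)
  #-sum {zero}  f = refl
  #-sum {suc m} f = cong (ind (f zero) +_) (#-sum (f ∘ suc))

  #-all : ∀ m → # {m} (λ _ → true) ≡ m
  #-all zero    = refl
  #-all (suc m) = cong suc (#-all m)

  #-pos : ∀ {m} {f : Fin m → Bool} → 0 < # f → ∃ λ i → f i ≡ true
  #-pos {suc m} {f} p with f zero in eq
  ... | true  = zero , eq
  ... | false with #-pos {m} p
  ...   | i , q = suc i , q

  length-elems : ∀ {m} (f : Fin m → Bool) → length (elems f) ≡ # f
  length-elems {zero}  f = refl
  length-elems {suc m} f with f zero
  ... | true  = cong suc (trans (length-map suc (elems (f ∘ suc))) (length-elems (f ∘ suc)))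
  ... | false = trans (length-map suc (elems (f ∘ suc))) (length-elems (f ∘ suc))

two≤sum : ∀ {m} (f : Fin m → ℕ) {i j} → i ≢ j → f i + f j ≤ ∑ f
two≤sum f {i} {j} i≢j rewrite sum-remove f i =
  +-monoʳ-≤ (f i) (subst (_≤ ∑ (without i f)) (without-≢ f (i≢j ∘ ≡sym)) (term≤sum (without i f) j))

three≤sum : ∀ {m} (f : Fin m → ℕ) {i j k} → i ≢ j → i ≢ k → j ≢ k → f i + (f j + f k) ≤ ∑ f
three≤sum f {i} {j} {k} ij ik jk rewrite sum-remove f i =
  +-monoʳ-≤ (f i) (subst (_≤ ∑ (without i f))
    (cong₂ _+_ (without-≢ f (ij ∘ ≡sym)) (without-≢ f (ik ∘ ≡sym))) (two≤sum (without i f) jk))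

-- Counting

ind-mono : ∀ {a b} → (a ≡ true → b ≡ true) → ind a ≤ ind b
ind-mono {false} p = z≤n
ind-mono {true}  p rewrite p refl = ≤-refl

ind-∧ : ∀ a b → ind (a ∧ b) ≡ ind a * ind b
ind-∧ true  b = ≡sym (+-identityʳ _)
ind-∧ false b = refl

#-mono : ∀ {m} {f g : Fin m → Bool} → (∀ i → f i ≡ true → g i ≡ true) → # f ≤ # g
#-mono {f = f} {g} p rewrite #-sum f | #-sum g = sum-mono (λ i → ind-mono (p i))

#-cong : ∀ {m} {f g : Fin m → Bool} → (∀ i → f i ≡ g i) → # f ≡ # g
#-cong {f = f} {g} p rewrite #-sum f | #-sum g = sum-cong (λ i → cong ind (p i))

#-∨ : ∀ {m} {f g h : Fin m → Bool} → (∀ i → f i ≡ true → g i ≡ true ⊎ h i ≡ true) → # f ≤ # g + # h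
#-∨ {f = f} {g} {h} p rewrite #-sum f | #-sum g | #-sum h =
  subst (_ ≤_) (sum-+ (ind ∘ g) (ind ∘ h)) (sum-mono (λ i → lem (p i)))
  where
  lem : ∀ {a b c} → (a ≡ true → b ≡ true ⊎ c ≡ true) → ind a ≤ ind b + ind c
  lem {false} q = z≤n
  lem {true} {b} q with q refl
  ... | inj₁ refl = s≤s z≤n
  ... | inj₂ refl = m≤n+m 1 (ind b)

#-split : ∀ {m} (f g : Fin m → Bool) → # f ≡ # (λ i → f i ∧ g i) + # (λ i → f i ∧ not (g i))
#-split f g rewrite #-sum f | #-sum (λ i → f i ∧ g i) | #-sum (λ i → f i ∧ not (g i)) =
  trans (sum-cong (λ i → lem (f i) (g i))) (sum-+ _ _)
  where
  lem : ∀ a b → ind a ≡ ind (a ∧ b) + ind (a ∧ not b)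
  lem false b     = refl
  lem true  true  = refl
  lem true  false = refl

#-pos′ : ∀ {m} {f : Fin m → Bool} i → f i ≡ true → 1 ≤ # f
#-pos′ {f = f} i p rewrite #-sum f = ≤-trans (subst (λ b → 1 ≤ ind b) (≡sym p) ≤-refl) (term≤sum (ind ∘ f) i)

#-strict : ∀ {m} {f g : Fin m → Bool} → (∀ i → f i ≡ true → g i ≡ true) →
  ∀ i → f i ≡ false → g i ≡ true → # f < # g
#-strict {f = f} {g} p i q q′ rewrite #-sum f | #-sum g =
  sum-strict (λ i → ind-mono (p i)) i (lem q q′)
  where
  lem : ∀ {a b} → a ≡ false → b ≡ true → ind a < ind b
  lem refl refl = s≤s z≤n

-- Union bound by counting pairs `(w , u)`. It limits how many members a greedy selection has to
-- discard for touching a forbidden set `κ`.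
#-anyB : ∀ {m k} (E : Fin m → Bool) (κ : Fin k → Bool) (h : Fin m → Fin k → Bool) c →
  (∀ u → # (λ w → E w ∧ h w u) ≤ c) →
  # (λ w → E w ∧ anyB (λ u → κ u ∧ h w u)) ≤ # κ * c
#-anyB {m} {k} E κ h c bound = begin
  # (λ w → E w ∧ anyB (λ u → κ u ∧ h w u))                       ≡⟨ #-sum _ ⟩
  ∑ (λ w → ind (E w ∧ anyB (λ u → κ u ∧ h w u)))            ≤⟨ sum-mono step ⟩
  ∑ (λ w → ∑ (λ u → ind (κ u) * ind (E w ∧ h w u)))    ≡⟨ sum-swap _ ⟩
  ∑ (λ u → ∑ (λ w → ind (κ u) * ind (E w ∧ h w u)))    ≡⟨ sum-cong (λ u → trans (sum-* (ind (κ u)) _) (cong (ind (κ u) *_) (≡sym (#-sum _)))) ⟩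
  ∑ (λ u → ind (κ u) * # (λ w → E w ∧ h w u))               ≤⟨ sum-mono (λ u → *-monoʳ-≤ (ind (κ u)) (bound u)) ⟩
  ∑ (λ u → ind (κ u) * c)                                   ≡⟨ sum-*ʳ c _ ⟩
  ∑ (ind ∘ κ) * c                                           ≡⟨ cong (_* c) (≡sym (#-sum κ)) ⟩
  # κ * c ∎
  where
  open ≤-Reasoning
  step : ∀ w → ind (E w ∧ anyB (λ u → κ u ∧ h w u)) ≤ ∑ (λ u → ind (κ u) * ind (E w ∧ h w u))
  step w with decide (E w ∧ anyB (λ u → κ u ∧ h w u))
  ... | inj₂ p rewrite p = z≤n
  ... | inj₁ p with anyB-e {f = λ u → κ u ∧ h w u} (∧-r {E w} p)
  ...   | u , q = ≤-trans (subst₁ p) (≤-trans (≤-reflexive (≡sym one)) (term≤sum (λ u → ind (κ u) * ind (E w ∧ h w u)) u))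
    where
    subst₁ : ∀ {b} → b ≡ true → ind b ≤ 1
    subst₁ refl = ≤-refl
    one : ind (κ u) * ind (E w ∧ h w u) ≡ 1
    one rewrite ∧-l {κ u} q | ∧-r {κ u} q | ∧-l {E w} p = refl

elems-All : ∀ {m} (f : Fin m → Bool) → All (λ i → f i ≡ true) (elems f)
elems-All {zero}  f = []
elems-All {suc m} f with f zero in eq
... | true  = eq ∷ AllP.map⁺ (elems-All (f ∘ suc))
... | false = AllP.map⁺ (elems-All (f ∘ suc))

elems-∈ : ∀ {m} {f : Fin m → Bool} i → f i ≡ true → i ∈ elems f
elems-∈ {suc m} {f} zero p rewrite p = here refl
elems-∈ {suc m} {f} (suc i) p with f zero
... | true  = there (∈-map⁺ suc (elems-∈ i p))
... | false = ∈-map⁺ suc (elems-∈ i p)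

elems-distinct : ∀ {m} (f : Fin m → Bool) → AllPairs _≢_ (elems f)
elems-distinct {zero} f = []
elems-distinct {suc m} f with f zero
... | true  = AllP.map⁺ (All.tabulate (λ _ → 0≢1+n)) ∷ APP.map⁺ (AP.map (λ p → p ∘ suc-injective) (elems-distinct (f ∘ suc)))
... | false = APP.map⁺ (AP.map (λ p → p ∘ suc-injective) (elems-distinct (f ∘ suc)))

record Three {m : ℕ} (f : Fin m → Bool) : Set where
  constructor three
  field
    x y z       : Fin m
    fx          : f x ≡ true
    fy          : f y ≡ true
    fz          : f z ≡ true
    x≢y         : x ≢ y
    x≢z         : x ≢ z
    y≢z         : y ≢ z
    cover       : ∀ u → f u ≡ true → u ≡ x ⊎ u ≡ y ⊎ u ≡ z

#-three : ∀ {m} (f : Fin m → Bool) → # f ≡ 3 → Three f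
#-three f p = go (elems f) (trans (length-elems f) p) (elems-All f) (elems-distinct f) (elems-∈ {f = f})
  where
  go : ∀ xs → length xs ≡ 3 → All (λ i → f i ≡ true) xs → AllPairs _≢_ xs → (∀ i → f i ≡ true → i ∈ xs) → Three f
  go (x ∷ y ∷ z ∷ []) refl (fx ∷ fy ∷ fz ∷ []) ((xy ∷ xz ∷ []) ∷ (yz ∷ []) ∷ [] ∷ []) c =
    three x y z fx fy fz xy xz yz (λ u q → cv (c u q))
    where
    cv : ∀ {u} → u ∈ (x ∷ y ∷ z ∷ []) → u ≡ x ⊎ u ≡ y ⊎ u ≡ z
    cv (here p) = inj₁ p
    cv (there (here p)) = inj₂ (inj₁ p)
    cv (there (there (here p))) = inj₂ (inj₂ p)

take-distinct : ∀ {m} (f : Fin m → Bool) k → k ≤ # f →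
  ∃ λ xs → length xs ≡ k × All (λ i → f i ≡ true) xs × AllPairs _≢_ xs
take-distinct f k p = take k (elems f) , trans (length-take k (elems f)) (m≤n⇒m⊓n≡m (subst (k ≤_) (≡sym (length-elems f)) p)) ,
  AllP.take⁺ k (elems-All f) , APP.take⁺ k (elems-distinct f)

#≤1 : ∀ {m} {f : Fin m → Bool} → (∀ i j → f i ≡ true → f j ≡ true → i ≡ j) → # f ≤ 1
#≤1 {f = f} u with 2 ≤? # f
... | no q = ≤-pred (≰⇒> q)
... | yes q with take-distinct f 2 q
...   | (i ∷ j ∷ []) , refl , (a ∷ b ∷ []) , ((d ∷ []) ∷ _) = ⊥-elim (d (u i j a b))

-- Combinatorial selection principles

Homogeneous : ∀ {m} → List (Fin m → Bool) → (Fin m → Bool) → Set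
Homogeneous {m} ts B =
  Σ (Fin m → Bool) λ B′ → (∀ v → B′ v ≡ true → B v ≡ true) × # B ≤ 2 ^ length ts * # B′ ×
    All (λ t → ∀ v w → B′ v ≡ true → B′ w ≡ true → t v ≡ t w) ts

-- Each test keeps the larger of its two classes, so it costs at most a factor of 2.
homogenize : ∀ {m} (ts : List (Fin m → Bool)) (B : Fin m → Bool) → Homogeneous ts B
homogenize [] B = B , (λ _ p → p) , ≤-reflexive (≡sym (+-identityʳ _)) , []
homogenize (t ∷ ts) B = pick (≤-total (# Bt) (# Bf))
  where
  Bt Bf : Fin _ → Bool
  Bt v = B v ∧ t v
  Bf v = B v ∧ not (t v)
  arith : ∀ a b → a * b + a * b ≡ 2 * a * b
  arith = solve-∀
  finish : (B₁ : Fin _ → Bool) → (∀ v → B₁ v ≡ true → B v ≡ true) → # B ≤ # B₁ + # B₁ →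
    (∀ v w → B₁ v ≡ true → B₁ w ≡ true → t v ≡ t w) → Homogeneous (t ∷ ts) B
  finish B₁ sub le eq with homogenize ts B₁
  ... | B′ , sub′ , le′ , al = B′ , (λ v → sub v ∘ sub′ v) ,
        ≤-trans le (subst (# B₁ + # B₁ ≤_) (arith (2 ^ length ts) (# B′)) (+-mono-≤ le′ le′)) ,
        (λ v w p q → eq v w (sub′ v p) (sub′ w q)) ∷ al
  pick : # Bt ≤ # Bf ⊎ # Bf ≤ # Bt → Homogeneous (t ∷ ts) B
  pick (inj₁ p) = finish Bf (λ v → ∧-l) (≤-trans (≤-reflexive (#-split B t)) (+-monoˡ-≤ (# Bf) p))
    (λ v w a b → trans (not-e (∧-r {B v} a)) (≡sym (not-e (∧-r {B w} b))))
  pick (inj₂ p) = finish Bt (λ v → ∧-l) (≤-trans (≤-reflexive (#-split B t)) (+-monoʳ-≤ (# Bt) p))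
    (λ v w a b → trans (∧-r {B v} a) (≡sym (∧-r {B w} b)))

-- Homogenizing with one test per element of `F` leaves at most one member, since members that agree
-- on `F` coincide.
#-traces : ∀ {m k} (B : Fin m → Bool) (F : Fin k → Bool) (inc : Fin m → Fin k → Bool) →
  (∀ v w → B v ≡ true → B w ≡ true → (∀ u → F u ≡ true → inc v u ≡ inc w u) → v ≡ w) →
  # B ≤ 2 ^ # F
#-traces B F inc inj with homogenize (map (λ u v → inc v u) (elems F)) B
... | B′ , sub , le , al = ≤-trans le (subst (λ l → 2 ^ l * # B′ ≤ 2 ^ # F) (≡sym (trans (length-map _ (elems F)) (length-elems F)))
        (subst (2 ^ # F * # B′ ≤_) (*-identityʳ _) (*-monoʳ-≤ (2 ^ # F) (#≤1 uniq))))
  where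
  uniq : ∀ v w → B′ v ≡ true → B′ w ≡ true → v ≡ w
  uniq v w p q = inj v w (sub v p) (sub w q) (λ u fu → All.lookup (AllP.map⁻ al) (elems-∈ u fu) v w p q)

-- The head splits the tail into two classes, and one of them has at least `2 ^ (s + t - 1)` of the
-- `2 ^ (s + t) - 1` or more elements. Pairs are compared in list order.
ramsey : ∀ {A : Set} (P : A → A → Bool) s t (xs : List A) → 2 ^ (s + t) ≤ length xs →
  (∃ λ ys → ys ⊆ xs × length ys ≡ s × AllPairs (λ x y → P x y ≡ true) ys) ⊎
  (∃ λ ys → ys ⊆ xs × length ys ≡ t × AllPairs (λ x y → P x y ≡ false) ys)
ramsey P zero t xs p = inj₁ ([] , minimum xs , refl , [])
ramsey P (suc s) zero xs p = inj₂ ([] , minimum xs , refl , [])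
ramsey {A} P (suc s) (suc t) [] p = ⊥-elim (<⇒≱ (m^n>0 2 (suc s + suc t)) p)
ramsey {A} P (suc s) (suc t) (x ∷ xs) p = split (parts xs)
  where
  parts : ∀ xs → ∃ λ ys → ∃ λ zs → ys ⊆ xs × zs ⊆ xs × All (λ y → P x y ≡ true) ys ×
            All (λ z → P x z ≡ false) zs × length ys + length zs ≡ length xs
  parts [] = [] , [] , [] , [] , [] , [] , refl
  parts (u ∷ us) with parts us
  ... | ys , zs , sy , sz , ay , az , e with P x u in eq
  ...   | true  = u ∷ ys , zs , refl ∷ sy , u ∷ʳ sz , eq ∷ ay , az , cong suc e
  ...   | false = ys , u ∷ zs , u ∷ʳ sy , refl ∷ sz , ay , eq ∷ az , trans (+-suc (length ys) (length zs)) (cong suc e)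
  half : ∀ {a b c} → 2 * c ≤ suc (a + b) → 1 ≤ c → (c ≤ a) ⊎ (c ≤ b)
  half {a} {b} {c} q r with c ≤? a
  ... | yes u = inj₁ u
  ... | no u  = inj₂ (+-cancelˡ-≤ c c b (≤-trans (≤-reflexive (cong (c +_) (≡sym (+-identityʳ c)))) (≤-trans q (+-monoˡ-≤ b (≰⇒> u)))))
  split : _ → _
  split (ys , zs , sy , sz , ay , az , e) with half {length ys} {length zs} {2 ^ (s + suc t)} (subst (λ l → 2 * 2 ^ (s + suc t) ≤ suc l) (≡sym e) p) (m^n>0 2 (s + suc t))
  split (ys , zs , sy , sz , ay , az , e) | inj₁ q with ramsey P s (suc t) ys q
  ... | inj₁ (us , su , lu , pu) = inj₁ (x ∷ us , refl ∷ ⊆-trans su sy , cong suc lu , All-resp-⊆ su ay ∷ pu)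
  ... | inj₂ (us , su , lu , pu) = inj₂ (us , x ∷ʳ ⊆-trans su sy , lu , pu)
  split (ys , zs , sy , sz , ay , az , e) | inj₂ q with ramsey P (suc s) t zs (subst (λ l → 2 ^ l ≤ length zs) (+-suc s t) q)
  ... | inj₁ (us , su , lu , pu) = inj₁ (us , x ∷ʳ ⊆-trans su sz , lu , pu)
  ... | inj₂ (us , su , lu , pu) = inj₂ (x ∷ us , refl ∷ ⊆-trans su sz , cong suc lu , All-resp-⊆ su az ∷ pu)

AllPairs-⊆ : ∀ {A : Set} {R : A → A → Set} {ys xs : List A} → ys ⊆ xs → AllPairs R xs → AllPairs R ys
AllPairs-⊆ []         []       = []
AllPairs-⊆ (y ∷ʳ s)   (a ∷ p) = AllPairs-⊆ s p
AllPairs-⊆ (refl ∷ s) (a ∷ p) = All-resp-⊆ s a ∷ AllPairs-⊆ s p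

-- Greedy choice: after picking `w`, the members that hit `kill w` are dropped, at most `κ * c` of
-- them, so `suc (κ * c)` members pay for one round.
generic-sequence : ∀ {m k} (hits kill : Fin m → Fin k → Bool) c κ L (E : Fin m → Bool) →
  (∀ u → # (λ w → E w ∧ hits w u) ≤ c) → (∀ w → E w ≡ true → # (kill w) ≤ κ) →
  L * suc (κ * c) ≤ # E →
  ∃ λ ws → length ws ≡ L × All (λ w → E w ≡ true) ws ×
    AllPairs (λ w w′ → ∀ u → hits w′ u ≡ true → kill w u ≡ false) ws
generic-sequence hits kill c κ zero E bh bk le = [] , refl , [] , []
generic-sequence {m} hits kill c κ (suc L) E bh bk le with #-pos {f = E} (≤-trans (s≤s z≤n) le)
... | w , Ew with generic-sequence hits kill c κ L E′ bh′ (λ w p → bk w (∧-l p)) le′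
  where
  bad E′ : Fin m → Bool
  bad w′ = anyB (λ u → kill w u ∧ hits w′ u)
  E′ w′ = E w′ ∧ not (bad w′)
  bh′ : ∀ u → # (λ w → E′ w ∧ hits w u) ≤ c
  bh′ u = ≤-trans (#-mono (λ i p → ∧-i (∧-l (∧-l {E i ∧ _} p)) (∧-r {E′ i} p))) (bh u)
  le′ : L * suc (κ * c) ≤ # E′
  le′ = +-cancelˡ-≤ (suc (κ * c)) _ _ (≤-trans le (subst (_≤ suc (κ * c) + # E′) (≡sym (#-split E bad))
          (+-monoˡ-≤ (# E′) (m≤n⇒m≤1+n (≤-trans (#-anyB E (kill w) hits c bh) (*-monoˡ-≤ c (bk w Ew)))))))
...   | ws , l , a , p = w ∷ ws , cong suc l , Ew ∷ All.map ∧-l a , All.map later a ∷ p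
  where
  later : ∀ {w′} → _ → ∀ u → hits w′ u ≡ true → kill w u ≡ false
  later {w′} q u h = ¬true⇒false (λ t → clash (anyB-i {f = λ u → kill w u ∧ hits w′ u} u (∧-i t h)) (not-e (∧-r {E w′} q)))

-- Peeling: as long as some value at some position occurs in at most `A` members, these members are
-- deleted and the value leaves the alphabet of that position. At most `k` rounds are possible; if
-- members are left at the end, all their values are popular.
degenerate-or-core : ∀ {m} (pos : Fin 3 → Fin m → Fin m) A k (Al : Fin 3 → Fin m → Bool) (B : Fin m → Bool) →
  ∑ (λ i → # (Al i)) ≤ k → (∀ v i → B v ≡ true → Al i (pos i v) ≡ true) →
  (# B ≤ A * k) ⊎ (Σ (Fin m → Bool) λ B′ → (∀ v → B′ v ≡ true → B v ≡ true) × (∃ λ v → B′ v ≡ true) ×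
    (∀ v i → B′ v ≡ true → A < # (λ w → B′ w ∧ does (pos i w ≟ pos i v))))
degenerate-or-core {m} pos A k Al B le al
  with any? (λ v → any? (λ i → (B v ≟ᵇ true) ×-dec (# (λ w → B w ∧ does (pos i w ≟ pos i v)) ≤? A)))
... | no none with any? (λ v → B v ≟ᵇ true)
...   | yes w = inj₂ (B , (λ _ p → p) , w , (λ v i p → ≰⇒> (λ q → none (v , i , p , q))))
...   | no em = inj₁ (≤-trans (≮⇒≥ (λ q → em (#-pos q))) z≤n)
degenerate-or-core {m} pos A zero Al B le al | yes (v , i , Bv , small) =
  ⊥-elim (<⇒≱ (≤-trans (#-pos′ (pos i v) (al v i Bv)) (term≤sum (λ i → # (Al i)) i)) le)
degenerate-or-core {m} pos A (suc k) Al B le al | yes (v , i , Bv , small)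
  with degenerate-or-core pos A k Al′ B′ le′ al′
  where
  e = pos i v
  Al′ : Fin 3 → Fin m → Bool
  Al′ j u = Al j u ∧ not (does (j ≟ i) ∧ does (u ≟ e))
  B′ : Fin m → Bool
  B′ w = B w ∧ not (does (pos i w ≟ e))
  le′ : ∑ (λ j → # (Al′ j)) ≤ k
  le′ = ≤-pred (≤-trans (sum-strict {f = λ j → # (Al′ j)} {λ j → # (Al j)} (λ j → #-mono (λ _ → ∧-l)) i
          (#-strict (λ _ → ∧-l) e (¬true⇒false (λ q → clash (∧-i {does (i ≟ i)} (does-i (i ≟ i) refl) (does-i (e ≟ e) refl)) (not-e (∧-r {Al i e} q)))) (al v i Bv))) le)
  al′ : ∀ w j → B′ w ≡ true → Al′ j (pos j w) ≡ true
  al′ w j p = ∧-i (al w j (∧-l p)) (not-i (¬true⇒false (λ q → lem (does-e (j ≟ i) (∧-l q)) (does-e (pos j w ≟ e) (∧-r {does (j ≟ i)} q)))))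
    where
    lem : j ≡ i → pos j w ≡ e → ⊥
    lem refl eq = does-ne (pos i w ≟ e) (not-e (∧-r {B w} p)) eq
... | inj₂ (B″ , sub , ne , big) = inj₂ (B″ , (λ v → ∧-l ∘ sub v) , ne , big)
... | inj₁ q = inj₁ (≤-trans (≤-reflexive (#-split B (λ w → does (pos i w ≟ pos i v))))
                 (≤-trans (+-mono-≤ small q) (≤-reflexive (≡sym (*-suc A k)))))

#-del : ∀ {m} (f : Fin m → Bool) x → f x ≡ true → # f ≡ suc (# (λ u → f u ∧ not (does (u ≟ x))))
#-del {m} f x fx = begin
  # f                                                      ≡⟨ #-sum f ⟩
  ∑ (ind ∘ f)                                              ≡⟨ sum-remove (ind ∘ f) x ⟩
  ind (f x) + ∑ (without x (ind ∘ f))                      ≡⟨ cong₂ _+_ (cong ind fx) (sum-cong step) ⟩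
  suc (∑ (λ u → ind (f u ∧ not (does (u ≟ x)))))           ≡⟨ cong suc (≡sym (#-sum _)) ⟩
  suc (# (λ u → f u ∧ not (does (u ≟ x)))) ∎
  where
  open ≡-Reasoning
  step : ∀ u → without x (ind ∘ f) u ≡ ind (f u ∧ not (does (u ≟ x)))
  step u with does (u ≟ x) | f u
  ... | true  | true  = refl
  ... | true  | false = refl
  ... | false | true  = refl
  ... | false | false = refl

length≤# : ∀ {m} (f : Fin m → Bool) xs → All (λ i → f i ≡ true) xs → AllPairs _≢_ xs → length xs ≤ # f
length≤# f [] a p = z≤n
length≤# f (x ∷ xs) (fx ∷ a) (d ∷ p) rewrite #-del f x fx =
  s≤s (length≤# _ xs (All.zipWith (λ { (fu , x≢u) → ∧-i fu (not-i (does-ni (_ ≟ x) (x≢u ∘ ≡sym))) }) (a , d)) p)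

#≡1-unique : ∀ {m} {f : Fin m → Bool} {i j} → # f ≡ 1 → f i ≡ true → f j ≡ true → i ≡ j
#≡1-unique {f = f} {i} {j} e p q with i ≟ j
... | yes r = r
... | no r = ⊥-elim (<⇒≱ (≤-refl {2}) (subst (2 ≤_) e (length≤# f (i ∷ j ∷ []) (p ∷ q ∷ []) ((r ∷ []) ∷ [] ∷ []))))

choose : ∀ {m} → (Fin m → Bool) → Fin m → Fin m
choose f d with any? (λ i → f i ≟ᵇ true)
... | yes (i , _) = i
... | no _        = d

choose-spec : ∀ {m} (f : Fin m → Bool) d → 1 ≤ # f → f (choose f d) ≡ true
choose-spec f d p with any? (λ i → f i ≟ᵇ true)
... | yes (i , q) = q
... | no q        = ⊥-elim (q (#-pos p))

-- Cliques

module Cliques {n : ℕ} (G : Graph n) where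

  infix 4 _~_
  _~_ : Fin n → Fin n → Set
  u ~ v = adj G u v ≡ true

  ~-sym : ∀ {u v} → u ~ v → v ~ u
  ~-sym {u} {v} p = trans (≡sym (sym G u v)) p

  ~-irr : ∀ {u} → ¬ u ~ u
  ~-irr {u} p = clash p (irrefl G u)

  ~⇒≢ : ∀ {u v} → u ~ v → u ≢ v
  ~⇒≢ p refl = ~-irr p

  record Clique (s : ℕ) (P : Fin n → Set) : Set where
    constructor clique
    field
      vertex   : Fin s → Fin n
      adjacent : ∀ i j → i ≢ j → vertex i ~ vertex j
      member   : ∀ i → P (vertex i)
  open Clique public

  clique-map : ∀ {s} {P Q : Fin n → Set} → (∀ t → P t → Q t) → Clique s P → Clique s Q
  clique-map h (clique f a p) = clique f a (λ i → h _ (p i))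

  clique-drop : ∀ {s} {P : Fin n → Set} (g : Clique (suc s) P) i → Clique s (λ t → P t × t ~ vertex g i)
  clique-drop (clique f a p) i = clique (f ∘ punchIn i) (λ j k j≢k → a _ _ (λ e → j≢k (punchIn-injective i j k e)))
    (λ j → p _ , a _ _ (punchInᵢ≢i i j))

  clique-cons : ∀ {s} {P : Fin n → Set} u → P u → Clique s (λ t → P t × t ~ u) → Clique (suc s) P
  clique-cons {s} {P} u pu (clique f a p) = clique g ga gp
    where
    g : Fin (suc s) → Fin n
    g zero    = u
    g (suc i) = f i
    ga : ∀ i j → i ≢ j → g i ~ g j
    ga zero    zero    q = ⊥-elim (q refl)
    ga zero    (suc j) q = ~-sym (proj₂ (p j))
    ga (suc i) zero    q = proj₂ (p i)
    ga (suc i) (suc j) q = a i j (q ∘ cong suc)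
    gp : ∀ i → P (g i)
    gp zero    = pu
    gp (suc i) = proj₁ (p i)

  clique⇒K : ∀ {s} {P : Fin n → Set} → Clique s P → ContainsK s (adj G)
  clique⇒K (clique f a p) = f , inj , a
    where
    inj : ∀ {i j} → f i ≡ f j → i ≡ j
    inj {i} {j} e with i ≟ j
    ... | yes q = q
    ... | no q = ⊥-elim (~⇒≢ (a i j q) e)

  clique-of-list : ∀ xs → AllPairs _~_ xs → Clique (length xs) (λ t → t ∈ xs)
  clique-of-list [] [] = clique (λ ()) (λ ()) (λ ())
  clique-of-list (x ∷ xs) (a ∷ p) = clique-cons {P = λ t → t ∈ (x ∷ xs)} x (here refl)
    (clique-map {P = λ t → t ∈ xs} (λ t q → there q , ~-sym (All.lookup a q)) (clique-of-list xs p))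

  addEdge-off : ∀ {u v a b} → addEdge G u v a b ≡ true → ¬ (a ≡ u × b ≡ v) → ¬ (a ≡ v × b ≡ u) → a ~ b
  addEdge-off {u} {v} {a} {b} p q r with ∨-e {adj G a b} p
  ... | inj₁ s = s
  ... | inj₂ s with ∨-e {does (a ≟ u) ∧ does (b ≟ v)} s
  ...   | inj₁ t = ⊥-elim (q (does-e (a ≟ u) (∧-l t) , does-e (b ≟ v) (∧-r {does (a ≟ u)} t)))
  ...   | inj₂ t = ⊥-elim (r (does-e (a ≟ v) (∧-l t) , does-e (b ≟ u) (∧-r {does (a ≟ v)} t)))

  -- A new clique must use both ends of the added edge, since otherwise it is a clique of `G`. Its
  -- other `s` vertices, indexed through two `punchIn`s, are joined to each other and to both ends
  -- by old edges.
  common-clique : ∀ {s u v} → ¬ ContainsK (suc (suc s)) (adj G) → u ≢ v →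
    ContainsK (suc (suc s)) (addEdge G u v) → Clique s (λ t → u ~ t × v ~ t)
  common-clique {s} {u} {v} noK u≢v (f , inj , a) with any? (λ i → f i ≟ u) | any? (λ i → f i ≟ v)
  ... | no q | _ = ⊥-elim (noK (f , inj , λ x y x≢y → addEdge-off (a x y x≢y) (λ { (e , _) → q (x , e) }) (λ { (_ , e) → q (y , e) })))
  ... | yes _ | no q = ⊥-elim (noK (f , inj , λ x y x≢y → addEdge-off (a x y x≢y) (λ { (_ , e) → q (y , e) }) (λ { (e , _) → q (x , e) })))
  ... | yes (i , fi) | yes (j , fj) = clique (f ∘ g) adjs (λ k → edge i fi g≢i k , edge j fj g≢j k)
    where
    i≢j : i ≢ j
    i≢j refl = u≢v (trans (≡sym fi) fj)
    j′ = punchOut i≢j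
    g : Fin s → Fin (suc (suc s))
    g k = punchIn i (punchIn j′ k)
    g≢i : ∀ k → g k ≢ i
    g≢i k = punchInᵢ≢i i (punchIn j′ k)
    g≢j : ∀ k → g k ≢ j
    g≢j k e = punchInᵢ≢i j′ k (punchIn-injective i _ _ (trans e (≡sym (punchIn-punchOut i≢j))))
    fg≢u : ∀ k → f (g k) ≢ u
    fg≢u k e = g≢i k (inj (trans e (≡sym fi)))
    fg≢v : ∀ k → f (g k) ≢ v
    fg≢v k e = g≢j k (inj (trans e (≡sym fj)))
    off : ∀ k b → addEdge G u v (f (g k)) b ≡ true → f (g k) ~ b
    off k b p = addEdge-off p (fg≢u k ∘ proj₁) (fg≢v k ∘ proj₁)
    adjs : ∀ k l → k ≢ l → f (g k) ~ f (g l)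
    adjs k l k≢l = off k _ (a _ _ (λ e → k≢l (punchIn-injective j′ k l (punchIn-injective i _ _ e))))
    edge : ∀ m {w} → f m ≡ w → (∀ k → g k ≢ m) → ∀ k → w ~ f (g k)
    edge m refl q k = ~-sym (off k _ (a _ _ (q k)))

-- Explicit bounds; ρ is r - 3 and K bounds the number of vertices that a trace fails to dominate

opaque
  one-bound inner-ramsey outer-ramsey sequence-bound kill-bound core-bound three-bound few-bound : ℕ → ℕ → ℕ
  one-bound ρ K = (3 + ρ) * suc (K * 2 ^ K)
  inner-ramsey ρ K = 2 ^ (3 + ρ + 2)
  outer-ramsey ρ K = 2 ^ (3 + ρ + inner-ramsey ρ K)
  sequence-bound ρ K = outer-ramsey ρ K + suc K * 4
  kill-bound ρ K = K + (suc K * K + K)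
  core-bound ρ K = sequence-bound ρ K * suc (K * one-bound ρ K) + kill-bound ρ K * one-bound ρ K
  three-bound ρ K = 2 ^ (3 * suc ρ + 9) * (core-bound ρ K * 3)
  few-bound ρ K = K + 2 ^ (4 + ρ) * (2 ^ K + one-bound ρ K + one-bound ρ K + three-bound ρ K)

  one-bound-def : ∀ ρ K → one-bound ρ K ≡ (3 + ρ) * suc (K * 2 ^ K)
  one-bound-def ρ K = refl
  inner-ramsey-def : ∀ ρ K → inner-ramsey ρ K ≡ 2 ^ (3 + ρ + 2)
  inner-ramsey-def ρ K = refl
  outer-ramsey-def : ∀ ρ K → outer-ramsey ρ K ≡ 2 ^ (3 + ρ + inner-ramsey ρ K)
  outer-ramsey-def ρ K = refl
  sequence-bound-def : ∀ ρ K → sequence-bound ρ K ≡ outer-ramsey ρ K + suc K * 4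
  sequence-bound-def ρ K = refl
  kill-bound-def : ∀ ρ K → kill-bound ρ K ≡ K + (suc K * K + K)
  kill-bound-def ρ K = refl
  core-bound-def : ∀ ρ K → core-bound ρ K ≡ sequence-bound ρ K * suc (K * one-bound ρ K) + kill-bound ρ K * one-bound ρ K
  core-bound-def ρ K = refl
  three-bound-def : ∀ ρ K → three-bound ρ K ≡ 2 ^ (3 * suc ρ + 9) * (core-bound ρ K * 3)
  three-bound-def ρ K = refl
  few-bound-def : ∀ ρ K → few-bound ρ K ≡ K + 2 ^ (4 + ρ) * (2 ^ K + one-bound ρ K + one-bound ρ K + three-bound ρ K)
  few-bound-def ρ K = refl

-- Traces of vertices on a core C

module Traces {n : ℕ} (G : Graph n) (ρ : ℕ) (sat : KSaturated (3 + ρ) G) (tf : TwinFree G)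
              (C : Fin n → Bool) (K : ℕ) where
  open Cliques G

  noClique : ∀ {P : Fin n → Set} → Clique (3 + ρ) P → ⊥
  noClique c = proj₁ sat (clique⇒K c)

  noClique-list : ∀ xs → length xs ≡ 3 + ρ → AllPairs _~_ xs → ⊥
  noClique-list xs len p = noClique (subst (λ l → Clique l (_∈ xs)) len (clique-of-list xs p))

  ban2 : ∀ {u v} → u ~ v → Clique (suc ρ) (λ t → u ~ t × v ~ t) → ⊥
  ban2 {u} {v} uv c = noClique {λ _ → ⊤} (clique-cons u tt (clique-cons v (tt , ~-sym uv)
    (clique-map (λ { t (ut , vt) → (tt , ~-sym ut) , ~-sym vt }) c)))

  ban3 : ∀ {u v w} → u ~ v → u ~ w → v ~ w → Clique ρ (λ t → u ~ t × v ~ t × w ~ t) → ⊥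
  ban3 {u} {v} {w} uv uw vw c = ban2 uv (clique-cons w (uw , vw)
    (clique-map (λ { t (ut , vt , wt) → (ut , vt) , ~-sym wt }) c))

  common : ∀ {u v} → u ≢ v → adj G u v ≡ false → Clique (suc ρ) (λ t → u ~ t × v ~ t)
  common u≢v na = common-clique (proj₁ sat) u≢v (proj₂ sat _ _ u≢v na)

  opaque
    -- Chosen so that a vertex beyond this set is different from `w` and non-adjacent to it, and
    -- shares only core vertices with it as common neighbours.
    exc : Fin n → Fin n → Bool
    exc w u = does (u ≟ w) ∨ (adj G w u ∨ anyB (λ t → (adj G w t ∧ not (C t)) ∧ adj G t u))

    exc-def : ∀ w u → exc w u ≡ does (u ≟ w) ∨ (adj G w u ∨ anyB (λ t → (adj G w t ∧ not (C t)) ∧ adj G t u))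
    exc-def w u = refl

    exc-self : ∀ {w} → exc w w ≡ true
    exc-self {w} = ∨-l (does-i (w ≟ w) refl)

    exc-adj : ∀ {w u} → w ~ u → exc w u ≡ true
    exc-adj {w} {u} p = ∨-r {does (u ≟ w)} (∨-l p)

    exc-via : ∀ {w u} t → w ~ t → C t ≡ false → t ~ u → exc w u ≡ true
    exc-via {w} {u} t wt ct tu = ∨-r {does (u ≟ w)} (∨-r {adj G w u}
      (anyB-i {f = λ t → (adj G w t ∧ not (C t)) ∧ adj G t u} t (∧-i (∧-i wt (not-i ct)) tu)))

  S : Fin n → Fin n → Bool
  S w u = adj G w u ∧ C u

  -- Saturation supplies a clique of size r - 2 in the common neighbourhood; a member outside `C`
  -- would put `u` into `exc w`.
  dominated : ∀ {w u} → exc w u ≡ false → Clique (suc ρ) (λ t → S w t ≡ true × u ~ t)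
  dominated {w} {u} e = clique-map h (common w≢u na)
    where
    w≢u : w ≢ u
    w≢u refl = clash exc-self e
    na : adj G w u ≡ false
    na = ¬true⇒false (λ p → clash (exc-adj p) e)
    h : ∀ t → w ~ t × u ~ t → S w t ≡ true × u ~ t
    h t (wt , ut) with decide (C t)
    ... | inj₁ p = ∧-i wt p , ut
    ... | inj₂ p = ⊥-elim (clash (exc-via t wt p (~-sym ut)) e)

  Good : (Fin n → Bool) → Set
  Good B = ∀ v → B v ≡ true → # (exc v) ≤ K

  -- Fix a member `w₀`. A vertex outside `C` and `exc w₀` sees an (r - 2)-clique of the common
  -- trace, so a member adjacent to it would complete a K_r. Members thus differ only inside
  -- `exc w₀`, and twin-freeness leaves at most `2 ^ K` of them.
  same-trace : ∀ B → Good B → (∀ v w → B v ≡ true → B w ≡ true → ∀ u → C u ≡ true → adj G v u ≡ adj G w u) →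
    # B ≤ 2 ^ K
  same-trace B good eq with 1 ≤? # B
  ... | no q = ≤-trans (≤-pred (≰⇒> q)) z≤n
  ... | yes q with #-pos q
  ...   | w₀ , b₀ = ≤-trans (#-traces B (exc w₀) (adj G) inj) (^-monoʳ-≤ 2 (good w₀ b₀))
    where
    off : ∀ v → B v ≡ true → ∀ x → C x ≡ false → exc w₀ x ≡ false → adj G v x ≡ false
    off v bv x cx ex = ¬true⇒false (λ vx → ban2 vx
      (clique-map (λ { t (st , xt) → trans (eq v w₀ bv b₀ t (∧-r {adj G w₀ t} st)) (∧-l st) , xt }) (dominated ex)))
    inj : ∀ v w → B v ≡ true → B w ≡ true → (∀ u → exc w₀ u ≡ true → adj G v u ≡ adj G w u) → v ≡ w
    inj v w bv bw ag with v ≟ w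
    ... | yes p = p
    ... | no p = ⊥-elim (tf v w (p , twin))
      where
      twin : ∀ x → adj G v x ≡ adj G w x
      twin x with decide (exc w₀ x) | decide (C x)
      ... | inj₁ e | _ = ag x e
      ... | inj₂ e | inj₁ c = eq v w bv bw x c
      ... | inj₂ e | inj₂ c = trans (off v bv x c e) (≡sym (off w bw x c e))

  R : (Fin n → Bool) → Fin n → Fin n → Bool
  R J w u = S w u ∧ not (J u)

  R⇒~ : ∀ {J w u} → R J w u ≡ true → w ~ u
  R⇒~ {J} {w} {u} p = ∧-l (∧-l {S w u} p)

  R⇒C : ∀ {J w u} → R J w u ≡ true → C u ≡ true
  R⇒C {J} {w} {u} p = ∧-r {adj G w u} (∧-l {S w u} p)

  S⇒J⊎R : ∀ {J w u} → S w u ≡ true → J u ≡ true ⊎ R J w u ≡ true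
  S⇒J⊎R {J} {w} {u} p with decide (J u)
  ... | inj₁ q = inj₁ q
  ... | inj₂ q = inj₂ (∧-i p (not-i q))

  -- A `k`-uniform system of remainders over a kernel `J`; `link` lowers `k` by moving an element
  -- into the kernel.
  record Family (J : Fin n → Bool) (k : ℕ) (B : Fin n → Bool) : Set where
    field
      good : Good B
      base : ∀ v → B v ≡ true → ∀ u → J u ≡ true → S v u ≡ true
      size : ∀ v → B v ≡ true → # (R J v) ≡ k
  open Family

  _∪_ : (Fin n → Bool) → Fin n → Fin n → Bool
  (J ∪ x) u = J u ∨ does (u ≟ x)

  R-∪ : ∀ {J x w u} → R J w u ≡ true → u ≢ x → R (J ∪ x) w u ≡ true
  R-∪ {J} {x} {w} {u} p q = ∧-i (∧-l {S w u} p) (not-i (¬true⇒false λ r → lem (∨-e {J u} r)))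
    where
    lem : J u ≡ true ⊎ does (u ≟ x) ≡ true → ⊥
    lem (inj₁ j) = clash j (not-e (∧-r {S w u} p))
    lem (inj₂ e) = q (does-e (u ≟ x) e)

  link : ∀ {J k B} x → Family J (suc k) B → Family (J ∪ x) k (λ w → B w ∧ R J w x)
  link {J} {k} {B} x F = record
    { good = λ v p → good F v (∧-l p)
    ; base = λ v p u j → b v p u (∨-e {J u} j)
    ; size = λ v p → sz v (∧-l p) (∧-r {B v} p) }
    where
    b : ∀ v → B v ∧ R J v x ≡ true → ∀ u → J u ≡ true ⊎ does (u ≟ x) ≡ true → S v u ≡ true
    b v p u (inj₁ j) = base F v (∧-l p) u j
    b v p u (inj₂ e) with does-e (u ≟ x) e
    ... | refl = ∧-l {S v x} (∧-r {B v} p)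
    sz : ∀ v → B v ≡ true → R J v x ≡ true → # (R (J ∪ x) v) ≡ k
    sz v bv rx = cong pred (trans (≡sym (trans (#-del (R J v) x rx) (cong suc (#-cong eq)))) (size F v bv))
      where
      lem : ∀ a b c → (a ∧ not b) ∧ not c ≡ a ∧ not (b ∨ c)
      lem true true c = refl
      lem true false c = refl
      lem false b c = refl
      eq : ∀ u → R J v u ∧ not (does (u ≟ x)) ≡ R (J ∪ x) v u
      eq u = lem (S v u) (J u) (does (u ≟ x))

  c₁ seqLen killLen multiplicity ramsey₁ ramsey₂ : ℕ
  c₁ = one-bound ρ K
  ramsey₁ = inner-ramsey ρ K
  ramsey₂ = outer-ramsey ρ K
  seqLen = sequence-bound ρ K
  killLen = kill-bound ρ K
  multiplicity = core-bound ρ K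

  -- Distinct one-point extensions of a common trace are adjacent, so fewer than r of them are generic.
  family₁ : ∀ {J B} → Family J 1 B → # B ≤ c₁
  family₁ {J} {B} F with c₁ ≤? # B
  ... | no q = <⇒≤ (≰⇒> q)
  ... | yes q = ⊥-elim (refute (generic-sequence (R J) exc (2 ^ K) K (3 + ρ) B hit (good F) (subst (_≤ # B) (one-bound-def ρ K) q)))
    where
    -- Members with the same extra element have the same trace.
    hit : ∀ u → # (λ w → B w ∧ R J w u) ≤ 2 ^ K
    hit u = same-trace _ (λ v p → good F v (∧-l p)) eq
      where
      half : ∀ v w → B v ∧ R J v u ≡ true → B w ∧ R J w u ≡ true → ∀ x → C x ≡ true → v ~ x → w ~ x
      half v w p q x cx vx with S⇒J⊎R {J} {v} {x} (∧-i vx cx)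
      ... | inj₁ j = ∧-l (base F w (∧-l q) x j)
      ... | inj₂ r with #≡1-unique {f = R J v} (size F v (∧-l p)) r (∧-r {B v} p)
      ...   | refl = R⇒~ {J} (∧-r {B w} q)
      eq : ∀ v w → B v ∧ R J v u ≡ true → B w ∧ R J w u ≡ true → ∀ x → C x ≡ true → adj G v x ≡ adj G w x
      eq v w p q x cx = bool-ext (half v w p q x cx) (half w v q p x cx)
    z : Fin n → Fin n
    z w = choose (R J w) w
    zR : ∀ {w} → B w ≡ true → R J w (z w) ≡ true
    zR {w} b = choose-spec (R J w) w (≤-reflexive (≡sym (size F w b)))
    linked : ∀ {w w′} → B w ≡ true → B w′ ≡ true → exc w (z w′) ≡ false → z w ~ z w′
    linked {w} {w′} b b′ e with decide (adj G (z w) (z w′))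
    ... | inj₁ p = p
    -- The clique that `z w′` sees in the trace of `w` would avoid `z w`, so it would lie in `J` and
    -- extend by `w′` and `z w′` to a K_r.
    ... | inj₂ p = ⊥-elim (ban2 (R⇒~ {J} (zR b′)) (clique-map h (dominated e)))
      where
      h : ∀ t → S w t ≡ true × z w′ ~ t → w′ ~ t × z w′ ~ t
      h t (st , zt) with S⇒J⊎R {J} {w} {t} st
      ... | inj₁ j = ∧-l (base F w′ b′ t j) , zt
      ... | inj₂ r with #≡1-unique {f = R J w} (size F w b) r (zR b)
      ...   | refl = ⊥-elim (clash (~-sym zt) p)
    pairs : ∀ ws → All (λ w → B w ≡ true) ws → AllPairs (λ w w′ → ∀ u → R J w′ u ≡ true → exc w u ≡ false) ws →
      AllPairs (λ w w′ → z w ~ z w′) ws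
    pairs [] [] [] = []
    pairs (w ∷ ws) (b ∷ bs) (g ∷ gs) = All.zipWith (λ { (b′ , e) → linked b b′ (e _ (zR b′)) }) (bs , g) ∷ pairs ws bs gs
    refute : (∃ λ ws → length ws ≡ 3 + ρ × All (λ w → B w ≡ true) ws ×
      AllPairs (λ w w′ → ∀ u → R J w′ u ≡ true → exc w u ≡ false) ws) → ⊥
    refute (ws , len , inB , gen) = noClique-list (map z ws) (trans (length-map z ws) len) (APP.map⁺ (pairs ws inB gen))

  family₀ : ∀ {J B} → Family J 0 B → # B ≤ 2 ^ K
  family₀ {J} {B} F = same-trace B (good F) (λ v w p q x cx → bool-ext (half v w p q x cx) (half w v q p x cx))
    where
    half : ∀ v w → B v ≡ true → B w ≡ true → ∀ x → C x ≡ true → v ~ x → w ~ x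
    half v w p q x cx vx with S⇒J⊎R {J} {v} {x} (∧-i vx cx)
    ... | inj₁ j = ∧-l (base F w q x j)
    ... | inj₂ r = ⊥-elim (<⇒≱ (#-pos′ {f = R J v} x r) (≤-reflexive (size F v p)))

  -- Fixing one element of each remainder leaves remainders of size one; sum their bound over the
  -- core.
  family₂ : ∀ {J B} → Family J 2 B → # B ≤ # C * c₁
  family₂ {J} {B} F = ≤-trans (#-mono h) (#-anyB B C (R J) c₁ (λ u → family₁ (link u F)))
    where
    h : ∀ w → B w ≡ true → B w ∧ anyB (λ u → C u ∧ R J w u) ≡ true
    h w b with #-pos {f = R J w} (subst (0 <_) (≡sym (size F w b)) (s≤s z≤n))
    ... | u , r = ∧-i b (anyB-i {f = λ u → C u ∧ R J w u} u (∧-i (R⇒C {J} r) r))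

  -- Two fixed elements leave a one-element remainder. This bound is what lets a large star through
  -- `x` contain a sunflower.
  codegree : ∀ {J B} → Family J 3 B → ∀ x u → u ≢ x → # (λ w → (B w ∧ R J w x) ∧ R J w u) ≤ c₁
  codegree {J} {B} F x u u≢x = ≤-trans
    (#-mono (λ w p → ∧-i {B w ∧ R J w x} (∧-l p) (R-∪ {J} {x} {w} {u} (∧-r {B w ∧ R J w x} p) u≢x)))
    (family₁ (link u (link x F)))

  -- Lets the (r - 3)-cliques shared by any two of three vertices be replaced by one shared by all
  -- three. It is proved below when `J` is a clique of size r - 2; for r = 3 it only asks for an
  -- empty clique.
  Helly : (Fin n → Bool) → Set
  Helly J = ∀ (A : Fin 3 → Fin n) → (∀ j k → j ≢ k → Clique ρ (λ t → J t ≡ true × A j ~ t × A k ~ t)) →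
    (∀ j → Clique (suc ρ) (λ t → J t ≡ true × A j ~ t) → ⊥) → Clique ρ (λ t → J t ≡ true × (∀ j → A j ~ t))

  -- An assignment of roles to the three positions: `i` is the one that petals share, `j` and `k`
  -- are the others in a chosen order.
  record Perm (i j k : Fin 3) : Set where
    constructor perm
    field
      i≢j : i ≢ j
      i≢k : i ≢ k
      j≢k : j ≢ k
      all : ∀ l → l ≡ i ⊎ l ≡ j ⊎ l ≡ k

  p₀ : Perm zero (suc zero) (suc (suc zero))
  p₀ = perm (λ ()) (λ ()) (λ ()) λ { zero → inj₁ refl ; (suc zero) → inj₂ (inj₁ refl) ; (suc (suc zero)) → inj₂ (inj₂ refl) }

  p₁ : Perm (suc zero) zero (suc (suc zero))
  p₁ = perm (λ ()) (λ ()) (λ ()) λ { zero → inj₂ (inj₁ refl) ; (suc zero) → inj₁ refl ; (suc (suc zero)) → inj₂ (inj₂ refl) }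

  p₂ : Perm (suc (suc zero)) zero (suc zero)
  p₂ = perm (λ ()) (λ ()) (λ ()) λ { zero → inj₂ (inj₁ refl) ; (suc zero) → inj₂ (inj₂ refl) ; (suc (suc zero)) → inj₁ refl }

  #-none : ∀ {f : Fin n → Bool} → (∀ u → f u ≡ false) → # f ≡ 0
  #-none h = n≤0⇒n≡0 (≮⇒≥ (λ q → let u , p = #-pos q in clash p (h u)))

  -- Families whose traces exceed the base by three elements

  module Triples (J : Fin n → Bool) {B : Fin n → Bool} (F : Family J 3 B) where

    select : ∀ {f : Fin n → Bool} → Three f → Fin 3 → Fin n
    select t zero             = Three.x t
    select t (suc zero)       = Three.y t
    select t (suc (suc zero)) = Three.z t

    select-in : ∀ {f : Fin n → Bool} (t : Three f) i → f (select t i) ≡ true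
    select-in t zero             = Three.fx t
    select-in t (suc zero)       = Three.fy t
    select-in t (suc (suc zero)) = Three.fz t

    select-≢ : ∀ {f : Fin n → Bool} (t : Three f) i j → i ≢ j → select t i ≢ select t j
    select-≢ t zero zero q = ⊥-elim (q refl)
    select-≢ t zero (suc zero) q = Three.x≢y t
    select-≢ t zero (suc (suc zero)) q = Three.x≢z t
    select-≢ t (suc zero) zero q = Three.x≢y t ∘ ≡sym
    select-≢ t (suc zero) (suc zero) q = ⊥-elim (q refl)
    select-≢ t (suc zero) (suc (suc zero)) q = Three.y≢z t
    select-≢ t (suc (suc zero)) zero q = Three.x≢z t ∘ ≡sym
    select-≢ t (suc (suc zero)) (suc zero) q = Three.y≢z t ∘ ≡sym
    select-≢ t (suc (suc zero)) (suc (suc zero)) q = ⊥-elim (q refl)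

    select-all : ∀ {f : Fin n → Bool} (t : Three f) u → f u ≡ true → ∃ λ i → u ≡ select t i
    select-all t u p with Three.cover t u p
    ... | inj₁ e = zero , e
    ... | inj₂ (inj₁ e) = suc zero , e
    ... | inj₂ (inj₂ e) = suc (suc zero) , e

    opaque
      -- A fixed numbering of the remainder; `w` itself is a junk value where the remainder does not
      -- have three elements.
      pos : Fin 3 → Fin n → Fin n
      pos i w with # (R J w) ≟ℕ 3
      ... | yes e = select (#-three (R J w) e) i
      ... | no _  = w

      pos-R : ∀ {w} i → B w ≡ true → R J w (pos i w) ≡ true
      pos-R {w} i b with # (R J w) ≟ℕ 3
      ... | yes e = select-in (#-three (R J w) e) i
      ... | no q  = ⊥-elim (q (size F w b))

      pos-≢ : ∀ {w} → B w ≡ true → ∀ i j → i ≢ j → pos i w ≢ pos j w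
      pos-≢ {w} b i j p with # (R J w) ≟ℕ 3
      ... | yes e = select-≢ (#-three (R J w) e) i j p
      ... | no q  = ⊥-elim (q (size F w b))

      pos-all : ∀ {w} → B w ≡ true → ∀ u → R J w u ≡ true → ∃ λ i → u ≡ pos i w
      pos-all {w} b u r with # (R J w) ≟ℕ 3
      ... | yes e = select-all (#-three (R J w) e) u r
      ... | no q  = ⊥-elim (q (size F w b))

    S-cases : ∀ {i j k} → Perm i j k → ∀ {w t} → B w ≡ true → S w t ≡ true →
      J t ≡ true ⊎ t ≡ pos i w ⊎ t ≡ pos j w ⊎ t ≡ pos k w
    S-cases π {w} {t} b s with S⇒J⊎R {J} {w} {t} s
    ... | inj₁ q = inj₁ q
    ... | inj₂ r with pos-all b t r
    ...   | l , e with Perm.all π l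
    ...     | inj₁ refl = inj₂ (inj₁ e)
    ...     | inj₂ (inj₁ refl) = inj₂ (inj₂ (inj₁ e))
    ...     | inj₂ (inj₂ refl) = inj₂ (inj₂ (inj₂ e))

    -- The situation after homogenizing and peeling: the adjacencies from positions to `J` and
    -- between positions are the same for all members, and every element in use is popular at its
    -- position. It is refuted by `contradiction`.
    module Core (helly : Helly J) {B₂ : Fin n → Bool} (sub : ∀ v → B₂ v ≡ true → B v ≡ true)
      (hJ : ∀ i u → J u ≡ true → ∀ v w → B₂ v ≡ true → B₂ w ≡ true → adj G (pos i v) u ≡ adj G (pos i w) u)
      (hP : ∀ i j v w → B₂ v ≡ true → B₂ w ≡ true → adj G (pos i v) (pos j v) ≡ adj G (pos i w) (pos j w))
      (v₀ : Fin n) (b₀ : B₂ v₀ ≡ true)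
      (big : ∀ v i → B₂ v ≡ true → multiplicity < # (λ w → B₂ w ∧ does (pos i w ≟ pos i v))) where

      hits : Fin n → Fin n → Fin n → Bool
      hits x w u = R J w u ∧ not (does (u ≟ x))

      Gen : Fin n → Fin n → Fin n → Set
      Gen x w w′ = ∀ u → hits x w′ u ≡ true → exc w u ≡ false

      Petal : Fin 3 → Fin n → (Fin n → Bool) → Fin n → Set
      Petal i x A w = B₂ w ≡ true × pos i w ≡ x × (∀ u → hits x w u ≡ true → A u ≡ false)

      -- A popular element is the centre of a long sunflower: any other element lies in at most `c₁`
      -- of the members through it, so few of them meet `A` and the greedy choice works in the rest.
      -- `core-bound` adds up the two costs.
      petals : ∀ v i → B₂ v ≡ true → ∀ L A → # A ≤ killLen → L ≤ seqLen →
        ∃ λ ws → length ws ≡ L × All (Petal i (pos i v) A) ws × AllPairs (Gen (pos i v)) ws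
      petals v i bv L A #A L≤ with generic-sequence (hits x) exc c₁ K L E hit (λ w p → good F w (sub w (∧-l (∧-l {E₀ w} p)))) le
        where
        x = pos i v
        E₀ bad E : Fin n → Bool
        E₀ w = B₂ w ∧ does (pos i w ≟ x)
        bad w = anyB (λ u → A u ∧ hits x w u)
        E w = E₀ w ∧ not (bad w)
        hit₀ : ∀ u → # (λ w → E₀ w ∧ hits x w u) ≤ c₁
        hit₀ u = go (u ≟ x)
          where
          h : u ≢ x → ∀ w → E₀ w ∧ hits x w u ≡ true → (B w ∧ R J w x) ∧ R J w u ≡ true
          h u≢x w p = ∧-i (∧-i bw (subst (λ y → R J w y ≡ true) (does-e (pos i w ≟ x) (∧-r {B₂ w} (∧-l {E₀ w} p))) (pos-R i bw)))
                      (∧-l {R J w u} (∧-r {E₀ w} p))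
            where
            bw = sub w (∧-l (∧-l {E₀ w} p))
          go : Dec (u ≡ x) → # (λ w → E₀ w ∧ hits x w u) ≤ c₁
          go (yes e) = ≤-trans (≤-reflexive (#-none (λ w → ¬true⇒false (λ p → does-ne (u ≟ x) (not-e (∧-r {R J w u} (∧-r {E₀ w} p))) e)))) z≤n
          go (no u≢x) = ≤-trans (#-mono (h u≢x)) (codegree F x u u≢x)
        hit : ∀ u → # (λ w → E w ∧ hits x w u) ≤ c₁
        hit u = ≤-trans (#-mono (λ w p → ∧-i {E₀ w} (∧-l (∧-l {E w} p)) (∧-r {E w} p))) (hit₀ u)
        le : L * suc (K * c₁) ≤ # E
        le = +-cancelʳ-≤ (killLen * c₁) _ _ (begin
          L * suc (K * c₁) + killLen * c₁        ≤⟨ +-monoˡ-≤ _ (*-monoˡ-≤ (suc (K * c₁)) L≤) ⟩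
          seqLen * suc (K * c₁) + killLen * c₁   ≡⟨ ≡sym (core-bound-def ρ K) ⟩
          multiplicity                           ≤⟨ <⇒≤ (big v i bv) ⟩
          # E₀                                   ≡⟨ #-split E₀ bad ⟩
          # (λ w → E₀ w ∧ bad w) + # E           ≤⟨ +-monoˡ-≤ (# E) (≤-trans (#-anyB E₀ A (hits x) c₁ hit₀) (*-monoˡ-≤ c₁ #A)) ⟩
          killLen * c₁ + # E                     ≡⟨ +-comm (killLen * c₁) (# E) ⟩
          # E + killLen * c₁ ∎)
          where open ≤-Reasoning
      ... | ws , len , inE , gen = ws , len , All.map conv inE , gen
        where
        conv : ∀ {w} → _ → Petal i (pos i v) A w
        conv {w} p = ∧-l (∧-l {B₂ w ∧ _} p) , does-e (pos i w ≟ pos i v) (∧-r {B₂ w} (∧-l {B₂ w ∧ _} p)) ,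
          (λ u h → ¬true⇒false (λ a → clash (anyB-i {f = λ u → A u ∧ hits (pos i v) w u} u (∧-i a h)) (not-e (∧-r {B₂ w ∧ does (pos i w ≟ pos i v)} p))))

      hits-pos : ∀ {i j x w} → B₂ w ≡ true → pos i w ≡ x → i ≢ j → hits x w (pos j w) ≡ true
      hits-pos {i} {j} {x} {w} b refl q = ∧-i (pos-R j (sub w b)) (not-i (does-ni (pos j w ≟ pos i w) (pos-≢ (sub w b) j i (q ∘ ≡sym))))

      pos~ : ∀ {w} i → B₂ w ≡ true → w ~ pos i w
      pos~ i b = R⇒~ {J} (pos-R i (sub _ b))

      -- `pos j w₂` sees an (r - 2)-clique in the trace of `w₁`. It contains `pos k w₁`, for
      -- otherwise it lies in `J` together with the shared element, hence in the trace of `w₂`, and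
      -- gives a K_r. Without `pos k w₁` it is the asserted clique, adjacent to `pos j w₁` by
      -- homogeneity; with `w₁` it forbids an edge between positions `j` and `k`.
      crown-step : ∀ {i j k} → Perm i j k → ∀ {w₁ w₂} → B₂ w₁ ≡ true → B₂ w₂ ≡ true → pos i w₂ ≡ pos i w₁ →
        Gen (pos i w₁) w₁ w₂ → adj G (pos j w₁) (pos j w₂) ≡ false →
        adj G (pos j w₁) (pos k w₁) ≡ false × Clique ρ (λ t → (J t ≡ true ⊎ t ≡ pos i w₁) × pos j w₁ ~ t × pos k w₁ ~ t)
      crown-step {i} {j} {k} π {w₁} {w₂} b₁ b₂ ex gen na with dominated {w₁} {pos j w₂} (gen (pos j w₂) (hits-pos b₂ ex (Perm.i≢j π)))
      ... | g with any? (λ a → vertex g a ≟ pos k w₁)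
      ...   | no none = ⊥-elim (ban2 (pos~ j b₂) (clique (vertex g) (adjacent g) h))
        where
        h : ∀ a → w₂ ~ vertex g a × pos j w₂ ~ vertex g a
        h a with member g a
        ... | s , yt with S-cases π (sub w₁ b₁) s
        ...   | inj₁ q = ∧-l (base F w₂ (sub w₂ b₂) _ q) , yt
        ...   | inj₂ (inj₁ e) = subst (w₂ ~_) (trans ex (≡sym e)) (pos~ i b₂) , yt
        ...   | inj₂ (inj₂ (inj₁ e)) = ⊥-elim (clash (~-sym (subst (pos j w₂ ~_) e yt)) na)
        ...   | inj₂ (inj₂ (inj₂ e)) = ⊥-elim (none (a , e))
      ...   | yes (a , ea) = nyz , clique-map (λ { t (p , q , _) → p , q }) cl
        where
        cl : Clique ρ (λ t → (J t ≡ true ⊎ t ≡ pos i w₁) × (pos j w₁ ~ t × pos k w₁ ~ t) × w₁ ~ t)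
        cl = clique-map h (clique-drop g a)
          where
          h : ∀ t → (S w₁ t ≡ true × pos j w₂ ~ t) × t ~ vertex g a → _
          h t ((s , yt) , tz′) with S-cases π (sub w₁ b₁) s
          ... | inj₁ q = inj₁ q , (trans (hJ j t q w₁ w₂ b₁ b₂) yt , subst (_~ t) ea (~-sym tz′)) , ∧-l s
          ... | inj₂ (inj₁ e) = inj₂ e , (subst (pos j w₁ ~_) (≡sym e) (trans (hP j i w₁ w₂ b₁ b₂) (subst (pos j w₂ ~_) (trans e (≡sym ex)) yt)) , subst (_~ t) ea (~-sym tz′)) , ∧-l s
          ... | inj₂ (inj₂ (inj₁ e)) = ⊥-elim (clash (~-sym (subst (pos j w₂ ~_) e yt)) na)
          ... | inj₂ (inj₂ (inj₂ e)) = ⊥-elim (~⇒≢ tz′ (trans e (≡sym ea)))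
        nyz : adj G (pos j w₁) (pos k w₁) ≡ false
        nyz = ¬true⇒false (λ yz → ban3 (pos~ j b₁) (pos~ k b₁) yz (clique-map (λ { t (_ , (yt , zt) , wt) → wt , yt , zt }) cl))

      -- No r vertices are pairwise adjacent, so Ramsey's theorem, used for position `j` and then
      -- for position `k`, finds two petals to which `crown-step` applies.
      crown : ∀ {i j k} → Perm i j k → ∀ v → B₂ v ≡ true → ∃ λ w → B₂ w ≡ true ×
        adj G (pos j w) (pos k w) ≡ false × Clique ρ (λ t → (J t ≡ true ⊎ t ≡ pos i w) × pos j w ~ t × pos k w ~ t)
      crown {i} {j} {k} π v bv with petals v i bv ramsey₂ (λ _ → false) (≤-trans (≤-reflexive (#-none (λ _ → refl))) z≤n) (subst (ramsey₂ ≤_) (≡sym (sequence-bound-def ρ K)) (m≤m+n _ _))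
      ... | ws , len , al , gen with ramsey (λ w w′ → adj G (pos j w) (pos j w′)) (3 + ρ) ramsey₁ ws (≤-reflexive (trans (≡sym (outer-ramsey-def ρ K)) (≡sym len)))
      ...   | inj₁ (ys , _ , ly , cl) = ⊥-elim (noClique-list (map (pos j) ys) (trans (length-map (pos j) ys) ly) (APP.map⁺ cl))
      ...   | inj₂ (ys , sy , ly , na) with ramsey (λ w w′ → adj G (pos k w) (pos k w′)) (3 + ρ) 2 ys (≤-reflexive (trans (≡sym (inner-ramsey-def ρ K)) (≡sym ly)))
      ...     | inj₁ (zs , _ , lz , cl) = ⊥-elim (noClique-list (map (pos k) zs) (trans (length-map (pos k) zs) lz) (APP.map⁺ cl))
      ...     | inj₂ ((w₁ ∷ w₂ ∷ []) , sz , refl , _) with AllPairs-⊆ sz na | All-resp-⊆ (⊆-trans sz sy) al | AllPairs-⊆ (⊆-trans sz sy) gen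
      ...       | ((n₁₂ ∷ []) ∷ _) | ((b₁ , e₁ , _) ∷ (b₂ , e₂ , _) ∷ []) | ((g₁₂ ∷ []) ∷ _) =
                  w₁ , b₁ , crown-step π b₁ b₂ (trans e₂ (≡sym e₁)) (subst (λ x → Gen x w₁ w₂) (≡sym e₁) g₁₂) n₁₂

      -- A crown shows the non-adjacency at one member, and homogeneity transfers it to all.
      eps : ∀ {v} → B₂ v ≡ true → ∀ j k → adj G (pos j v) (pos k v) ≡ false
      eps {v} bv j k = go j k
        where
        from : ∀ {i j k} → Perm i j k → adj G (pos j v) (pos k v) ≡ false
        from {i} {j} {k} π with crown π v bv
        ... | w , bw , na , _ = trans (hP j k v w bv bw) na
        flip : ∀ {j k} → adj G (pos j v) (pos k v) ≡ false → adj G (pos k v) (pos j v) ≡ false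
        flip e = trans (sym G _ _) e
        go : ∀ j k → adj G (pos j v) (pos k v) ≡ false
        go zero zero = irrefl G _
        go zero (suc zero) = from p₂
        go zero (suc (suc zero)) = from p₁
        go (suc zero) zero = flip (from p₂)
        go (suc zero) (suc zero) = irrefl G _
        go (suc zero) (suc (suc zero)) = from p₀
        go (suc (suc zero)) zero = flip (from p₁)
        go (suc (suc zero)) (suc zero) = flip (from p₀)
        go (suc (suc zero)) (suc (suc zero)) = irrefl G _

      Pt : Fin n → Set
      Pt u = ∃ λ w → ∃ λ i → B₂ w ≡ true × u ≡ pos i w

      -- By the crowns any two positions share an (r - 3)-clique, which by `eps` avoids the third
      -- position and so lies in `J`. The Helly property merges the three cliques, and homogeneity
      -- extends the result to all points. This is what makes the points span a triangle-free graph.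
      W : Clique ρ (λ t → J t ≡ true × (∀ u → Pt u → u ~ t))
      W = clique-map (λ { t (q , h) → q , (λ { u (w , i , b , refl) → trans (hJ i t q w v₀ b b₀) (h i) }) })
            (helly (λ i → pos i v₀) pair (λ j c → ban2 (pos~ j b₀) (clique-map (λ { t (q , p) → ∧-l (base F v₀ (sub v₀ b₀) t q) , p }) c)))
        where
        from : ∀ {i j k} → Perm i j k → Clique ρ (λ t → J t ≡ true × pos j v₀ ~ t × pos k v₀ ~ t)
        from {i} {j} {k} π with crown π v₀ b₀
        ... | w , bw , _ , cl = clique-map h cl
          where
          h : ∀ t → (J t ≡ true ⊎ t ≡ pos i w) × pos j w ~ t × pos k w ~ t → J t ≡ true × pos j v₀ ~ t × pos k v₀ ~ t
          h t (inj₁ q , yt , zt) = q , trans (hJ j t q v₀ w b₀ bw) yt , trans (hJ k t q v₀ w b₀ bw) zt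
          h t (inj₂ refl , yt , zt) = ⊥-elim (clash yt (eps bw j i))
        flip : ∀ {j k} → Clique ρ (λ t → J t ≡ true × pos j v₀ ~ t × pos k v₀ ~ t) → Clique ρ (λ t → J t ≡ true × pos k v₀ ~ t × pos j v₀ ~ t)
        flip = clique-map (λ { t (a , b , c) → a , c , b })
        pair : ∀ j k → j ≢ k → Clique ρ (λ t → J t ≡ true × pos j v₀ ~ t × pos k v₀ ~ t)
        pair zero zero q = ⊥-elim (q refl)
        pair zero (suc zero) q = from p₂
        pair zero (suc (suc zero)) q = from p₁
        pair (suc zero) zero q = flip (from p₂)
        pair (suc zero) (suc zero) q = ⊥-elim (q refl)
        pair (suc zero) (suc (suc zero)) q = from p₀
        pair (suc (suc zero)) zero q = flip (from p₁)
        pair (suc (suc zero)) (suc zero) q = flip (from p₀)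
        pair (suc (suc zero)) (suc (suc zero)) q = ⊥-elim (q refl)

      triangle-free : ∀ {u v w} → Pt u → Pt v → Pt w → u ~ v → u ~ w → v ~ w → ⊥
      triangle-free pu pv pw uv uw vw = ban3 uv uw vw (clique-map (λ { t (_ , h) → h _ pu , h _ pv , h _ pw }) W)

      -- The clique that `u` sees in the trace of `w` cannot lie in `J`, because `J` also belongs to
      -- a trace that contains `u`. So it has an element among the three positions of `w`.
      dom : ∀ {i j k} → Perm i j k → ∀ {w u} → B₂ w ≡ true → Pt u → exc w u ≡ false → u ~ pos i w ⊎ u ~ pos j w ⊎ u ~ pos k w
      dom {i} {j} {k} π {w} {u} b (w′ , l , b′ , refl) e with dominated e
      ... | g with any? (λ a → J (vertex g a) ≟ᵇ false)
      ...   | no none = ⊥-elim (ban2 (pos~ l b′) (clique (vertex g) (adjacent g) (λ a → ∧-l (base F w′ (sub w′ b′) _ (inJ a)) , proj₂ (member g a))))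
        where
        inJ : ∀ a → J (vertex g a) ≡ true
        inJ a with decide (J (vertex g a))
        ... | inj₁ q = q
        ... | inj₂ q = ⊥-elim (none (a , q))
      ...   | yes (a , notJ) with member g a
      ...     | s , ut with S-cases π (sub w b) s
      ...       | inj₁ q = ⊥-elim (clash q notJ)
      ...       | inj₂ (inj₁ q) = inj₁ (subst (_ ~_) q ut)
      ...       | inj₂ (inj₂ (inj₁ q)) = inj₂ (inj₁ (subst (_ ~_) q ut))
      ...       | inj₂ (inj₂ (inj₂ q)) = inj₂ (inj₂ (subst (_ ~_) q ut))

      -- If `v₀` has the elements x, y, z in the roles `i`, `j`, `k`, then `a` sees y but not z, and
      -- `b` sees z but not y. Such petals at the three elements of `v₀` will close up to a
      -- triangle.
      record GoodPetal {i j k : Fin 3} (π : Perm i j k) (w : Fin n) : Set where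
        field
          inB₂  : B₂ w ≡ true
          a b   : Fin n
          pa    : Pt a
          pb    : Pt b
          ha    : hits (pos i v₀) w a ≡ true
          hb    : hits (pos i v₀) w b ≡ true
          a~y   : a ~ pos j v₀
          b~z   : b ~ pos k v₀
          a≁z   : ¬ a ~ pos k v₀
          b≁y   : ¬ b ~ pos j v₀
          covers : ∀ {u} → Pt u → exc w u ≡ false → u ~ pos i v₀ ⊎ u ~ a ⊎ u ~ b
      open GoodPetal

      pt : ∀ {w} → B₂ w ≡ true → ∀ i → Pt (pos i w)
      pt b i = _ , i , b , refl

      Petal₀ : Fin 3 → Fin n → Set
      Petal₀ i w = B₂ w ≡ true × pos i w ≡ pos i v₀ × (∀ u → hits (pos i v₀) w u ≡ true → exc v₀ u ≡ false)

      module _ {i j k : Fin 3} (π : Perm i j k) where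
        el : Bool → Fin 3
        el true  = j
        el false = k

        i≢el : ∀ s → i ≢ el s
        i≢el true  = Perm.i≢j π
        i≢el false = Perm.i≢k π

        P : Fin n → Bool → Fin n
        P w s = pos (el s) w

        hitP : ∀ {w} → Petal₀ i w → ∀ s → hits (pos i v₀) w (P w s) ≡ true
        hitP (b , e , _) s = hits-pos b e (i≢el s)

        not-x : ∀ {w} → Petal₀ i w → ∀ s → ¬ P w s ~ pos i v₀
        not-x {w} (b , e , _) s p = clash (subst (P w s ~_) (≡sym e) p) (eps b (el s) i)

        color : ∀ {w} → Petal₀ i w → ∀ s → P w s ~ pos j v₀ ⊎ P w s ~ pos k v₀
        color q s = [ (λ p → ⊥-elim (not-x q s p)) , id ]′
          (dom π b₀ (pt (proj₁ q) (el s)) (proj₂ (proj₂ q) _ (hitP q s)))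

        cross : ∀ {w w′} → Petal₀ i w → Petal₀ i w′ → Gen (pos i v₀) w w′ → ∀ s → ∃ λ s′ → P w′ s ~ P w s′
        cross {w} {w′} q q′ g s =
          [ (λ p → ⊥-elim (not-x q′ s (subst (P w′ s ~_) (proj₁ (proj₂ q)) p))) , [ (λ p → true , p) , (λ p → false , p) ]′ ]′
          (dom π (proj₁ q) (pt (proj₁ q′) (el s)) (g _ (hitP q′ s)))

        clashing : ∀ {w w′ s s′ l} → Petal₀ i w → Petal₀ i w′ → P w′ s ~ P w s′ → P w′ s ~ pos l v₀ → P w s′ ~ pos l v₀ → ⊥
        clashing q q′ p p₁ p₂ = triangle-free (pt (proj₁ q′) _) (pt (proj₁ q) _) (pt b₀ _) p p₁ p₂

        -- The vertex is joined to the earlier petal, at a vertex that sees one of the two elements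
        -- as well; this closes a triangle.
        excl : ∀ {w₁ w₂} → Petal₀ i w₁ → Petal₀ i w₂ → Gen (pos i v₀) w₁ w₂ →
          ∀ s → P w₂ s ~ pos j v₀ → P w₂ s ~ pos k v₀ → ⊥
        excl q₁ q₂ g s py pz = let s′ , p = cross q₁ q₂ g s in
          [ clashing {l = j} q₁ q₂ p py , clashing {l = k} q₁ q₂ p pz ]′ (color q₁ s′)

        -- A petal inside one neighbourhood pushes the next petal into the other, and then a vertex
        -- of a further petal clashes with one of the two.
        mono : ∀ {w₂ w₃ w₄} → Petal₀ i w₂ → Petal₀ i w₃ → Petal₀ i w₄ →
          Gen (pos i v₀) w₂ w₃ → Gen (pos i v₀) w₂ w₄ → Gen (pos i v₀) w₃ w₄ →
          ∀ l m → (∀ {w} → Petal₀ i w → ∀ s → P w s ~ pos l v₀ ⊎ P w s ~ pos m v₀) → (∀ s → P w₂ s ~ pos l v₀) → ⊥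
        mono {w₂} {w₃} {w₄} q₂ q₃ q₄ g₂₃ g₂₄ g₃₄ l m col all₂ = [ last₁ , last₂ ]′ (col q₄ true)
          where
          all₃ : ∀ s → P w₃ s ~ pos m v₀
          all₃ s = [ (λ c → let s′ , p = cross q₂ q₃ g₂₃ s in ⊥-elim (clashing q₂ q₃ p c (all₂ s′))) , id ]′ (col q₃ s)
          last₁ : P w₄ true ~ pos l v₀ → ⊥
          last₁ c = let s′ , p = cross q₂ q₄ g₂₄ true in clashing q₂ q₄ p c (all₂ s′)
          last₂ : P w₄ true ~ pos m v₀ → ⊥
          last₂ c = let s′ , p = cross q₃ q₄ g₃₄ true in clashing q₃ q₄ p c (all₃ s′)

        both : ∀ {Q : Bool → Set} → Q true → Q false → ∀ s → Q s
        both p q true  = p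
        both p q false = q

        petal-covers : ∀ {w u} → Petal₀ i w → Pt u → exc w u ≡ false → u ~ pos i v₀ ⊎ u ~ P w true ⊎ u ~ P w false
        petal-covers {u = u} q pu e = map₁ (subst (u ~_) (proj₁ (proj₂ q))) (dom π (proj₁ q) pu e)

        -- Every petal vertex is adjacent to y or to z, and to an earlier petal; of four generic petals
        -- the second one must meet both neighbourhoods, each in one vertex.
        goodPetal : ∀ {w₁ w₂ w₃ w₄} → Petal₀ i w₁ → Petal₀ i w₂ → Petal₀ i w₃ → Petal₀ i w₄ →
          Gen (pos i v₀) w₁ w₂ → Gen (pos i v₀) w₂ w₃ → Gen (pos i v₀) w₂ w₄ → Gen (pos i v₀) w₃ w₄ → GoodPetal π w₂
        goodPetal {w₁} {w₂} {w₃} {w₄} q₁ q₂ q₃ q₄ g₁₂ g₂₃ g₂₄ g₃₄ = result (color q₂ true) (color q₂ false)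
          where
          result : P w₂ true ~ pos j v₀ ⊎ P w₂ true ~ pos k v₀ → P w₂ false ~ pos j v₀ ⊎ P w₂ false ~ pos k v₀ → GoodPetal π w₂
          result (inj₁ p) (inj₁ q) = ⊥-elim (mono q₂ q₃ q₄ g₂₃ g₂₄ g₃₄ j k color (both p q))
          result (inj₂ p) (inj₂ q) = ⊥-elim (mono q₂ q₃ q₄ g₂₃ g₂₄ g₃₄ k j (λ r s → swap (color r s)) (both p q))
          result (inj₁ p) (inj₂ q) = record
            { inB₂ = proj₁ q₂ ; a = P w₂ true ; b = P w₂ false ; pa = pt (proj₁ q₂) j ; pb = pt (proj₁ q₂) k
            ; ha = hitP q₂ true ; hb = hitP q₂ false ; a~y = p ; b~z = q
            ; a≁z = excl q₁ q₂ g₁₂ true p ; b≁y = λ r → excl q₁ q₂ g₁₂ false r q ; covers = petal-covers q₂ }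
          result (inj₂ p) (inj₁ q) = record
            { inB₂ = proj₁ q₂ ; a = P w₂ false ; b = P w₂ true ; pa = pt (proj₁ q₂) k ; pb = pt (proj₁ q₂) j
            ; ha = hitP q₂ false ; hb = hitP q₂ true ; a~y = q ; b~z = p
            ; a≁z = excl q₁ q₂ g₁₂ false q ; b≁y = λ r → excl q₁ q₂ g₁₂ true r p ; covers = λ pu e → map₂ swap (petal-covers q₂ pu e) }

      -- Each block of four consecutive petals contributes its second one.
      goods : ∀ {i j k} (π : Perm i j k) A → (∀ u → A u ≡ false → exc v₀ u ≡ false) → ∀ m ws → length ws ≡ m * 4 →
        All (Petal i (pos i v₀) A) ws → AllPairs (Gen (pos i v₀)) ws →
        ∃ λ (gs : List (Σ (Fin n) (GoodPetal π))) → length gs ≡ m × map proj₁ gs ⊆ ws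
      goods π A sA zero ws len al gen = [] , refl , minimum ws
      goods π A sA (suc m) (w₁ ∷ w₂ ∷ w₃ ∷ w₄ ∷ ws) len (q₁ ∷ q₂ ∷ q₃ ∷ q₄ ∷ al)
            ((g₁₂ ∷ _) ∷ (g₂₃ ∷ g₂₄ ∷ _) ∷ (g₃₄ ∷ _) ∷ _ ∷ gen)
        with goods π A sA m ws (ℕ-suc-injective (ℕ-suc-injective (ℕ-suc-injective (ℕ-suc-injective len)))) al gen
      ... | gs , lg , s = (w₂ , goodPetal π (c q₁) (c q₂) (c q₃) (c q₄) g₁₂ g₂₃ g₂₄ g₃₄) ∷ gs , cong suc lg , w₁ ∷ʳ (refl ∷ (w₃ ∷ʳ (w₄ ∷ʳ s)))
        where
        c : ∀ {w} → Petal _ _ A w → Petal₀ _ w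
        c (b , e , av) = b , e , (λ u h → sA u (av u h))

      #exc : ∀ {w} → B₂ w ≡ true → # (exc w) ≤ K
      #exc {w} b = good F w (sub w b)

      oneGood : ∀ {i j k} (π : Perm i j k) A → (∀ u → A u ≡ false → exc v₀ u ≡ false) → # A ≤ killLen →
        ∃ λ w → GoodPetal π w × (∀ u → hits (pos i v₀) w u ≡ true → A u ≡ false)
      oneGood {i} π A sA #A = first (petals v₀ i b₀ 4 A #A 4≤)
        where
        4≤ : 4 ≤ seqLen
        4≤ = subst (4 ≤_) (≡sym (sequence-bound-def ρ K)) (≤-trans (m≤m+n 4 (K * 4)) (m≤n+m (suc K * 4) ramsey₂))
        second : ∀ {ws} → All (Petal i (pos i v₀) A) ws → (∃ λ (gs : List (Σ (Fin n) (GoodPetal π))) → length gs ≡ 1 × map proj₁ gs ⊆ ws) →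
          ∃ λ w → GoodPetal π w × (∀ u → hits (pos i v₀) w u ≡ true → A u ≡ false)
        second al ((w , g) ∷ [] , refl , s) = w , g , proj₂ (proj₂ (All.head (All-resp-⊆ s al)))
        first : (∃ λ ws → length ws ≡ 4 × All (Petal i (pos i v₀) A) ws × AllPairs (Gen (pos i v₀)) ws) →
          ∃ λ w → GoodPetal π w × (∀ u → hits (pos i v₀) w u ≡ true → A u ≡ false)
        first (ws , len , al , gen) = second al (goods π A sA 1 ws len al gen)

      excOf : ∀ {i j k} {π : Perm i j k} → List (Σ (Fin n) (GoodPetal π)) → Fin n → Bool
      excOf []       u = false
      excOf (g ∷ gs) u = exc (proj₁ g) u ∨ excOf gs u

      #excOf : ∀ {i j k} {π : Perm i j k} (gs : List (Σ (Fin n) (GoodPetal π))) → # (excOf gs) ≤ length gs * K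
      #excOf []       = ≤-reflexive (#-none (λ _ → refl))
      #excOf (g ∷ gs) = ≤-trans (#-∨ (λ u p → ∨-e {exc (proj₁ g) u} p)) (+-mono-≤ (#exc (inB₂ (proj₂ g))) (#excOf gs))

      excOf-∈ : ∀ {i j k} {π : Perm i j k} {g} {gs : List (Σ (Fin n) (GoodPetal π))} → g ∈ gs → ∀ {u} → excOf gs u ≡ false → exc (proj₁ g) u ≡ false
      excOf-∈ {g = g} {g′ ∷ gs} (here refl) {u} e = ¬true⇒false (λ p → clash (∨-l {exc (proj₁ g) u} p) e)
      excOf-∈ {g = g} {g′ ∷ gs} (there i) {u} e = excOf-∈ i (¬true⇒false (λ p → clash (∨-r {exc (proj₁ g′) u} p) e))

      left : ∀ {A B : Fin n → Bool} u → A u ∨ B u ≡ false → A u ≡ false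
      left {A} {B} u e = ¬true⇒false (λ p → clash (∨-l {A u} p) e)

      right : ∀ {A B : Fin n → Bool} u → A u ∨ B u ≡ false → B u ≡ false
      right {A} {B} u e = ¬true⇒false (λ p → clash (∨-r {A u} p) e)

      -- A later `a` avoids the exceptional set of an earlier petal, which contains the earlier `a`
      -- as a neighbour.
      distinct : ∀ (gs : List (Σ (Fin n) (GoodPetal p₀))) → AllPairs (Gen (pos zero v₀)) (map proj₁ gs) →
        AllPairs _≢_ (map (λ g → a (proj₂ g)) gs)
      distinct [] p = []
      distinct (g ∷ gs) (q ∷ p) = AllP.map⁺ (All.map (λ {g₂} h e → clash (exc-adj (R⇒~ {J} (∧-l {R J _ _} (ha (proj₂ g)))))
           (trans (cong (exc (proj₁ g)) e) (h _ (ha (proj₂ g₂))))) (AllP.map⁻ q)) ∷ distinct gs p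

      search : ∀ w (gs : List (Σ (Fin n) (GoodPetal p₀))) →
        (∃ λ g → g ∈ gs × exc w (a (proj₂ g)) ≡ false) ⊎ All (λ g → exc w (a (proj₂ g)) ≡ true) gs
      search w [] = inj₂ []
      search w (g ∷ gs) = [ (λ p → [ (λ { (g₂ , i , q) → inj₁ (g₂ , there i , q) }) , (λ q → inj₂ (p ∷ q)) ]′ (search w gs))
                          , (λ p → inj₁ (g , here refl , p)) ]′ (decide (exc w (a (proj₂ g))))

      -- Let the centres be x, y, z. Then `a g`, `b g′`, `a g″` see y, z, x in this order. By
      -- `covers`, `b g′` sees the petal of `g`, `a g″` that of `g′`, and `a g` that of `g″`; the
      -- centre is excluded by `b≁y` or `a≁z`, and one petal vertex by a neighbour in common. What
      -- is left is a triangle.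
      closing : ∀ {w w′ w″} (g : GoodPetal p₀ w) (g′ : GoodPetal p₁ w′) (g″ : GoodPetal p₂ w″) →
        exc w (b g′) ≡ false → exc w′ (a g″) ≡ false → exc w″ (a g) ≡ false → ⊥
      closing g g′ g″ e₁ e₂ e₃ = triangle-free (pa g) (pb g′) (pa g″) (~-sym da) ae (~-sym ed)
        where
        da : b g′ ~ a g
        da = [ (λ p → ⊥-elim (b≁y g′ p)) , [ id , (λ p → ⊥-elim (triangle-free (pb g′) (pb g) (pt b₀ _) p (b~z g′) (b~z g))) ]′ ]′ (covers g (pb g′) e₁)
        ed : a g″ ~ b g′
        ed = [ (λ p → ⊥-elim (a≁z g″ p)) , [ (λ p → ⊥-elim (triangle-free (pa g″) (pa g′) (pt b₀ _) p (a~y g″) (a~y g′))) , id ]′ ]′ (covers g′ (pa g″) e₂)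
        ae : a g ~ a g″
        ae = [ (λ p → ⊥-elim (a≁z g p)) , [ id , (λ p → ⊥-elim (triangle-free (pa g) (pb g″) (pt b₀ _) p (a~y g) (b~z g″))) ]′ ]′ (covers g″ (pa g) e₃)

      -- The three petals must be generic in a cyclic pattern, which successive choice does not
      -- provide. So `suc K` good petals are prepared at the first centre, one is chosen at each of
      -- the other two, and the exceptional set of the last, having at most `K` elements, misses one
      -- of the prepared points `a`.
      contradiction : ⊥
      contradiction = step₁ (petals v₀ zero b₀ (suc K * 4) (exc v₀) (≤-trans (#exc b₀) (subst (K ≤_) (≡sym (kill-bound-def ρ K)) (m≤m+n _ _)))
                           (subst (suc K * 4 ≤_) (≡sym (sequence-bound-def ρ K)) (m≤n+m _ _)))
        where
        A₂ : List (Σ (Fin n) (GoodPetal p₀)) → Fin n → Bool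
        A₂ gs u = exc v₀ u ∨ excOf gs u
        A₃ : Fin n → Fin n → Bool
        A₃ w′ u = exc v₀ u ∨ exc w′ u
        step₄ : ∀ gs → length gs ≡ suc K → AllPairs (Gen (pos zero v₀)) (map proj₁ gs) → ∀ w′ (g′ : GoodPetal p₁ w′) →
          (∀ u → hits (pos (suc zero) v₀) w′ u ≡ true → A₂ gs u ≡ false) → ∀ w″ (g″ : GoodPetal p₂ w″) →
          (∀ u → hits (pos (suc (suc zero)) v₀) w″ u ≡ true → A₃ w′ u ≡ false) → ⊥
        step₄ gs lg gen w′ g′ av′ w″ g″ av″ =
          [ (λ { ((w , g) , i , e₃) → closing g g′ g″ (excOf-∈ i (right {exc v₀} {excOf gs} _ (av′ _ (hb g′))))
                                        (right {exc v₀} {exc w′} _ (av″ _ (ha g″))) e₃ })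
          , (λ q → <⇒≱ (≤-refl {suc K}) (≤-trans (≤-reflexive (≡sym (trans (length-map _ gs) lg)))
              (≤-trans (length≤# (exc w″) (map (λ g → a (proj₂ g)) gs) (AllP.map⁺ q) (distinct gs gen)) (#exc (inB₂ g″))))) ]′ (search w″ gs)
        step₃ : ∀ gs → length gs ≡ suc K → AllPairs (Gen (pos zero v₀)) (map proj₁ gs) →
          (∃ λ w → GoodPetal p₁ w × (∀ u → hits (pos (suc zero) v₀) w u ≡ true → A₂ gs u ≡ false)) → ⊥
        step₃ gs lg gen (w′ , g′ , av′) = go (oneGood p₂ (A₃ w′) (λ u → left {exc v₀} {exc w′} u)
            (≤-trans (#-∨ (λ u p → ∨-e {exc v₀ u} p)) (≤-trans (+-mono-≤ (#exc b₀) (#exc (inB₂ g′)))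
              (subst (K + K ≤_) (≡sym (kill-bound-def ρ K)) (+-monoʳ-≤ K (m≤n+m _ _))))))
          where
          go : (∃ λ w → GoodPetal p₂ w × (∀ u → hits (pos (suc (suc zero)) v₀) w u ≡ true → A₃ w′ u ≡ false)) → ⊥
          go (w″ , g″ , av″) = step₄ gs lg gen w′ g′ av′ w″ g″ av″
        step₂ : ∀ {ws} → AllPairs (Gen (pos zero v₀)) ws →
          (∃ λ (gs : List (Σ (Fin n) (GoodPetal p₀))) → length gs ≡ suc K × map proj₁ gs ⊆ ws) → ⊥
        step₂ gen (gs , lg , s) = step₃ gs lg (AllPairs-⊆ s gen) (oneGood p₁ (A₂ gs) (λ u → left {exc v₀} {excOf gs} u)
                                 (≤-trans (#-∨ (λ u p → ∨-e {exc v₀ u} p)) (≤-trans (+-mono-≤ (#exc b₀) (≤-trans (#excOf gs) (≤-reflexive (cong (_* K) lg))))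
                                   (subst (K + suc K * K ≤_) (≡sym (kill-bound-def ρ K)) (+-monoʳ-≤ K (m≤m+n _ _))))))
        step₁ : (∃ λ ws → length ws ≡ suc K * 4 × All (Petal zero (pos zero v₀) (exc v₀)) ws × AllPairs (Gen (pos zero v₀)) ws) → ⊥
        step₁ (ws , len , al , gen) = step₂ gen (goods p₀ (exc v₀) (λ _ e → e) (suc K) ws len al gen)

-- Counting the vertices with short traces

module Sparse {n : ℕ} (G : Graph n) (ρ : ℕ) (sat : KSaturated (3 + ρ) G) (tf : TwinFree G)
              (C : Fin n → Bool) (K : ℕ) where
  open Cliques G
  open Traces G ρ sat tf C K
  open Family

  product-length : ∀ {A B D : Set} (f : A → B → D) xs ys → length (cartesianProductWith f xs ys) ≡ length xs * length ys
  product-length f [] ys = refl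
  product-length f (x ∷ xs) ys = trans (length-++ (map (f x) ys)) (cong₂ _+_ (length-map (f x) ys) (product-length f xs ys))

  -- The tests record how the three positions see `J` (at most `3 * j₀`) and each other (9).
  -- Afterwards a popular core is contradictory, so peeling bounds the family; the three alphabets
  -- have total size `3 * # C`.
  family₃ : ∀ {J B} j₀ → Helly J → # J ≤ j₀ → Family J 3 B → # B ≤ 2 ^ (3 * j₀ + 9) * (multiplicity * (3 * # C))
  family₃ {J} {B} j₀ helly #J F = split (homogenize tests B)
    where
    open Triples J F
    testsJ testsP tests : List (Fin n → Bool)
    testsJ = cartesianProductWith (λ i u w → adj G (pos i w) u) (allFin 3) (elems J)
    testsP = cartesianProductWith (λ i j w → adj G (pos i w) (pos j w)) (allFin 3) (allFin 3)
    tests = testsJ ++ testsP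
    len : length tests ≤ 3 * j₀ + 9
    len = ≤-trans (≤-reflexive (trans (length-++ testsJ) (cong₂ _+_ (trans (product-length (λ i u w → adj G (pos i w) u) (allFin 3) (elems J)) (cong (3 *_) (length-elems J)))
            (product-length (λ i j w → adj G (pos i w) (pos j w)) (allFin 3) (allFin 3))))) (+-monoˡ-≤ 9 (*-monoʳ-≤ 3 #J))
    split : Homogeneous tests B → # B ≤ 2 ^ (3 * j₀ + 9) * (multiplicity * (3 * # C))
    split (B₁ , sub₁ , le₁ , hom) = ≤-trans le₁ (*-mono-≤ (^-monoʳ-≤ 2 len) small)
      where
      core : (Σ (Fin n → Bool) λ B′ → (∀ v → B′ v ≡ true → B₁ v ≡ true) × (∃ λ v → B′ v ≡ true) ×
        (∀ v i → B′ v ≡ true → multiplicity < # (λ w → B′ w ∧ does (pos i w ≟ pos i v)))) → ⊥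
      core (B₂ , sub₂ , (v₀ , b₀) , big) = Core.contradiction helly (λ v b → sub₁ v (sub₂ v b))
        (λ i u j v w bv bw → All.lookup hom (∈-++⁺ˡ (∈-cartesianProductWith⁺ (λ i u w → adj G (pos i w) u) (∈-allFin i) (elems-∈ u j))) v w (sub₂ v bv) (sub₂ w bw))
        (λ i j v w bv bw → All.lookup hom (∈-++⁺ʳ testsJ (∈-cartesianProductWith⁺ (λ i j w → adj G (pos i w) (pos j w)) (∈-allFin i) (∈-allFin j))) v w (sub₂ v bv) (sub₂ w bw))
        v₀ b₀ big
      small : # B₁ ≤ multiplicity * (3 * # C)
      small = [ id , (λ c → ⊥-elim (core c)) ]′ (degenerate-or-core pos multiplicity (3 * # C) (λ _ → C) B₁
        (≤-reflexive (sum-const 3 (# C))) (λ v i b → R⇒C {J} (pos-R i (sub₁ v b))))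

  opaque
    image : ∀ {s} → (Fin s → Fin n) → Fin n → Bool
    image q u = anyB (λ i → does (u ≟ q i))

    image-e : ∀ {s} {q : Fin s → Fin n} {u} → image q u ≡ true → ∃ λ i → u ≡ q i
    image-e {q = q} {u} p = let i , e = anyB-e {f = λ i → does (u ≟ q i)} p in i , does-e (u ≟ q i) e

    image-i : ∀ {s} (q : Fin s → Fin n) i → image q (q i) ≡ true
    image-i q i = anyB-i {f = λ j → does (q i ≟ q j)} i (does-i (q i ≟ q i) refl)

  #-image : ∀ {s} (q : Fin s → Fin n) → # (image q) ≤ s
  #-image {s} q = ≤-trans (#-mono {g = λ u → true ∧ anyB (λ i → true ∧ does (u ≟ q i))} (λ u p → let i , e = image-e {q = q} p in
        anyB-i {f = λ i → true ∧ does (u ≟ q i)} i (does-i (u ≟ q i) e)))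
      (≤-trans (#-anyB (λ _ → true) (λ _ → true) (λ u i → does (u ≟ q i)) 1
        (λ i → #≤1 (λ u u′ p p′ → trans (does-e (u ≟ q i) p) (≡sym (does-e (u′ ≟ q i) p′)))))
        (≤-reflexive (trans (*-identityʳ _) (#-all s))))

  #-image≥ : ∀ {s} (q : Fin s → Fin n) → (∀ i j → i ≢ j → q i ≢ q j) → s ≤ # (image q)
  #-image≥ q inj = subst (_≤ # (image q)) (length-tabulate q) (length≤# (image q) (tabulate q)
    (AllP.tabulate⁺ (image-i q)) (APP.tabulate⁺ (λ {i} {j} → inj i j)))

  -- Inside a clique Q of size r - 2 every relevant vertex misses exactly one element, always the same one.
  helly-clique : ∀ {P : Fin n → Set} (Q : Clique (suc ρ) P) → Helly (image (vertex Q))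
  helly-clique Q A pair proper = clique (λ k → q (punchIn m k)) (λ k l k≢l → adjacent Q _ _ (k≢l ∘ punchIn-injective m k l))
      (λ k → image-i q _ , (λ j → hit j (punchIn m k) (punchInᵢ≢i m k ∘ ≡sym)))
    where
    q = vertex Q
    missing : ∀ j → ∃ λ i → adj G (A j) (q i) ≡ false
    missing j with any? (λ i → adj G (A j) (q i) ≟ᵇ false)
    ... | yes p = p
    ... | no none = ⊥-elim (proper j (clique q (adjacent Q) (λ i → image-i q i , full i)))
      where
      full : ∀ i → A j ~ q i
      full i with decide (adj G (A j) (q i))
      ... | inj₁ p = p
      ... | inj₂ p = ⊥-elim (none (i , p))
    m = proj₁ (missing zero)
    two : ∀ j k → j ≢ k → ∀ b c → adj G (A j) (q b) ≡ false → adj G (A k) (q c) ≡ false → b ≡ c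
    two j k j≢k b c jb kc with b ≟ c
    ... | yes p = p
    -- The common clique avoids `b` and `c`, which makes ρ + 2 distinct elements of `Fin (suc ρ)`.
    ... | no b≢c = ⊥-elim (<⇒≱ (≤-refl {suc (suc ρ)}) (injective⇒≤ {f = f} f-inj))
      where
      W = pair j k j≢k
      κ : Fin ρ → Fin (suc ρ)
      κ i = proj₁ (image-e {q = q} {vertex W i} (proj₁ (member W i)))
      κ-eq : ∀ i → vertex W i ≡ q (κ i)
      κ-eq i = proj₂ (image-e {q = q} {vertex W i} (proj₁ (member W i)))
      κ≢b : ∀ i → κ i ≢ b
      κ≢b i e = clash (proj₁ (proj₂ (member W i))) (subst (λ x → adj G (A j) x ≡ false) (≡sym (trans (κ-eq i) (cong q e))) jb)
      κ≢c : ∀ i → κ i ≢ c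
      κ≢c i e = clash (proj₂ (proj₂ (member W i))) (subst (λ x → adj G (A k) x ≡ false) (≡sym (trans (κ-eq i) (cong q e))) kc)
      κ-inj : ∀ i l → κ i ≡ κ l → i ≡ l
      κ-inj i l e with i ≟ l
      ... | yes p = p
      ... | no p = ⊥-elim (~⇒≢ (adjacent W i l p) (trans (κ-eq i) (trans (cong q e) (≡sym (κ-eq l)))))
      f : Fin (suc (suc ρ)) → Fin (suc ρ)
      f zero          = b
      f (suc zero)    = c
      f (suc (suc i)) = κ i
      f-inj : ∀ {i l} → f i ≡ f l → i ≡ l
      f-inj {zero} {zero} e = refl
      f-inj {zero} {suc zero} e = ⊥-elim (b≢c e)
      f-inj {zero} {suc (suc l)} e = ⊥-elim (κ≢b l (≡sym e))
      f-inj {suc zero} {zero} e = ⊥-elim (b≢c (≡sym e))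
      f-inj {suc zero} {suc zero} e = refl
      f-inj {suc zero} {suc (suc l)} e = ⊥-elim (κ≢c l (≡sym e))
      f-inj {suc (suc i)} {zero} e = ⊥-elim (κ≢b i e)
      f-inj {suc (suc i)} {suc zero} e = ⊥-elim (κ≢c i e)
      f-inj {suc (suc i)} {suc (suc l)} e = cong (λ x → Fin.suc (Fin.suc x)) (κ-inj i l e)
    same : ∀ j i → adj G (A j) (q i) ≡ false → m ≡ i
    same zero i p = trans (two zero (suc zero) (λ ()) m i₁ (proj₂ (missing zero)) m₁) (two (suc zero) zero (λ ()) i₁ i m₁ p)
      where
      i₁ = proj₁ (missing (suc zero))
      m₁ = proj₂ (missing (suc zero))
    same (suc j) i p = two zero (suc j) (λ ()) m i (proj₂ (missing zero)) p
    hit : ∀ j i → m ≢ i → A j ~ q i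
    hit j i m≢i with decide (adj G (A j) (q i))
    ... | inj₁ p = p
    ... | inj₂ p = ⊥-elim (m≢i (same j i p))

  c₃ : ℕ
  c₃ = three-bound ρ K

  #-S : ∀ {J} v → (∀ u → J u ≡ true → S v u ≡ true) → # (S v) ≡ # J + # (R J v)
  #-S {J} v b = trans (#-split (S v) J) (cong (_+ # (R J v)) (#-cong (λ u → bool-ext (∧-r {S v u} {J u}) (λ j → ∧-i (b u j) j))))

  -- Traces of size at most r + 1 exceed a common clique of size r - 2 by at most three, and each
  -- excess has its own bound.
  few-based : ∀ {B} → Good B → (∀ v → B v ≡ true → # (S v) ≤ 4 + ρ) → (Q : Clique (suc ρ) (λ t → ∀ v → B v ≡ true → S v t ≡ true)) →
    # B ≤ (2 ^ K + c₁ + c₁ + c₃) * suc (# C)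
  few-based {B} gd small Q = begin
    # B                                             ≤⟨ #-∨ {g = λ v → (B₀ v ∨ B₁ v) ∨ B₂ v} {h = B₃} which ⟩
    # (λ v → (B₀ v ∨ B₁ v) ∨ B₂ v) + # B₃           ≤⟨ +-monoˡ-≤ (# B₃) (≤-trans (#-∨ {g = λ v → B₀ v ∨ B₁ v} {h = B₂} (λ v → ∨-e)) (+-monoˡ-≤ (# B₂) (#-∨ {g = B₀} {h = B₁} (λ v → ∨-e)))) ⟩
    # B₀ + # B₁ + # B₂ + # B₃                       ≤⟨ +-mono-≤ (+-mono-≤ (+-mono-≤ (family₀ (fam 0)) (family₁ (fam 1))) (family₂ (fam 2)))
                                                         (family₃ (suc ρ) (helly-clique Q) (#-image q) (fam 3)) ⟩
    2 ^ K + c₁ + # C * c₁ + 2 ^ (3 * suc ρ + 9) * (multiplicity * (3 * # C)) ≡⟨ cong (2 ^ K + c₁ + # C * c₁ +_) (trans (assoc4 (2 ^ (3 * suc ρ + 9)) multiplicity (# C)) (cong (_* # C) (≡sym (three-bound-def ρ K)))) ⟩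
    2 ^ K + c₁ + # C * c₁ + c₃ * # C                ≤⟨ widen (2 ^ K) c₁ (# C) c₃ ⟩
    (2 ^ K + c₁ + c₁ + c₃) * suc (# C) ∎
    where
    open ≤-Reasoning
    q = vertex Q
    J = image q
    base-J : ∀ v → B v ≡ true → ∀ u → J u ≡ true → S v u ≡ true
    base-J v b u p with image-e {q = q} p
    ... | i , refl = member Q i v b
    part : ℕ → Fin n → Bool
    part k v = B v ∧ does (# (R J v) ≟ℕ k)
    B₀ = part 0
    B₁ = part 1
    B₂ = part 2
    B₃ = part 3
    fam : ∀ k → Family J k (part k)
    fam k = record { good = λ v p → gd v (∧-l p) ; base = λ v p → base-J v (∧-l p) ; size = λ v p → does-e (# (R J v) ≟ℕ k) (∧-r {B v} p) }
    R≤3 : ∀ v → B v ≡ true → # (R J v) ≤ 3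
    R≤3 v b = +-cancelˡ-≤ (suc ρ) _ _ (≤-trans (+-monoˡ-≤ _ (#-image≥ q (λ i j i≢j → ~⇒≢ (adjacent Q i j i≢j))))
      (≤-trans (≤-reflexive (≡sym (#-S v (base-J v b)))) (≤-trans (small v b) (≤-reflexive (trans (+-comm 4 ρ) (+-suc ρ 3))))))
    which : ∀ v → B v ≡ true → ((B₀ v ∨ B₁ v) ∨ B₂ v) ≡ true ⊎ B₃ v ≡ true
    which v b = go (# (R J v)) refl (R≤3 v b)
      where
      in-part : ∀ k → # (R J v) ≡ k → part k v ≡ true
      in-part k e = ∧-i b (does-i (# (R J v) ≟ℕ k) e)
      go : ∀ k → # (R J v) ≡ k → k ≤ 3 → ((B₀ v ∨ B₁ v) ∨ B₂ v) ≡ true ⊎ B₃ v ≡ true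
      go 0 e _ = inj₁ (∨-l (∨-l (in-part 0 e)))
      go 1 e _ = inj₁ (∨-l (∨-r {B₀ v} (in-part 1 e)))
      go 2 e _ = inj₁ (∨-r {B₀ v ∨ B₁ v} (in-part 2 e))
      go 3 e _ = inj₂ (in-part 3 e)
      go (suc (suc (suc (suc k)))) e (s≤s (s≤s (s≤s ())))
    assoc4 : ∀ a m c → a * (m * (3 * c)) ≡ a * (m * 3) * c
    assoc4 = solve-∀
    widen : ∀ a b c d → a + b + c * b + d * c ≤ (a + b + b + d) * suc c
    widen a b c d = subst (a + b + c * b + d * c ≤_) (≡sym (eq a b c d)) (m≤m+n _ _)
      where
      eq : ∀ a b c d → (a + b + b + d) * suc c ≡ a + b + c * b + d * c + (b + d + a * c + b * c)
      eq = solve-∀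

  -- Each member outside `exc v₀` sees an (r - 2)-clique in the trace of `v₀`. Homogenizing over
  -- this trace makes all remaining members see the same clique, which becomes the base.
  few : ∀ {B} → Good B → (∀ v → B v ≡ true → # (S v) ≤ 4 + ρ) → # B ≤ few-bound ρ K * suc (# C)
  few {B} gd small with any? (λ v → B v ≟ᵇ true)
  ... | no none = ≤-trans (≤-reflexive (#-none (λ v → ¬true⇒false (λ p → none (v , p))))) z≤n
  ... | yes (v₀ , b₀) = go (homogenize tests B₁)
    where
    B₁ : Fin n → Bool
    B₁ w = B w ∧ not (exc v₀ w)
    tests : List (Fin n → Bool)
    tests = map (λ s w → adj G w s) (elems (S v₀))
    len : length tests ≤ 4 + ρ
    len = ≤-trans (≤-reflexive (trans (length-map _ (elems (S v₀))) (length-elems (S v₀)))) (small v₀ b₀)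
    #B : # B ≤ K + # B₁
    #B = ≤-trans (≤-reflexive (#-split B (exc v₀))) (+-monoˡ-≤ (# B₁) (≤-trans (#-mono (λ w → ∧-r {B w})) (gd v₀ b₀)))
    M = 2 ^ K + c₁ + c₁ + c₃
    go : Homogeneous tests B₁ → # B ≤ few-bound ρ K * suc (# C)
    go (B₂ , sub₂ , le₂ , hom) = ≤-trans #B (≤-trans (+-monoʳ-≤ K (≤-trans le₂ (*-mono-≤ (^-monoʳ-≤ 2 len) #B₂)))
        (subst (λ f → K + 2 ^ (4 + ρ) * (M * suc (# C)) ≤ f * suc (# C)) (≡sym (few-bound-def ρ K)) (widen K (2 ^ (4 + ρ)) M (# C))))
      where
      widen : ∀ k p m c → k + p * (m * suc c) ≤ (k + p * m) * suc c
      widen k p m c = subst (k + p * (m * suc c) ≤_) (≡sym (eq k p m c)) (m≤m+n _ _)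
        where
        eq : ∀ k p m c → (k + p * m) * suc c ≡ k + p * (m * suc c) + k * c
        eq = solve-∀
      #B₂ : # B₂ ≤ M * suc (# C)
      #B₂ with any? (λ v → B₂ v ≟ᵇ true)
      ... | no none = ≤-trans (≤-reflexive (#-none (λ v → ¬true⇒false (λ p → none (v , p))))) z≤n
      ... | yes (w₁ , b₁) = few-based (λ v b → gd v (∧-l (sub₂ v b))) (λ v b → small v (∧-l (sub₂ v b)))
            (clique-map transfer (dominated (not-e (∧-r {B w₁} (sub₂ w₁ b₁)))))
        where
        transfer : ∀ t → S v₀ t ≡ true × w₁ ~ t → ∀ v → B₂ v ≡ true → S v t ≡ true
        transfer t (s , wt) v b = ∧-i (trans (All.lookup (AllP.map⁻ hom) (elems-∈ t s) v w₁ b b₁) wt) (∧-r {adj G v₀ t} s)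

lookup-distinct : ∀ {A : Set} {xs : List A} → AllPairs _≢_ xs → ∀ i j → i ≢ j → lookup xs i ≢ lookup xs j
lookup-distinct (a ∷ p) zero    zero    q = ⊥-elim (q refl)
lookup-distinct {xs = x ∷ xs} (a ∷ p) zero    (suc j) q = All.lookup a (∈-lookup j)
lookup-distinct {xs = x ∷ xs} (a ∷ p) (suc i) zero    q = All.lookup a (∈-lookup i) ∘ ≡sym
lookup-distinct (a ∷ p) (suc i) (suc j) q = lookup-distinct p i j (q ∘ cong suc)

#-⊂-eq : ∀ {m} {f g : Fin m → Bool} → (∀ i → f i ≡ true → g i ≡ true) → # f ≡ # g → ∀ i → f i ≡ g i
#-⊂-eq {f = f} sub e i = bool-ext (sub i) (λ gi → [ id , (λ fi → ⊥-elim (<⇒≢ (#-strict sub i fi gi) e)) ]′ (decide (f i)))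

-- Checked by exhaustion. This is why the crowns below have four petals.
avoid3? : Dec (∀ (x y z : Fin 4) → ∃ λ k → k ≢ x × k ≢ y × k ≢ z)
avoid3? = all? λ x → all? λ y → all? λ z → any? λ k → ¬? (k ≟ x) ×-dec (¬? (k ≟ y) ×-dec ¬? (k ≟ z))

avoid3 : ∀ (x y z : Fin 4) → ∃ λ k → k ≢ x × k ≢ y × k ≢ z
avoid3 = from-yes avoid3?

sum-two : ∀ {m} (f : Fin m → Bool) (g : Fin m → ℕ) c → # f ≡ 2 →
  (∀ v w → f v ≡ true → f w ≡ true → v ≢ w → g v + g w ≤ c) → ∑ (λ v → ind (f v) * g v) ≤ c
sum-two {m} f g c e h with take-distinct f 2 (≤-reflexive (≡sym e))
... | (v ∷ w ∷ []) , refl , (fv ∷ fw ∷ []) , ((v≢w ∷ []) ∷ _) = begin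
  ∑ k                                        ≡⟨ sum-remove k v ⟩
  k v + ∑ (without v k)                      ≡⟨ cong (k v +_) (sum-remove (without v k) w) ⟩
  k v + (without v k w + ∑ (without w (without v k))) ≡⟨ cong₂ (λ a b → k v + (a + b)) (without-≢ k (v≢w ∘ ≡sym)) (trans (sum-cong rest) (trans (sum-const m 0) (*-zeroʳ m))) ⟩
  k v + (k w + 0)                            ≡⟨ cong (k v +_) (+-identityʳ _) ⟩
  k v + k w                                  ≡⟨ cong₂ _+_ (one v fv) (one w fw) ⟩
  g v + g w                                  ≤⟨ h v w fv fw v≢w ⟩
  c ∎
  where
  open ≤-Reasoning
  k : Fin m → ℕ
  k v = ind (f v) * g v
  one : ∀ v → f v ≡ true → k v ≡ g v
  one v p rewrite p = +-identityʳ _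
  rest : ∀ u → without w (without v k) u ≡ 0
  rest u with u ≟ w
  ... | yes _ = refl
  ... | no u≢w with u ≟ v
  ...   | yes _ = refl
  ...   | no u≢v with decide (f u)
  ...     | inj₂ p rewrite p = refl
  ...     | inj₁ p = ⊥-elim (<⇒≱ (≤-refl {3}) (subst (3 ≤_) e (length≤# f (u ∷ v ∷ w ∷ []) (p ∷ fv ∷ fw ∷ []) ((u≢v ∷ u≢w ∷ []) ∷ (v≢w ∷ []) ∷ [] ∷ []))))

-- Families of maximal independent triples in a triangle-free graph

module ExactTriples {n : ℕ} (G : Graph n) (T Y : Fin n → Bool) (inc : Fin n → Fin n → Bool)
  (tri : ∀ {u v w} → adj G u v ≡ true → adj G u w ≡ true → adj G v w ≡ true → ⊥)
  (size : ∀ {v} → T v ≡ true → # (inc v) ≡ 3)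
  (inY : ∀ {v u} → T v ≡ true → inc v u ≡ true → Y u ≡ true)
  (indep : ∀ {v u w} → T v ≡ true → inc v u ≡ true → inc v w ≡ true → adj G u w ≡ false)
  (domin : ∀ {v u} → T v ≡ true → Y u ≡ true → inc v u ≡ false → ∃ λ t → inc v t ≡ true × adj G u t ≡ true)
  (sep : ∀ {v w} → T v ≡ true → T w ≡ true → (∀ u → inc v u ≡ inc w u) → v ≡ w)
  where
  open Cliques G

  -- The triple of `v` in a chosen order, so that any of its elements can come first.
  record M (v y a b : Fin n) : Set where
    constructor triple
    field
      inT : T v ≡ true
      iy  : inc v y ≡ true
      ia  : inc v a ≡ true
      ib  : inc v b ≡ true
      y≢a : y ≢ a
      y≢b : y ≢ b
      a≢b : a ≢ b
      cov : ∀ u → inc v u ≡ true → u ≡ y ⊎ u ≡ a ⊎ u ≡ b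
  open M

  rot : ∀ {v y a b} → M v y a b → M v a b y
  rot (triple t y a b ya yb ab c) = triple t a b y ab (ya ∘ ≡sym) (yb ∘ ≡sym)
    (λ u p → [ (λ e → inj₂ (inj₂ e)) , [ inj₁ , (λ e → inj₂ (inj₁ e)) ]′ ]′ (c u p))

  swp : ∀ {v y a b} → M v y a b → M v y b a
  swp (triple t y a b ya yb ab c) = triple t y b a yb ya (ab ∘ ≡sym) (λ u p → map₂ swap (c u p))

  flp : ∀ {v y a b} → M v y a b → M v a y b
  flp m = swp (rot m)

  complete : ∀ {v y} → T v ≡ true → inc v y ≡ true → ∃ λ a → ∃ λ b → M v y a b
  complete {v} {y} t iy with #-three (inc v) (size t)
  ... | three x₁ x₂ x₃ i₁ i₂ i₃ d₁₂ d₁₃ d₂₃ c with c y iy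
  ...   | inj₁ refl        = x₂ , x₃ , triple t i₁ i₂ i₃ d₁₂ d₁₃ d₂₃ c
  ...   | inj₂ (inj₁ refl) = x₁ , x₃ , flp (triple t i₁ i₂ i₃ d₁₂ d₁₃ d₂₃ c)
  ...   | inj₂ (inj₂ refl) = x₁ , x₂ , rot (rot (triple t i₁ i₂ i₃ d₁₂ d₁₃ d₂₃ c))

  yY : ∀ {v y a b} → M v y a b → Y y ≡ true
  yY m = inY (inT m) (iy m)
  aY : ∀ {v y a b} → M v y a b → Y a ≡ true
  aY m = inY (inT m) (ia m)
  bY : ∀ {v y a b} → M v y a b → Y b ≡ true
  bY m = inY (inT m) (ib m)

  ya≁ : ∀ {v y a b} → M v y a b → ¬ y ~ a
  ya≁ m p = clash p (indep (inT m) (iy m) (ia m))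
  yb≁ : ∀ {v y a b} → M v y a b → ¬ y ~ b
  yb≁ m p = clash p (indep (inT m) (iy m) (ib m))
  ab≁ : ∀ {v y a b} → M v y a b → ¬ a ~ b
  ab≁ m p = clash p (indep (inT m) (ia m) (ib m))

  data Dom (y a b u : Fin n) : Set where
    eq₁ : u ≡ y → Dom y a b u
    eq₂ : u ≡ a → Dom y a b u
    eq₃ : u ≡ b → Dom y a b u
    ad₁ : u ~ y → Dom y a b u
    ad₂ : u ~ a → Dom y a b u
    ad₃ : u ~ b → Dom y a b u

  dom : ∀ {v y a b} → M v y a b → ∀ {u} → Y u ≡ true → Dom y a b u
  dom {v} {y} {a} {b} m {u} yu with decide (inc v u)
  ... | inj₁ p = [ eq₁ , [ eq₂ , eq₃ ]′ ]′ (cov m u p)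
  ... | inj₂ p with domin (inT m) yu p
  ...   | t , it , ut with cov m t it
  ...     | inj₁ refl = ad₁ ut
  ...     | inj₂ (inj₁ refl) = ad₂ ut
  ...     | inj₂ (inj₂ refl) = ad₃ ut

  same : ∀ {v w y a b} → M v y a b → M w y a b → v ≡ w
  same {v} {w} m m′ = sep (inT m) (inT m′) (λ u → bool-ext (half m m′ u) (half m′ m u))
    where
    half : ∀ {v w y a b} → M v y a b → M w y a b → ∀ u → inc v u ≡ true → inc w u ≡ true
    half m m′ u p with cov m u p
    ... | inj₁ refl = iy m′
    ... | inj₂ (inj₁ refl) = ia m′
    ... | inj₂ (inj₂ refl) = ib m′

  d : Fin n → ℕ
  d u = # (λ v → T v ∧ inc v u)

  others : ∀ u v → T v ≡ true → inc v u ≡ true → d u ≡ suc (# (λ w → (T w ∧ inc w u) ∧ not (does (w ≟ v))))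
  others u v t i = #-del (λ w → T w ∧ inc w u) v (∧-i t i)

  others₂ : ∀ u v v′ → T v ≡ true → inc v u ≡ true → T v′ ≡ true → inc v′ u ≡ true → v ≢ v′ →
    d u ≡ 2 + # (λ w → ((T w ∧ inc w u) ∧ not (does (w ≟ v))) ∧ not (does (w ≟ v′)))
  others₂ u v v′ t i t′ i′ ne = trans (others u v t i) (cong suc (#-del _ v′ (∧-i (∧-i t′ i′) (not-i (does-ni (v′ ≟ v) (ne ∘ ≡sym))))))

  another : ∀ {u v} → T v ≡ true → inc v u ≡ true → 2 ≤ d u → ∃ λ w → T w ≡ true × inc w u ≡ true × w ≢ v
  another {u} {v} t i p with #-pos (≤-pred (subst (2 ≤_) (others u v t i) p))
  ... | w , q = w , ∧-l (∧-l {T w ∧ inc w u} q) , ∧-r {T w} (∧-l {T w ∧ inc w u} q) , does-ne (w ≟ v) (not-e (∧-r {T w ∧ inc w u} q))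

  Third : Fin n → Fin n → Fin n → Fin n → Set
  Third u v v′ w = T w ≡ true × inc w u ≡ true × w ≢ v × w ≢ v′

  third-e : ∀ {u v v′ w} → ((T w ∧ inc w u) ∧ not (does (w ≟ v))) ∧ not (does (w ≟ v′)) ≡ true → Third u v v′ w
  third-e {u} {v} {v′} {w} q = ∧-l (∧-l {T w ∧ inc w u} q₁) , ∧-r {T w} (∧-l {T w ∧ inc w u} q₁) ,
      does-ne (w ≟ v) (not-e (∧-r {T w ∧ inc w u} q₁)) , does-ne (w ≟ v′) (not-e (∧-r {(T w ∧ inc w u) ∧ not (does (w ≟ v))} q))
    where
    q₁ : (T w ∧ inc w u) ∧ not (does (w ≟ v)) ≡ true
    q₁ = ∧-l q

  third : ∀ {u v v′} → T v ≡ true → inc v u ≡ true → T v′ ≡ true → inc v′ u ≡ true → v ≢ v′ → 3 ≤ d u → ∃ (Third u v v′)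
  third {u} {v} {v′} t i t′ i′ ne p with #-pos (≤-pred (≤-pred (subst (3 ≤_) (others₂ u v v′ t i t′ i′ ne) p)))
  ... | w , q = w , third-e q

  two-more : ∀ {u v v′} → T v ≡ true → inc v u ≡ true → T v′ ≡ true → inc v′ u ≡ true → v ≢ v′ → 4 ≤ d u →
    ∃ λ w → ∃ λ w′ → Third u v v′ w × Third u v v′ w′ × w ≢ w′
  two-more {u} {v} {v′} t i t′ i′ ne p with take-distinct _ 2 (≤-pred (≤-pred (subst (4 ≤_) (others₂ u v v′ t i t′ i′ ne) p)))
  ... | (w ∷ w′ ∷ []) , refl , (q ∷ q′ ∷ []) , ((ww ∷ []) ∷ _) = w , w′ , third-e q , third-e q′ , ww

  module Large (large : 64 < # T) where

    -- If no edge avoided F, a triple would be determined by its intersection with F.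
    free-edge : ∀ F → length F ≤ 6 → ∃ λ g → ∃ λ g′ → g ~ g′ × Y g ≡ true × Y g′ ≡ true × ¬ g ∈ F × ¬ g′ ∈ F
    free-edge F len = go (homogenize (map (λ f v → inc v f) F) T)
      where
      go : Homogeneous (map (λ f v → inc v f) F) T → ∃ λ g → ∃ λ g′ → g ~ g′ × Y g ≡ true × Y g′ ≡ true × ¬ g ∈ F × ¬ g′ ∈ F
      go (T′ , sub , le , hom) with 2 ≤? # T′
      ... | no q = ⊥-elim (<⇒≱ large (≤-trans le (≤-trans (*-mono-≤ (^-monoʳ-≤ 2 (≤-trans (≤-reflexive (length-map _ F)) len)) (≤-pred (≰⇒> q))) ≤-refl)))
      ... | yes q with take-distinct T′ 2 q
      ...   | (v ∷ v′ ∷ []) , refl , (t ∷ t′ ∷ []) , ((v≢v′ ∷ []) ∷ _) with any? (λ u → (inc v′ u ≟ᵇ true) ×-dec (inc v u ≟ᵇ false))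
      ...     | no none = ⊥-elim (v≢v′ (sep (sub v t) (sub v′ t′) (λ u → ≡sym (#-⊂-eq below (trans (size (sub v′ t′)) (≡sym (size (sub v t)))) u))))
        where
        below : ∀ u → inc v′ u ≡ true → inc v u ≡ true
        below u p with decide (inc v u)
        ... | inj₁ r = r
        ... | inj₂ r = ⊥-elim (none (u , p , r))
      ...     | yes (u , iu′ , iu) with domin (sub v t) (inY (sub v′ t′) iu′) iu
      ...       | s , is , us = u , s , us , inY (sub v′ t′) iu′ , inY (sub v t) is ,
                    (λ m → clash (trans (agree u m) iu′) iu) ,
                    (λ m → clash us (indep (sub v′ t′) iu′ (trans (≡sym (agree s m)) is)))
        where
        agree : ∀ f → f ∈ F → inc v f ≡ inc v′ f
        agree f m = All.lookup (AllP.map⁻ hom) m v v′ t t′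

    record Path (v v′ y a b b′ : Fin n) : Set where
      field
        m₁ : M v y a b
        m₂ : M v′ y a b′
        b~b′ : b ~ b′
        b≢b′ : b ≢ b′
    open Path

    -- The first triple must dominate `b′`, and independence of the second rules out `y` and `a`.
    path : ∀ {v v′ y a b b′} → M v y a b → M v′ y a b′ → v ≢ v′ → Path v v′ y a b b′
    path {b = b} {b′} m m′ ne = record { m₁ = m ; m₂ = m′ ; b~b′ = ~-sym e ; b≢b′ = b≢b′′ }
      where
      b≢b′′ : b ≢ b′
      b≢b′′ refl = ne (same m m′)
      e : b′ ~ b
      e with dom m (bY m′)
      ... | eq₁ q = ⊥-elim (y≢b m′ (≡sym q))
      ... | eq₂ q = ⊥-elim (a≢b m′ (≡sym q))
      ... | eq₃ q = ⊥-elim (b≢b′′ (≡sym q))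
      ... | ad₁ q = ⊥-elim (yb≁ m′ (~-sym q))
      ... | ad₂ q = ⊥-elim (ab≁ m′ (~-sym q))
      ... | ad₃ q = q

    -- Otherwise `g` would see both ends of the edge between `b` and `b′`.
    near : ∀ {v v′ y a b b′ g} → Path v v′ y a b b′ → Y g ≡ true → g ≢ y → g ≢ a → g ≢ b → g ≢ b′ → g ~ y ⊎ g ~ a
    near {g = g} P yg ny na nb nb′ with dom (m₁ P) yg | dom (m₂ P) yg
    ... | eq₁ q | _ = ⊥-elim (ny q)
    ... | eq₂ q | _ = ⊥-elim (na q)
    ... | eq₃ q | _ = ⊥-elim (nb q)
    ... | ad₁ q | _ = inj₁ q
    ... | ad₂ q | _ = inj₂ q
    ... | ad₃ q | eq₁ r = ⊥-elim (ny r)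
    ... | ad₃ q | eq₂ r = ⊥-elim (na r)
    ... | ad₃ q | eq₃ r = ⊥-elim (nb′ r)
    ... | ad₃ q | ad₁ r = inj₁ r
    ... | ad₃ q | ad₂ r = inj₂ r
    ... | ad₃ q | ad₃ r = ⊥-elim (tri q r (b~b′ P))

    no-third : ∀ {v v′ v″ y a b b′ b″} → M v y a b → M v′ y a b′ → M v″ y a b″ → v ≢ v′ → v ≢ v″ → v′ ≢ v″ → ⊥
    no-third m m′ m″ p q r = tri (b~b′ (path m m′ p)) (b~b′ (path m m″ q)) (b~b′ (path m′ m″ r))

    -- Both `c` and `e` see `a`, so a vertex that sees `a` sees neither of them and is dominated by
    -- `{y , c , e}` only through `y`. Hence all vertices beyond these six see `y`, against
    -- `free-edge`. The six vertices are the source of 64.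
    no-disjoint : ∀ {v v′ w y a b b′ c e} → Path v v′ y a b b′ → M w y c e →
      c ≢ a → c ≢ b → c ≢ b′ → e ≢ a → e ≢ b → e ≢ b′ → ⊥
    no-disjoint {y = y} {a} {b} {b′} {c} {e} P m ca cb cb′ ea eb eb′ with free-edge (y ∷ a ∷ b ∷ b′ ∷ c ∷ e ∷ []) ≤-refl
    ... | g , g′ , gg , yg , yg′ , ng , ng′ = tri gg (at-y yg ng) (at-y yg′ ng′)
      where
      c~a : c ~ a
      c~a = [ (λ q → ⊥-elim (ya≁ m (~-sym q))) , id ]′ (near P (aY m) (y≢a m ∘ ≡sym) ca cb cb′)
      e~a : e ~ a
      e~a = [ (λ q → ⊥-elim (yb≁ m (~-sym q))) , id ]′ (near P (bY m) (y≢b m ∘ ≡sym) ea eb eb′)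
      at-y : ∀ {g} → Y g ≡ true → ¬ g ∈ (y ∷ a ∷ b ∷ b′ ∷ c ∷ e ∷ []) → g ~ y
      at-y yg ng with near P yg (ng ∘ here) (ng ∘ there ∘ here) (ng ∘ there ∘ there ∘ here) (ng ∘ there ∘ there ∘ there ∘ here)
      ... | inj₁ q = q
      ... | inj₂ q with dom m yg
      ...   | eq₁ r = ⊥-elim (ng (here r))
      ...   | eq₂ r = ⊥-elim (ng (there (there (there (there (here r))))))
      ...   | eq₃ r = ⊥-elim (ng (there (there (there (there (there (here r)))))))
      ...   | ad₁ r = r
      ...   | ad₂ r = ⊥-elim (tri r q c~a)
      ...   | ad₃ r = ⊥-elim (tri r q e~a)

    -- As `a` and `a′` are adjacent, a further vertex cannot see both, so by `near` it sees `y`;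
    -- this contradicts `free-edge`.
    no-square : ∀ {v₁ v₂ v₃ v₄ y a a′ b b′} → M v₁ y a b → M v₂ y a b′ → M v₃ y a′ b → M v₄ y a′ b′ →
      v₁ ≢ v₂ → v₁ ≢ v₃ → v₃ ≢ v₄ → ⊥
    no-square {y = y} {a} {a′} {b} {b′} m₁₁ m₁₂ m₂₁ m₂₂ p q r with free-edge (y ∷ a ∷ a′ ∷ b ∷ b′ ∷ []) (n≤1+n 5)
    ... | g , g′ , gg , yg , yg′ , ng , ng′ = tri gg (at-y yg ng) (at-y yg′ ng′)
      where
      a~a′ : a ~ a′
      a~a′ = b~b′ (path (swp m₁₁) (swp m₂₁) q)
      at-y : ∀ {g} → Y g ≡ true → ¬ g ∈ (y ∷ a ∷ a′ ∷ b ∷ b′ ∷ []) → g ~ y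
      at-y yg ng with near (path m₁₁ m₁₂ p) yg (ng ∘ here) (ng ∘ there ∘ here) (ng ∘ there ∘ there ∘ there ∘ here) (ng ∘ there ∘ there ∘ there ∘ there ∘ here)
                    | near (path m₂₁ m₂₂ r) yg (ng ∘ here) (ng ∘ there ∘ there ∘ here) (ng ∘ there ∘ there ∘ there ∘ here) (ng ∘ there ∘ there ∘ there ∘ there ∘ here)
      ... | inj₁ s | _ = s
      ... | inj₂ s | inj₁ t = t
      ... | inj₂ s | inj₂ t = ⊥-elim (tri s t a~a′)

    -- Given `{y , a , b}` and `{y , a , b′}`, each of two further triples through `y` contains `b`
    -- or `b′`. If they use the same one, three triples share a pair; if not, there is a square or
    -- the situation of `no-disjoint`.
    codegree-one : ∀ {v v′ y a} → 4 ≤ d y → T v ≡ true → T v′ ≡ true → inc v y ≡ true → inc v′ y ≡ true →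
      inc v a ≡ true → inc v′ a ≡ true → a ≢ y → v ≡ v′
    codegree-one {v} {v′} {y} {a} deg t t′ iy iy′ ia ia′ a≢y with v ≟ v′
    ... | yes e = e
    ... | no ne = ⊥-elim (cases (with-two t iy ia) (with-two t′ iy′ ia′) (two-more t iy t′ iy′ ne deg))
      where
      with-two : ∀ {v} → T v ≡ true → inc v y ≡ true → inc v a ≡ true → ∃ λ b → M v y a b
      with-two t iy ia with complete t iy
      ... | b , c , m with cov m a ia
      ...   | inj₁ q = ⊥-elim (a≢y q)
      ...   | inj₂ (inj₁ refl) = c , m
      ...   | inj₂ (inj₂ refl) = b , swp m
      cases : (∃ λ b → M v y a b) → (∃ λ b → M v′ y a b) → (∃ λ w → ∃ λ w′ → Third y v v′ w × Third y v v′ w′ × w ≢ w′) → ⊥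
      cases (b , m) (b′ , m′) (w , w′ , τ@(_ , _ , wv , wv′) , τ′@(_ , _ , w′v , w′v′) , ww) = go (locate τ) (locate τ′)
        where
        P = path m m′ ne
        locate : ∀ {w} → Third y v v′ w → (∃ λ c → M w y b c × c ≢ a) ⊎ (∃ λ c → M w y b′ c × c ≢ a)
        locate {w} (tw , iw , wv , wv′) with complete tw iw
        ... | c , e , mw with c ≟ a | e ≟ a
        ...   | yes refl | _ = ⊥-elim (no-third m m′ mw ne (wv ∘ ≡sym) (wv′ ∘ ≡sym))
        ...   | no _ | yes refl = ⊥-elim (no-third m m′ (swp mw) ne (wv ∘ ≡sym) (wv′ ∘ ≡sym))
        ...   | no ca | no ea with c ≟ b | c ≟ b′ | e ≟ b | e ≟ b′
        ...     | yes refl | _ | _ | _ = inj₁ (e , mw , ea)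
        ...     | no _ | yes refl | _ | _ = inj₂ (e , mw , ea)
        ...     | no _ | no _ | yes refl | _ = inj₁ (c , swp mw , ca)
        ...     | no _ | no _ | no _ | yes refl = inj₂ (c , swp mw , ca)
        ...     | no cb | no cb′ | no eb | no eb′ = ⊥-elim (no-disjoint P mw ca cb cb′ ea eb eb′)
        mixed : ∀ {w w′ c c′} → M w y b c → M w′ y b′ c′ → c ≢ a → c′ ≢ a → w ≢ v → w ≢ w′ → ⊥
        mixed {w} {w′} {c} {c′} mw mw′ ca ca′ wv ww with c ≟ c′
        ... | yes refl = no-square m m′ (swp mw) (swp mw′) ne (wv ∘ ≡sym) ww
        ... | no cc = no-disjoint (path (swp m) mw (wv ∘ ≡sym)) mw′ (b≢b′ P ∘ ≡sym) (a≢b m′ ∘ ≡sym)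
                        (λ { refl → ab≁ mw (b~b′ P) }) (λ { refl → ab≁ mw′ (~-sym (b~b′ P)) }) ca′ (cc ∘ ≡sym)
        go : (∃ λ c → M w y b c × c ≢ a) ⊎ (∃ λ c → M w y b′ c × c ≢ a) → (∃ λ c → M w′ y b c × c ≢ a) ⊎ (∃ λ c → M w′ y b′ c × c ≢ a) → ⊥
        go (inj₁ (_ , mw , _)) (inj₁ (_ , mw′ , _)) = no-third (swp m) mw mw′ (wv ∘ ≡sym) (w′v ∘ ≡sym) ww
        go (inj₂ (_ , mw , _)) (inj₂ (_ , mw′ , _)) = no-third (swp m′) mw mw′ (wv′ ∘ ≡sym) (w′v′ ∘ ≡sym) ww
        go (inj₁ (_ , mw , ca)) (inj₂ (_ , mw′ , ca′)) = mixed mw mw′ ca ca′ wv ww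
        go (inj₂ (_ , mw , ca)) (inj₁ (_ , mw′ , ca′)) = mixed mw′ mw ca′ ca w′v (ww ∘ ≡sym)

    record Crown (y : Fin n) (a b : Fin 4 → Fin n) : Set where
      field
        w      : Fin 4 → Fin n
        petal  : ∀ i → M (w i) y (a i) (b i)
        cross  : ∀ i j → i ≢ j → a i ~ b j
        high   : 4 ≤ d y
    open Crown

    crown-swap : ∀ {y a b} → Crown y a b → Crown y b a
    crown-swap c = record { w = w c ; petal = λ i → swp (petal c i) ; cross = λ i j ne → ~-sym (cross c j i (ne ∘ ≡sym)) ; high = high c }

    disjoint : ∀ {v v′ y a b c e} → 4 ≤ d y → M v y a b → M v′ y c e → v ≢ v′ → a ≢ c × a ≢ e
    disjoint deg m m′ ne =
      (λ { refl → ne (codegree-one deg (inT m) (inT m′) (iy m) (iy m′) (ia m) (ia m′) (y≢a m ∘ ≡sym)) }) ,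
      (λ { refl → ne (codegree-one deg (inT m) (inT m′) (iy m) (iy m′) (ia m) (ib m′) (y≢a m ∘ ≡sym)) })

    meets : ∀ {v v′ y a b c e} → 4 ≤ d y → M v y a b → M v′ y c e → v ≢ v′ → a ~ c ⊎ a ~ e
    meets deg m m′ ne with dom m′ (aY m) | disjoint deg m m′ ne
    ... | eq₁ q | _ = ⊥-elim (y≢a m (≡sym q))
    ... | eq₂ q | nc , _ = ⊥-elim (nc q)
    ... | eq₃ q | _ , ne′ = ⊥-elim (ne′ q)
    ... | ad₁ q | _ = ⊥-elim (ya≁ m (~-sym q))
    ... | ad₂ q | _ = inj₁ q
    ... | ad₃ q | _ = inj₂ q

    -- Each of the four vertices has a neighbour in the other petal, so there is a perfect matching
    -- between the petals; it fixes the order of the second one.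
    oriented : ∀ {v v′ y a b c e} → 4 ≤ d y → M v y a b → M v′ y c e → v′ ≢ v →
      ∃ λ a′ → ∃ λ b′ → M v′ y a′ b′ × a′ ~ b × a ~ b′
    oriented {c = c} {e} deg m m′ ne with meets deg m′ m ne | meets deg (swp m′) m ne | meets deg m m′ (ne ∘ ≡sym) | meets deg (swp m) m′ (ne ∘ ≡sym)
    ... | inj₂ cb | inj₁ ea | _ | _ = c , e , m′ , cb , ~-sym ea
    ... | inj₁ ca | inj₂ eb | _ | _ = e , c , swp m′ , eb , ~-sym ca
    ... | inj₁ ca | inj₁ ea | _ | inj₁ bc = c , e , m′ , ~-sym bc , ~-sym ea
    ... | inj₁ ca | inj₁ ea | _ | inj₂ be = e , c , swp m′ , ~-sym be , ~-sym ca
    ... | inj₂ cb | inj₂ eb | inj₁ ac | _ = e , c , swp m′ , eb , ac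
    ... | inj₂ cb | inj₂ eb | inj₂ ae | _ = c , e , m′ , cb , ae

    -- Three further petals are oriented towards `{α , β}`. Their vertices `a i` all see `β`, so
    -- they are pairwise non-adjacent, and `a i` must see `b j` in another petal.
    crown : ∀ {v y α β} → 4 ≤ d y → M v y α β → ∃ λ a → ∃ λ b → Crown y a b × a zero ≡ α × b zero ≡ β
    crown {v} {y} {α} {β} deg m with take-distinct _ 3 (≤-pred (subst (4 ≤_) (others y v (inT m) (iy m)) deg))
    ... | (w₁ ∷ w₂ ∷ w₃ ∷ []) , refl , al , ap = a , b , record { w = wt ; petal = pt ; cross = cr ; high = deg } , refl , refl
      where
      ws = w₁ ∷ w₂ ∷ w₃ ∷ []
      data-of : ∀ i → ∃ λ a′ → ∃ λ b′ → M (lookup ws i) y a′ b′ × a′ ~ β × α ~ b′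
      data-of i with All.lookup al (∈-lookup {xs = ws} i)
      ... | q with complete (∧-l (∧-l {T (lookup ws i) ∧ inc (lookup ws i) y} q)) (∧-r {T (lookup ws i)} (∧-l {T (lookup ws i) ∧ inc (lookup ws i) y} q))
      ...   | _ , _ , m′ = oriented deg m m′ (does-ne (lookup ws i ≟ v) (not-e (∧-r {T (lookup ws i) ∧ inc (lookup ws i) y} q)))
      wt a b : Fin 4 → Fin n
      wt zero    = v
      wt (suc i) = lookup ws i
      a zero    = α
      a (suc i) = proj₁ (data-of i)
      b zero    = β
      b (suc i) = proj₁ (proj₂ (data-of i))
      pt : ∀ i → M (wt i) y (a i) (b i)
      pt zero    = m
      pt (suc i) = proj₁ (proj₂ (proj₂ (data-of i)))
      a~β : ∀ i → a (suc i) ~ β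
      a~β i = proj₁ (proj₂ (proj₂ (proj₂ (data-of i))))
      cr : ∀ i j → i ≢ j → a i ~ b j
      cr zero zero q = ⊥-elim (q refl)
      cr zero (suc j) q = proj₂ (proj₂ (proj₂ (proj₂ (data-of j))))
      cr (suc i) zero q = a~β i
      cr (suc i) (suc j) q = [ (λ r → ⊥-elim (tri r (a~β i) (a~β j))) , id ]′
        (meets deg (pt (suc i)) (pt (suc j)) (lookup-distinct ap i j (q ∘ cong suc)))

    module _ {y : Fin n} {a b : Fin 4 → Fin n} (c : Crown y a b) where
      b≁b : ∀ i j → ¬ b i ~ b j
      b≁b i j p with avoid3 i j i
      ... | k , ki , kj , _ = tri p (~-sym (cross c k i ki)) (~-sym (cross c k j kj))

      a≁y : ∀ i → ¬ a i ~ y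
      a≁y i p = ya≁ (petal c i) (~-sym p)

      b≁y : ∀ i → ¬ b i ~ y
      b≁y i p = yb≁ (petal c i) (~-sym p)

      ab-i : ∀ i → ¬ a i ~ b i
      ab-i i = ab≁ (petal c i)

      b-inj : ∀ {i j} → i ≢ j → b i ≢ b j
      b-inj {i} {j} q e = ab-i i (subst (a i ~_) (≡sym e) (cross c i j q))

      -- Seeing `a zero` excludes every `b i` with another index, and likewise with the sides
      -- exchanged, so the choice at one petal spreads to all.
      outside : ∀ {u} → Y u ≡ true → ¬ u ~ y → u ≢ y → (∀ i → u ≢ a i) → (∀ i → u ≢ b i) → (∀ i → u ~ a i) ⊎ (∀ i → u ~ b i)
      outside {u} yu uy ny na nb = [ (λ p → inj₁ (spread-a p)) , (λ p → inj₂ (spread-b p)) ]′ (one zero)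
        where
        one : ∀ i → u ~ a i ⊎ u ~ b i
        one i with dom (petal c i) yu
        ... | eq₁ q = ⊥-elim (ny q)
        ... | eq₂ q = ⊥-elim (na i q)
        ... | eq₃ q = ⊥-elim (nb i q)
        ... | ad₁ q = ⊥-elim (uy q)
        ... | ad₂ q = inj₁ q
        ... | ad₃ q = inj₂ q
        spread-a : u ~ a zero → ∀ i → u ~ a i
        spread-a p i with i ≟ zero
        ... | yes refl = p
        ... | no q = [ id , (λ r → ⊥-elim (tri p r (cross c zero i (q ∘ ≡sym)))) ]′ (one i)
        spread-b : u ~ b zero → ∀ i → u ~ b i
        spread-b p i with i ≟ zero
        ... | yes refl = p
        ... | no q = [ (λ r → ⊥-elim (tri r p (cross c i zero q))) , id ]′ (one i)

      -- A further triple {b₀, p, q} through b₀ that avoids a₀; the index e is the exceptional petal met by q, if any.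
      record Ext (v p q : Fin n) : Set where
        field
          m     : M v (b zero) p q
          p~y   : p ~ y
          e     : Fin 4
          p~b   : ∀ k → k ≢ zero → k ≢ e → p ~ b k
          q~a₀  : q ~ a zero
          shape : q ~ y ⊎ (¬ q ~ y × (∀ k → k ≢ e → q ~ a k))

      -- With `Ext` the only kinds of further triples through `b zero`, by `classify`.
      Cap : Fin n → Fin n → Set
      Cap v p = M v (b zero) (a zero) p × p ~ y

      y≁v : ∀ {v} → T v ≡ true → inc v (b zero) ≡ true → v ≢ w c zero → ¬ inc v y ≡ true
      y≁v t i ne j = ne (codegree-one (high c) t (inT (petal c zero)) j (iy (petal c zero)) i (ib (petal c zero)) (y≢b (petal c zero) ∘ ≡sym))

      dom-b : ∀ {v p q} → M v (b zero) p q → ∀ k → k ≢ zero → b k ≢ p → b k ≢ q → ¬ q ~ b k → p ~ b k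
      dom-b m k k0 np nq q≁ with dom m (bY (petal c k))
      ... | eq₁ r = ⊥-elim (b-inj k0 r)
      ... | eq₂ r = ⊥-elim (np r)
      ... | eq₃ r = ⊥-elim (nq r)
      ... | ad₁ r = ⊥-elim (b≁b k zero r)
      ... | ad₂ r = ~-sym r
      ... | ad₃ r = ⊥-elim (q≁ (~-sym r))

      ≢-nbr : ∀ {u v} → u ~ y → ¬ v ~ y → v ≢ u
      ≢-nbr p q refl = q p

      classify₁ : ∀ {v p q} → M v (b zero) p q → p ~ y → (∃ λ p → Cap v p) ⊎ (∃ λ p → ∃ λ q → Ext v p q)
      classify₁ {v} {p} {q} m py with q ≟ a zero
      ... | yes refl = inj₁ (p , swp m , py)
      ... | no q≢a₀ = inj₂ (go (decide (adj G q y)))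
        where
        both : ∀ {p q} → M v (b zero) p q → p ~ y → q ~ y → q ~ a zero → ∃ λ p → ∃ λ q → Ext v p q
        both {p} {q} m py qy qa = p , q , record { m = m ; p~y = py ; e = zero ; q~a₀ = qa ; shape = inj₁ qy
          ; p~b = λ k k0 _ → dom-b m k k0 (≢-nbr py (b≁y k)) (≢-nbr qy (b≁y k)) (λ r → tri qa r (cross c zero k (k0 ∘ ≡sym))) }
        go : q ~ y ⊎ adj G q y ≡ false → ∃ λ p → ∃ λ q → Ext v p q
        go (inj₁ qy) with dom m (aY (petal c zero))
        ... | eq₁ r = ⊥-elim (a≢b (petal c zero) r)
        ... | eq₂ r = ⊥-elim (≢-nbr py (a≁y zero) r)
        ... | eq₃ r = ⊥-elim (q≢a₀ (≡sym r))
        ... | ad₁ r = ⊥-elim (ab-i zero r)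
        ... | ad₂ r = both (swp m) qy py (~-sym r)
        ... | ad₃ r = both m py qy (~-sym r)
        go (inj₂ qy) with any? (λ i → q ≟ a i) | any? (λ i → q ≟ b i)
        ... | yes (i , refl) | _ = ⊥-elim (yb≁ m (~-sym (cross c i zero (λ { refl → q≢a₀ refl }))))
        ... | no _ | yes (i , refl) = p , q , record { m = m ; p~y = py ; e = i ; q~a₀ = ~-sym (cross c zero i (λ { refl → y≢b m refl }))
              ; shape = inj₂ ((λ r → clash r qy) , λ k ki → ~-sym (cross c k i ki))
              ; p~b = λ k k0 ki → dom-b m k k0 (≢-nbr py (b≁y k)) (b-inj ki) (b≁b i k) }
        ... | no na | no nb with outside (bY m) (λ r → clash r qy) q≢y (λ i r → na (i , r)) (λ i r → nb (i , r))
          where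
          q≢y : q ≢ y
          q≢y refl = ya≁ (rot m) py
        ...   | inj₁ qa = p , q , record { m = m ; p~y = py ; e = zero ; q~a₀ = qa zero ; shape = inj₂ ((λ r → clash r qy) , λ k _ → qa k)
              ; p~b = λ k k0 _ → dom-b m k k0 (≢-nbr py (b≁y k)) (λ r → nb (k , ≡sym r))
                        (λ r → let j , jk , _ = avoid3 k k k in tri (qa j) r (cross c j k jk)) }
        ...   | inj₂ qb = ⊥-elim (yb≁ m (~-sym (qb zero)))

      -- The triple dominates `y` but does not contain it, by `codegree-one`, and `b zero` does not
      -- see `y`. So one of its other two elements does.
      classify : ∀ {v} → T v ≡ true → inc v (b zero) ≡ true → v ≢ w c zero → (∃ λ p → Cap v p) ⊎ (∃ λ p → ∃ λ q → Ext v p q)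
      classify {v} t i ne with complete t i
      ... | p , q , m with dom m (yY (petal c zero))
      ...   | eq₁ r = ⊥-elim (y≢b (petal c zero) r)
      ...   | eq₂ refl = ⊥-elim (y≁v t i ne (ia m))
      ...   | eq₃ refl = ⊥-elim (y≁v t i ne (ib m))
      ...   | ad₁ r = ⊥-elim (yb≁ (petal c zero) r)
      ...   | ad₂ r = classify₁ m (~-sym r)
      ...   | ad₃ r = classify₁ (swp m) (~-sym r)

      ext-p≁a : ∀ {v p q} → Ext v p q → ∀ j → ¬ p ~ a j
      ext-p≁a x j r with avoid3 zero (Ext.e x) j
      ... | k , k0 , ke , kj = tri r (Ext.p~b x k k0 ke) (cross c j k (kj ∘ ≡sym))

      -- The cap dominates `p′`, which cannot see `a zero`; seeing `p` would close a triangle with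
      -- `y`.
      cap-ext : ∀ {v v′ p p′ q} → Cap v p → Ext v′ p′ q → p′ ≡ p
      cap-ext (m , py) x with dom m (aY (Ext.m x))
      ... | eq₁ r = ⊥-elim (y≢a (Ext.m x) (≡sym r))
      ... | eq₂ r = ⊥-elim (a≁y zero (subst (_~ y) r (Ext.p~y x)))
      ... | eq₃ r = r
      ... | ad₁ r = ⊥-elim (ya≁ (Ext.m x) (~-sym r))
      ... | ad₂ r = ⊥-elim (ext-p≁a x zero r)
      ... | ad₃ r = ⊥-elim (tri r (Ext.p~y x) py)

      cap-unique : ∀ {v v′ p p′} → Cap v p → Cap v′ p′ → v ≡ v′
      cap-unique {v} {v′} (m , py) (m′ , py′) with dom m (bY m′)
      ... | eq₁ r = ⊥-elim (y≢b m′ (≡sym r))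
      ... | eq₂ r = ⊥-elim (a≢b m′ (≡sym r))
      ... | eq₃ refl = same m m′
      ... | ad₁ r = ⊥-elim (yb≁ m′ (~-sym r))
      ... | ad₂ r = ⊥-elim (ab≁ m′ (~-sym r))
      ... | ad₃ r = ⊥-elim (tri r py′ py)

      ext-unique : ∀ {v v′ p q q′} → Ext v p q → Ext v′ p q′ → v ≡ v′
      ext-unique x x′ with dom (Ext.m x) (bY (Ext.m x′))
      ... | eq₁ r = ⊥-elim (y≢b (Ext.m x′) (≡sym r))
      ... | eq₂ r = ⊥-elim (a≢b (Ext.m x′) (≡sym r))
      ... | eq₃ refl = same (Ext.m x) (Ext.m x′)
      ... | ad₁ r = ⊥-elim (yb≁ (Ext.m x′) (~-sym r))
      ... | ad₂ r = ⊥-elim (ab≁ (Ext.m x′) (~-sym r))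
      ... | ad₃ r = ⊥-elim (tri r (Ext.q~a₀ x′) (Ext.q~a₀ x))

    -- However `{b zero , p , q}` dominates `p′`, there is a contradiction. If `p′` sees `q` and `q`
    -- does not see `y`, then both see some `a k`, where `k` has to avoid zero and both exceptional
    -- indices.
    not-both : ∀ {y a b} (c : Crown y a b) {v v′ p q p′ q′} → Ext c v p q → Ext (crown-swap c) v′ p′ q′ → ⊥
    not-both {y} {a} {b} c {v} {v′} {p} {q} {p′} {q′} x x′ with dom (Ext.m x) (aY (Ext.m x′))
    ... | eq₁ refl = b≁y c zero (Ext.p~y x′)
    ... | eq₂ refl = let k , k0 , ke , _ = avoid3 zero (Ext.e x′) zero in ext-p≁a c x k (Ext.p~b x′ k k0 ke)
    ... | eq₃ refl = eq-q (Ext.shape x)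
      where
      eq-q : q ~ y ⊎ (¬ q ~ y × (∀ k → k ≢ Ext.e x → q ~ a k)) → ⊥
      eq-q (inj₁ _) = ya≁ (Ext.m x′) (~-sym (Ext.q~a₀ x))
      eq-q (inj₂ (qy , _)) = qy (Ext.p~y x′)
    ... | ad₁ r = ext-p≁a (crown-swap c) x′ zero r
    ... | ad₂ r = tri r (Ext.p~y x′) (Ext.p~y x)
    ... | ad₃ r = adj-q (Ext.shape x)
      where
      adj-q : q ~ y ⊎ (¬ q ~ y × (∀ k → k ≢ Ext.e x → q ~ a k)) → ⊥
      adj-q (inj₁ qy) = tri r (Ext.p~y x′) qy
      adj-q (inj₂ (_ , qa)) = let k , k0 , ke , ke′ = avoid3 zero (Ext.e x) (Ext.e x′) in tri r (Ext.p~b x′ k k0 ke′) (qa k ke)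

    record Petal (v y α β : Fin n) : Set where
      field
        v₁ p  : Fin n
        cap   : M v₁ α β p
        v≢v₁  : v ≢ v₁
        α≤3   : d α ≤ 3
        β≤3   : d β ≤ 3
        not33 : ¬ (3 ≤ d α × 3 ≤ d β)
        ext-β : 3 ≤ d β → ∃ λ v₂ → v₂ ≢ v₁ × T v₂ ≡ true × inc v₂ β ≡ true × inc v₂ p ≡ true

    -- Further triples run through `α` and through `β`; by `not-both` one of them is a cap
    -- `{α , β , p}`. Beyond the given triple and the cap there is at most one extension at each of
    -- `α` and `β`, and not at both.
    petal-of : ∀ {v y α β} → 4 ≤ d y → M v y α β → 2 ≤ d α → 2 ≤ d β → Petal v y α β
    petal-of {v} {y} deg m₀ dα dβ with crown deg m₀
    ... | a , b , c , refl , refl = finish cap-exists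
      where
      c′ = crown-swap c
      v₀ = w c zero
      v₀≡v : v₀ ≡ v
      v₀≡v = same (petal c zero) m₀
      to-b : ∀ {v p} → Cap c′ v p → Cap c v p
      to-b (m , py) = flp m , py
      to-a : ∀ {v p} → Cap c v p → Cap c′ v p
      to-a (m , py) = flp m , py
      iα : inc v₀ (a zero) ≡ true
      iα = ia (petal c zero)
      iβ : inc v₀ (b zero) ≡ true
      iβ = ib (petal c zero)
      t₀ = inT (petal c zero)
      cap-exists : ∃ λ v₁ → ∃ λ p → Cap c v₁ p
      cap-exists with another t₀ iα dα | another t₀ iβ dβ
      ... | w , tw , iw , nw | w′ , tw′ , iw′ , nw′ with classify c′ tw iw nw | classify c tw′ iw′ nw′
      ...   | inj₁ (p , q) | _ = w , p , to-b q
      ...   | inj₂ _ | inj₁ (p , q) = w′ , p , q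
      ...   | inj₂ (_ , _ , x′) | inj₂ (_ , _ , x) = ⊥-elim (not-both c x x′)
      module _ {a b : Fin 4 → Fin n} (c : Crown y a b) {v₁ p} (cp : Cap c v₁ p) where
        v₀≢v₁ : w c zero ≢ v₁
        v₀≢v₁ refl with cov (petal c zero) p (ib (proj₁ cp))
        ... | inj₁ refl = ~-irr (proj₂ cp)
        ... | inj₂ (inj₁ refl) = a≁y c zero (proj₂ cp)
        ... | inj₂ (inj₂ refl) = b≁y c zero (proj₂ cp)
        beyond : ∀ {v} → Third (b zero) (w c zero) v₁ v → ∃ λ q → Ext c v p q
        beyond (tv , iv , n₀ , n₁) with classify c tv iv n₀
        ... | inj₁ (_ , cp′) = ⊥-elim (n₁ (cap-unique c cp′ cp))
        ... | inj₂ (_ , q , x) with cap-ext c cp x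
        ...   | refl = q , x
        third-b : 3 ≤ d (b zero) → ∃ (Third (b zero) (w c zero) v₁)
        third-b = third (inT (petal c zero)) (ib (petal c zero)) (inT (proj₁ cp)) (iy (proj₁ cp)) v₀≢v₁
        d≤3 : d (b zero) ≤ 3
        d≤3 with 4 ≤? d (b zero)
        ... | no q = ≤-pred (≰⇒> q)
        ... | yes q with two-more (inT (petal c zero)) (ib (petal c zero)) (inT (proj₁ cp)) (iy (proj₁ cp)) v₀≢v₁ q
        ...   | _ , _ , τ , τ′ , ne = ⊥-elim (ne (ext-unique c (proj₂ (beyond τ)) (proj₂ (beyond τ′))))
      finish : (∃ λ v₁ → ∃ λ p → Cap c v₁ p) → Petal v y (a zero) (b zero)
      finish (v₁ , p , cp) = record
        { v₁ = v₁ ; p = p ; cap = flp (proj₁ cp) ; v≢v₁ = subst (_≢ v₁) v₀≡v (v₀≢v₁ c cp)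
        ; α≤3 = d≤3 c′ (to-a cp) ; β≤3 = d≤3 c cp
        ; not33 = λ { (r , s) → not-both c (proj₂ (beyond c cp (proj₂ (third-b c cp s)))) (proj₂ (beyond c′ (to-a cp) (proj₂ (third-b c′ (to-a cp) r)))) }
        ; ext-β = λ s → let v₂ , τ = third-b c cp s
                            q , x = beyond c cp τ
                        in v₂ , proj₂ (proj₂ (proj₂ τ)) , inT (Ext.m x) , iy (Ext.m x) , ia (Ext.m x) }

    hi th : Fin n → Bool
    hi v = anyB (λ u → inc v u ∧ does (4 ≤? d u))
    th v = anyB (λ u → inc v u ∧ does (d u ≟ℕ 3))

    hi-i : ∀ {v u} → inc v u ≡ true → 4 ≤ d u → hi v ≡ true
    hi-i {v} {u} i p = anyB-i {f = λ u → inc v u ∧ does (4 ≤? d u)} u (∧-i i (does-i (4 ≤? d u) p))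

    hi-e : ∀ {v} → hi v ≡ true → ∃ λ u → inc v u ≡ true × 4 ≤ d u
    hi-e {v} p = let u , q = anyB-e {f = λ u → inc v u ∧ does (4 ≤? d u)} p in u , ∧-l q , does-e (4 ≤? d u) (∧-r {inc v u} q)

    th-i : ∀ {v u} → inc v u ≡ true → d u ≡ 3 → th v ≡ true
    th-i {v} {u} i p = anyB-i {f = λ u → inc v u ∧ does (d u ≟ℕ 3)} u (∧-i i (does-i (d u ≟ℕ 3) p))

    th-e : ∀ {v} → th v ≡ true → ∃ λ u → inc v u ≡ true × d u ≡ 3
    th-e {v} p = let u , q = anyB-e {f = λ u → inc v u ∧ does (d u ≟ℕ 3)} p in u , ∧-l q , does-e (d u ≟ℕ 3) (∧-r {inc v u} q)

    -- Every triple is paid at least 6 and every vertex pays at most 6. The values for degree 2 compensate triples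
    -- with a vertex of degree at least 4 (which pays nothing) and one of degree 3.
    charge : ℕ → Bool → Bool → ℕ
    charge 1 _     _     = 6
    charge 2 false _     = 2
    charge 2 true  false = 3
    charge 2 true  true  = 4
    charge 3 _     _     = 2
    charge _ _     _     = 0

    data Degree (k : ℕ) : Set where
      deg₁ : k ≡ 1 → Degree k
      deg₂ : k ≡ 2 → Degree k
      deg₃ : k ≡ 3 → Degree k
      deg₄ : 4 ≤ k → Degree k

    degree : ∀ k → 1 ≤ k → Degree k
    degree 1 p = deg₁ refl
    degree 2 p = deg₂ refl
    degree 3 p = deg₃ refl
    degree (suc (suc (suc (suc k)))) p = deg₄ (s≤s (s≤s (s≤s (s≤s z≤n))))

    d≥1 : ∀ {v u} → T v ≡ true → inc v u ≡ true → 1 ≤ d u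
    d≥1 {v} t i = #-pos′ v (∧-i t i)

    pay : Fin n → Fin n → ℕ
    pay v u = charge (d u) (hi v) (th v)

    pay₁ : ∀ v u → d u ≡ 1 → pay v u ≡ 6
    pay₁ v u e rewrite e = refl
    pay₃ : ∀ v u → d u ≡ 3 → pay v u ≡ 2
    pay₃ v u e rewrite e = refl
    pay₂ : ∀ v u → d u ≡ 2 → pay v u ≡ charge 2 (hi v) (th v)
    pay₂ v u e rewrite e = refl
    pay₄ : ∀ v u → 4 ≤ d u → pay v u ≡ 0
    pay₄ v u p = zero-charge p
      where
      zero-charge : ∀ {k a b} → 4 ≤ k → charge k a b ≡ 0
      zero-charge (s≤s (s≤s (s≤s (s≤s _)))) = refl

    -- If no other element has degree 1, then `petal-of` leaves the degrees 2, 2 and 2, 3, which pay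
    -- at least 3 + 3 and 4 + 2.
    pay-high : ∀ {v x y z} → M v x y z → 4 ≤ d x → 6 ≤ pay v y + pay v z
    pay-high {v} {x} {y} {z} m hx with degree (d y) (d≥1 (inT m) (ia m)) | degree (d z) (d≥1 (inT m) (ib m))
    ... | deg₁ e | _ rewrite pay₁ v y e = m≤m+n 6 _
    ... | _ | deg₁ e rewrite pay₁ v z e = m≤n+m 6 _
    ... | deg₄ p | deg₂ q = ⊥-elim (<⇒≱ p (Petal.α≤3 (petal-of hx m (≤-trans (s≤s (s≤s z≤n)) p) (≤-reflexive (≡sym q)))))
    ... | deg₄ p | deg₃ q = ⊥-elim (<⇒≱ p (Petal.α≤3 (petal-of hx m (≤-trans (s≤s (s≤s z≤n)) p) (≤-trans (n≤1+n 2) (≤-reflexive (≡sym q))))))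
    ... | deg₄ p | deg₄ q = ⊥-elim (<⇒≱ p (Petal.α≤3 (petal-of hx m (≤-trans (s≤s (s≤s z≤n)) p) (≤-trans (s≤s (s≤s z≤n)) q))))
    ... | deg₂ p | deg₄ q = ⊥-elim (<⇒≱ q (Petal.β≤3 (petal-of hx m (≤-reflexive (≡sym p)) (≤-trans (s≤s (s≤s z≤n)) q))))
    ... | deg₃ p | deg₄ q = ⊥-elim (<⇒≱ q (Petal.β≤3 (petal-of hx m (≤-trans (n≤1+n 2) (≤-reflexive (≡sym p))) (≤-trans (s≤s (s≤s z≤n)) q))))
    ... | deg₃ p | deg₃ q = ⊥-elim (Petal.not33 (petal-of hx m (≤-trans (n≤1+n 2) (≤-reflexive (≡sym p))) (≤-trans (n≤1+n 2) (≤-reflexive (≡sym q)))) (≤-reflexive (≡sym p) , ≤-reflexive (≡sym q)))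
    ... | deg₂ p | deg₃ q rewrite pay₂ v y p | pay₃ v z q | hi-i {v} (iy m) hx | th-i {v} (ib m) q = ≤-refl
    ... | deg₃ p | deg₂ q rewrite pay₃ v y p | pay₂ v z q | hi-i {v} (iy m) hx | th-i {v} (ia m) p = ≤-refl
    ... | deg₂ p | deg₂ q rewrite pay₂ v y p | pay₂ v z q | hi-i {v} (iy m) hx = lem (th v)
      where
      lem : ∀ b → 6 ≤ charge 2 true b + charge 2 true b
      lem true  = m≤m+n 6 2
      lem false = ≤-refl

    pay-low : ∀ {v u} → T v ≡ true → inc v u ≡ true → hi v ≡ false → 2 ≤ pay v u
    pay-low {v} {u} t i h with degree (d u) (d≥1 t i)
    ... | deg₁ e rewrite pay₁ v u e = m≤m+n 2 4
    ... | deg₂ e rewrite pay₂ v u e | h = ≤-refl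
    ... | deg₃ e rewrite pay₃ v u e = ≤-refl
    ... | deg₄ p = ⊥-elim (clash (hi-i i p) h)

    pay-triple : ∀ {v x y z} → M v x y z → 6 ≤ pay v x + (pay v y + pay v z)
    pay-triple {v} {x} {y} {z} m = [ found , (λ h → +-mono-≤ (pay-low (inT m) (iy m) h) (+-mono-≤ (pay-low (inT m) (ia m) h) (pay-low (inT m) (ib m) h))) ]′ (decide (hi v))
      where
      found : hi v ≡ true → 6 ≤ pay v x + (pay v y + pay v z)
      found h with hi-e {v} h
      ... | u , iu , hu with cov m u iu
      ...   | inj₁ refl = ≤-trans (pay-high m hu) (m≤n+m _ (pay v x))
      ...   | inj₂ (inj₁ refl) = ≤-trans (pay-high (flp m) hu) (+-monoʳ-≤ (pay v x) (m≤n+m (pay v z) (pay v y)))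
      ...   | inj₂ (inj₂ refl) = ≤-trans (pay-high (rot (rot m)) hu) (+-monoʳ-≤ (pay v x) (m≤m+n (pay v y) (pay v z)))

    arrange : ∀ {v x y z} → T v ≡ true → inc v x ≡ true → inc v y ≡ true → inc v z ≡ true → x ≢ y → x ≢ z → y ≢ z → M v x y z
    arrange {v} t ix iy′ iz xy xz yz with complete t ix
    ... | c , e , m with cov m _ iy′ | cov m _ iz
    ...   | inj₁ q | _ = ⊥-elim (xy (≡sym q))
    ...   | _ | inj₁ q = ⊥-elim (xz (≡sym q))
    ...   | inj₂ (inj₁ refl) | inj₂ (inj₁ refl) = ⊥-elim (yz refl)
    ...   | inj₂ (inj₁ refl) | inj₂ (inj₂ refl) = m
    ...   | inj₂ (inj₂ refl) | inj₂ (inj₁ refl) = swp m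
    ...   | inj₂ (inj₂ refl) | inj₂ (inj₂ refl) = ⊥-elim (yz refl)

    -- As `u` has degree 2, `v′` must be the cap `{u , β , p}`. The third triple through `β`
    -- contains `p` too, so `codegree-one` keeps the degree of `p` below 4.
    quiet : ∀ {u v v′} → T v ≡ true → inc v u ≡ true → T v′ ≡ true → inc v′ u ≡ true → v ≢ v′ → d u ≡ 2 →
      hi v ≡ true → th v ≡ true → hi v′ ≡ false
    quiet {u} {v} {v′} t i t′ i′ ne du h h₃ with hi-e {v} h | th-e {v} h₃
    ... | y , iy′ , hy | β , iβ , dβ = ¬true⇒false (λ h′ → absurd (hi-e {v′} h′))
      where
      ≢-deg : ∀ {s t} → d s ≢ d t → s ≢ t
      ≢-deg q refl = q refl
      π : Petal v y u β
      π = petal-of hy (arrange t iy′ i iβ (≢-deg (λ e → <⇒≱ hy (≤-trans (≤-reflexive (trans e du)) (n≤1+n 2))))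
                          (≢-deg (λ e → <⇒≱ hy (≤-reflexive (trans e dβ)))) (≢-deg (λ e → 1+n≢n (≡sym (trans (≡sym du) (trans e dβ))))))
                   (≤-reflexive (≡sym du)) (≤-trans (n≤1+n 2) (≤-reflexive (≡sym dβ)))
      open Petal π
      v′≡v₁ : v′ ≡ v₁
      v′≡v₁ with v′ ≟ v₁
      ... | yes e = e
      ... | no q = ⊥-elim (<⇒≱ (≤-refl {3}) (subst (3 ≤_) du (length≤# (λ v → T v ∧ inc v u) (v ∷ v′ ∷ v₁ ∷ [])
                     (∧-i t i ∷ ∧-i t′ i′ ∷ ∧-i (inT cap) (iy cap) ∷ []) ((ne ∷ v≢v₁ ∷ []) ∷ (q ∷ []) ∷ [] ∷ []))))
      absurd : (∃ λ s → inc v′ s ≡ true × 4 ≤ d s) → ⊥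
      absurd (s , is , hs) with cov cap s (subst (λ x → inc x s ≡ true) v′≡v₁ is)
      ... | inj₁ refl = <⇒≱ hs (≤-trans (≤-reflexive du) (n≤1+n 2))
      ... | inj₂ (inj₁ refl) = <⇒≱ hs (≤-reflexive dβ)
      ... | inj₂ (inj₂ refl) with ext-β (≤-reflexive (≡sym dβ))
      ...   | v₂ , ne₂ , t₂ , iβ₂ , ip₂ = ne₂ (codegree-one hs t₂ (inT cap) ip₂ (ib cap) iβ₂ (ia cap) (a≢b cap))

    weighted : ∀ (f : Fin n → Bool) (g : Fin n → ℕ) c → (∀ v → f v ≡ true → g v ≤ c) → ∑ (λ v → ind (f v) * g v) ≤ # f * c
    weighted f g c h = ≤-trans (sum-mono step) (≤-reflexive (trans (sum-*ʳ c (ind ∘ f)) (cong (_* c) (≡sym (#-sum f)))))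
      where
      step : ∀ v → ind (f v) * g v ≤ ind (f v) * c
      step v with decide (f v)
      ... | inj₁ p = *-monoʳ-≤ (ind (f v)) (h v p)
      ... | inj₂ p rewrite p = z≤n

    received : ∀ u → ∑ (λ v → ind (T v ∧ inc v u) * pay v u) ≤ 6 * ind (Y u)
    received u with decide (Y u)
    ... | inj₂ p = ≤-trans (weighted (λ v → T v ∧ inc v u) (λ v → pay v u) 0 (λ v q → ⊥-elim (clash (inY (∧-l q) (∧-r {T v} q)) p))) (≤-trans (≤-reflexive (*-zeroʳ (d u))) z≤n)
    ... | inj₁ p rewrite p with 1 ≤? d u
    ...   | no q = ≤-trans (weighted (λ v → T v ∧ inc v u) (λ v → pay v u) 0 (λ v r → ⊥-elim (q (d≥1 (∧-l r) (∧-r {T v} r))))) (≤-trans (≤-reflexive (*-zeroʳ (d u))) z≤n)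
    ...   | yes q with degree (d u) q
    ...     | deg₁ e = ≤-trans (weighted (λ v → T v ∧ inc v u) (λ v → pay v u) 6 (λ v _ → ≤-reflexive (pay₁ v u e))) (≤-reflexive (cong (_* 6) e))
    ...     | deg₃ e = ≤-trans (weighted (λ v → T v ∧ inc v u) (λ v → pay v u) 2 (λ v _ → ≤-reflexive (pay₃ v u e))) (≤-reflexive (cong (_* 2) e))
    ...     | deg₄ r = ≤-trans (weighted (λ v → T v ∧ inc v u) (λ v → pay v u) 0 (λ v _ → ≤-reflexive (pay₄ v u r))) (≤-trans (≤-reflexive (*-zeroʳ (d u))) z≤n)
    ...     | deg₂ e = sum-two (λ v → T v ∧ inc v u) (λ v → pay v u) 6 e pair
      where
      table : ∀ a b a′ b′ → (a ≡ true → b ≡ true → a′ ≡ false) → (a′ ≡ true → b′ ≡ true → a ≡ false) → charge 2 a b + charge 2 a′ b′ ≤ 6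
      table true  true  true  b′    f g with f refl refl
      ... | ()
      table true  true  false b′    f g = ≤-refl
      table true  false true  true  f g with g refl refl
      ... | ()
      table true  false true  false f g = ≤-refl
      table true  false false b′    f g = n≤1+n 5
      table false b     true  true  f g = ≤-refl
      table false b     true  false f g = n≤1+n 5
      table false b     false b′    f g = m≤m+n 4 2
      pair : ∀ v v′ → T v ∧ inc v u ≡ true → T v′ ∧ inc v′ u ≡ true → v ≢ v′ → pay v u + pay v′ u ≤ 6
      pair v v′ s s′ ne rewrite pay₂ v u e | pay₂ v′ u e = table (hi v) (th v) (hi v′) (th v′)
        (quiet (∧-l s) (∧-r {T v} s) (∧-l s′) (∧-r {T v′} s′) ne e) (quiet (∧-l s′) (∧-r {T v′} s′) (∧-l s) (∧-r {T v} s) (ne ∘ ≡sym) e)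

    given : ∀ v → 6 * ind (T v) ≤ ∑ (λ u → ind (T v ∧ inc v u) * pay v u)
    given v with decide (T v)
    ... | inj₂ p rewrite p = z≤n
    ... | inj₁ p with #-three (inc v) (size p)
    ...   | three x y z ix iy′ iz xy xz yz c = begin
      6 * ind (T v)                        ≡⟨ cong (λ b → 6 * ind b) p ⟩
      6                                    ≤⟨ pay-triple (triple p ix iy′ iz xy xz yz c) ⟩
      pay v x + (pay v y + pay v z)        ≡⟨ cong₂ _+_ (one x ix) (cong₂ _+_ (one y iy′) (one z iz)) ⟩
      f x + (f y + f z)                    ≤⟨ three≤sum f xy xz yz ⟩
      ∑ f ∎
      where
      open ≤-Reasoning
      f : Fin n → ℕ
      f u = ind (T v ∧ inc v u) * pay v u
      one : ∀ u → inc v u ≡ true → pay v u ≡ f u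
      one u q rewrite p | q = ≡sym (+-identityʳ _)

    bounded : # T ≤ # Y
    bounded = *-cancelˡ-≤ 6 (begin
      6 * # T                                                   ≡⟨ cong (6 *_) (#-sum T) ⟩
      6 * ∑ (ind ∘ T)                                           ≡⟨ ≡sym (sum-* 6 (ind ∘ T)) ⟩
      ∑ (λ v → 6 * ind (T v))                                   ≤⟨ sum-mono given ⟩
      ∑ (λ v → ∑ (λ u → ind (T v ∧ inc v u) * pay v u))         ≡⟨ sum-swap (λ v u → ind (T v ∧ inc v u) * pay v u) ⟩
      ∑ (λ u → ∑ (λ v → ind (T v ∧ inc v u) * pay v u))         ≤⟨ sum-mono received ⟩
      ∑ (λ u → 6 * ind (Y u))                                   ≡⟨ sum-* 6 (ind ∘ Y) ⟩
      6 * ∑ (ind ∘ Y)                                           ≡⟨ cong (6 *_) (≡sym (#-sum Y)) ⟩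
      6 * # Y ∎)
      where open ≤-Reasoning

  #T≤#Y+64 : # T ≤ # Y + 64
  #T≤#Y+64 with 65 ≤? # T
  ... | yes large = ≤-trans (Large.bounded large) (m≤m+n _ _)
  ... | no q = ≤-trans (≤-pred (≰⇒> q)) (m≤n+m _ _)

-- Edge counts and the separation of degrees

#-anyB-sum : ∀ {m k} (κ : Fin k → Bool) (h : Fin m → Fin k → Bool) →
  # (λ w → anyB (λ u → κ u ∧ h w u)) ≤ ∑ (λ u → ind (κ u) * # (λ w → h w u))
#-anyB-sum {m} {k} κ h = begin
  # (λ w → anyB (λ u → κ u ∧ h w u))                  ≡⟨ #-sum _ ⟩
  ∑ (λ w → ind (anyB (λ u → κ u ∧ h w u)))            ≤⟨ sum-mono step ⟩
  ∑ (λ w → ∑ (λ u → ind (κ u) * ind (h w u)))         ≡⟨ sum-swap _ ⟩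
  ∑ (λ u → ∑ (λ w → ind (κ u) * ind (h w u)))         ≡⟨ sum-cong (λ u → trans (sum-* (ind (κ u)) _) (cong (ind (κ u) *_) (≡sym (#-sum _)))) ⟩
  ∑ (λ u → ind (κ u) * # (λ w → h w u)) ∎
  where
  open ≤-Reasoning
  step : ∀ w → ind (anyB (λ u → κ u ∧ h w u)) ≤ ∑ (λ u → ind (κ u) * ind (h w u))
  step w with decide (anyB (λ u → κ u ∧ h w u))
  ... | inj₂ p rewrite p = z≤n
  ... | inj₁ p with anyB-e {f = λ u → κ u ∧ h w u} p
  ...   | u , q = ≤-trans (≤-trans (ind-mono {anyB (λ u → κ u ∧ h w u)} {κ u ∧ h w u} (λ _ → q)) (≤-reflexive (ind-∧ (κ u) (h w u)))) (term≤sum (λ u → ind (κ u) * ind (h w u)) u)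

small-term : ∀ K (f : Fin (suc K) → ℕ) s → ∑ f ≤ s → ∃ λ i → suc K * f i ≤ s
small-term K f s le with any? (λ i → suc K * f i ≤? s)
... | yes p = p
... | no none = ⊥-elim (<⇒≱ (*-monoʳ-< (suc K) (≤-refl {suc s})) (begin
  suc K * suc s            ≡⟨ ≡sym (sum-const (suc K) (suc s)) ⟩
  ∑ {suc K} (λ _ → suc s)  ≤⟨ sum-mono (λ i → ≰⇒> (λ q → none (i , q))) ⟩
  ∑ (λ i → suc K * f i)    ≡⟨ sum-* (suc K) f ⟩
  suc K * ∑ f              ≤⟨ *-monoʳ-≤ (suc K) le ⟩
  suc K * s                ∎))
  where open ≤-Reasoning

module Degrees {n : ℕ} (G : Graph n) where
  open Cliques G

  deg : Fin n → ℕ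
  deg u = # (adj G u)

  -- Weights on ordered adjacent pairs. Weights of at most 1 add up to at most twice the number of
  -- edges, so disjointness of edge classes becomes a pointwise check.
  total : (Fin n → Fin n → ℕ) → ℕ
  total f = ∑ (λ u → ∑ (λ w → ind (adj G u w) * f u w))

  edges-sum : edges G ≡ ∑ (λ i → ∑ (λ j → ind (does (i <ᶠ? j) ∧ adj G i j)))
  edges-sum = trans (≡sym (∑-def _)) (sum-cong (λ i → trans (≡sym (#-def _)) (#-sum _)))

  handshake : edges G + edges G ≡ ∑ (λ u → ∑ (λ w → ind (adj G u w)))
  handshake = begin
    edges G + edges G                                            ≡⟨ cong₂ _+_ edges-sum (trans edges-sum (sum-swap _)) ⟩
    ∑ (λ i → ∑ (λ j → E i j)) + ∑ (λ i → ∑ (λ j → E j i))        ≡⟨ ≡sym (sum-+ _ _) ⟩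
    ∑ (λ i → ∑ (λ j → E i j) + ∑ (λ j → E j i))                  ≡⟨ sum-cong (λ i → ≡sym (sum-+ _ _)) ⟩
    ∑ (λ i → ∑ (λ j → E i j + E j i))                            ≡⟨ sum-cong (λ i → sum-cong (λ j → merge i j)) ⟩
    ∑ (λ u → ∑ (λ w → ind (adj G u w)))                          ∎
    where
    open ≡-Reasoning
    E : Fin n → Fin n → ℕ
    E i j = ind (does (i <ᶠ? j) ∧ adj G i j)
    kill : ∀ a {b} → b ≡ false → ind (a ∧ b) ≡ 0
    kill true refl = refl
    kill false refl = refl
    both : ∀ {a b c e} → a ≡ true → b ≡ true → c ≡ false → ind (a ∧ b) + ind (c ∧ e) ≡ 1
    both refl refl refl = refl
    merge : ∀ i j → E i j + E j i ≡ ind (adj G i j)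
    merge i j with decide (adj G i j)
    ... | inj₂ p = trans (cong₂ _+_ (kill (does (i <ᶠ? j)) p) (kill (does (j <ᶠ? i)) (trans (sym G j i) p))) (≡sym (cong ind p))
    ... | inj₁ p with <ᶠ-cmp i j
    ...   | tri< a _ c = trans (both (does-i (i <ᶠ? j) a) p (does-ni (j <ᶠ? i) c)) (≡sym (cong ind p))
    ...   | tri≈ _ e _ = ⊥-elim (~⇒≢ p e)
    ...   | tri> a _ c = trans (trans (+-comm (E i j) (E j i)) (both (does-i (j <ᶠ? i) c) (trans (sym G j i) p) (does-ni (i <ᶠ? j) a))) (≡sym (cong ind p))

  handshake-deg : edges G + edges G ≡ ∑ deg
  handshake-deg = trans handshake (sum-cong (λ u → ≡sym (#-sum _)))

  total-≤ : ∀ f → (∀ u w → u ~ w → f u w ≤ 1) → total f ≤ edges G + edges G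
  total-≤ f h = subst (total f ≤_) (≡sym handshake) (sum-mono (λ u → sum-mono (λ w → step u w)))
    where
    step : ∀ u w → ind (adj G u w) * f u w ≤ ind (adj G u w)
    step u w with decide (adj G u w)
    ... | inj₂ p rewrite p = z≤n
    ... | inj₁ p = subst (ind (adj G u w) * f u w ≤_) (*-identityʳ _) (*-monoʳ-≤ (ind (adj G u w)) (h u w p))

  total-+ : ∀ f g → total (λ u w → f u w + g u w) ≡ total f + total g
  total-+ f g = trans (sum-cong (λ u → trans (sum-cong (λ w → *-distribˡ-+ (ind (adj G u w)) _ _)) (sum-+ _ _))) (sum-+ _ _)

  total-sym : ∀ f → total (λ u w → f w u) ≡ total f
  total-sym f = trans (sum-swap _) (sum-cong (λ w → sum-cong (λ u → cong (λ b → ind b * f w u) (sym G u w))))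

  total-∧ : ∀ (A B : Fin n → Bool) → total (λ u w → ind (A u ∧ B w)) ≡ ∑ (λ u → ind (A u) * # (λ w → adj G u w ∧ B w))
  total-∧ A B = sum-cong (λ u → trans (sum-cong (λ w → step (adj G u w) (A u) (B w))) (trans (sum-* (ind (A u)) _) (cong (ind (A u) *_) (≡sym (#-sum _)))))
    where
    step : ∀ a b c → ind a * ind (b ∧ c) ≡ ind b * ind (a ∧ c)
    step true true c = refl
    step true false c = refl
    step false true c = refl
    step false false c = refl

  module Levels (ω Ω : ℕ) (1≤ω : 1 ≤ ω) (ω≤Ω : ω ≤ Ω) where

    C Mid Low Clear : Fin n → Bool
    C u = does (Ω ≤? deg u)
    Mid u = does (ω ≤? deg u) ∧ not (C u)
    Low u = not (does (ω ≤? deg u))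
    Clear v = Low v ∧ not (anyB (λ t → Mid t ∧ adj G v t))

    -- The degree sum of the middle range bounds both its size and the number of vertices next to
    -- it.
    mid : ℕ
    mid = ∑ (λ u → ind (Mid u) * deg u)

    Low⇒< : ∀ {u} → Low u ≡ true → deg u < ω
    Low⇒< {u} p = ≰⇒> (does-ne (ω ≤? deg u) (not-e p))

    Low⇒¬C : ∀ {u} → Low u ≡ true → C u ≡ false
    Low⇒¬C {u} p = ¬true⇒false (λ q → <⇒≱ (Low⇒< {u} p) (≤-trans ω≤Ω (does-e (Ω ≤? deg u) q)))

    Clear⇒¬C : ∀ {u} → Clear u ≡ true → C u ≡ false
    Clear⇒¬C {u} p = Low⇒¬C {u} (∧-l p)

    Clear-nbr : ∀ {v t} → Clear v ≡ true → v ~ t → C t ≡ false → deg t < ω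
    Clear-nbr {v} {t} p vt ct with decide (does (ω ≤? deg t))
    ... | inj₂ q = ≰⇒> (does-ne (ω ≤? deg t) q)
    ... | inj₁ q = ⊥-elim (clash (∧-i (∧-i q (not-i ct)) vt) (anyB-ne {f = λ t → Mid t ∧ adj G v t} (not-e (∧-r {Low v} p)) t))

    #C-bound : # C * Ω ≤ edges G + edges G
    #C-bound = begin
      # C * Ω                    ≡⟨ cong (_* Ω) (#-sum C) ⟩
      ∑ (ind ∘ C) * Ω            ≡⟨ ≡sym (sum-*ʳ Ω (ind ∘ C)) ⟩
      ∑ (λ u → ind (C u) * Ω)    ≤⟨ sum-mono step ⟩
      ∑ deg                      ≡⟨ ≡sym handshake-deg ⟩
      edges G + edges G          ∎
      where
      open ≤-Reasoning
      step : ∀ u → ind (C u) * Ω ≤ deg u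
      step u with decide (C u)
      ... | inj₂ p = ≤-trans (≤-reflexive (cong (λ b → ind b * Ω) p)) z≤n
      ... | inj₁ p = ≤-trans (≤-reflexive (trans (cong (λ b → ind b * Ω) p) (+-identityʳ Ω))) (does-e (Ω ≤? deg u) p)

    unclear : n ≤ # Clear + (# C + (mid + mid))
    unclear = begin
      n                                  ≡⟨ ≡sym (#-all n) ⟩
      # {n} (λ _ → true)                 ≤⟨ #-∨ {g = Clear} {h = λ u → C u ∨ (Mid u ∨ N u)} which ⟩
      # Clear + # (λ u → C u ∨ (Mid u ∨ N u)) ≤⟨ +-monoʳ-≤ (# Clear) (≤-trans (#-∨ {g = C} {h = λ u → Mid u ∨ N u} (λ u → ∨-e)) (+-monoʳ-≤ (# C) (≤-trans (#-∨ {g = Mid} {h = N} (λ u → ∨-e)) (+-mono-≤ #Mid #N)))) ⟩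
      # Clear + (# C + (mid + mid))      ∎
      where
      open ≤-Reasoning
      N : Fin n → Bool
      N v = anyB (λ t → Mid t ∧ adj G v t)
      which : ∀ u → true ≡ true → Clear u ≡ true ⊎ C u ∨ (Mid u ∨ N u) ≡ true
      which u _ with decide (does (ω ≤? deg u)) | decide (C u) | decide (N u)
      ... | _ | inj₁ c | _ = inj₂ (∨-l c)
      ... | inj₁ p | inj₂ c | _ = inj₂ (∨-r {C u} (∨-l (∧-i p (not-i c))))
      ... | inj₂ p | inj₂ c | inj₁ q = inj₂ (∨-r {C u} (∨-r {Mid u} q))
      ... | inj₂ p | inj₂ c | inj₂ q = inj₁ (∧-i (not-i p) (not-i q))
      #Mid : # Mid ≤ mid
      #Mid = ≤-trans (≤-reflexive (#-sum Mid)) (sum-mono step)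
        where
        step : ∀ u → ind (Mid u) ≤ ind (Mid u) * deg u
        step u with decide (Mid u)
        ... | inj₂ p = ≤-trans (≤-reflexive (cong ind p)) z≤n
        ... | inj₁ p = ≤-trans (≤-reflexive (≡sym (*-identityʳ _))) (*-monoʳ-≤ (ind (Mid u)) (≤-trans 1≤ω (does-e (ω ≤? deg u) (∧-l p))))
      #N : # N ≤ mid
      #N = ≤-trans (#-anyB-sum Mid (λ v t → adj G v t)) (≤-reflexive (sum-cong (λ t → cong (ind (Mid t) *_) (#-cong (λ v → sym G v t)))))

  module Scales (ω : ℕ → ℕ) (inc : ∀ i → ω i ≤ ω (suc i)) (pos : ∀ i → 1 ≤ ω i) where

    mono : ∀ {i j} → i ≤ j → ω i ≤ ω j
    mono {i} {zero} z≤n = ≤-refl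
    mono {i} {suc j} p with m≤n⇒m<n∨m≡n p
    ... | inj₁ q = ≤-trans (mono (≤-pred q)) (inc j)
    ... | inj₂ refl = ≤-refl

    midAt : ℕ → ℕ
    midAt i = Levels.mid (ω i) (ω (suc i)) (pos i) (inc i)

    -- The `suc K` middle ranges are disjoint, so their degree sums together are at most the total
    -- degree; take one that is at most the average.
    sparse-range : ∀ K → ∃ λ (i : Fin (suc K)) → suc K * midAt (toℕ i) ≤ edges G + edges G
    sparse-range K = small-term K (λ i → midAt (toℕ i)) (edges G + edges G) (begin
      ∑ (λ (i : Fin (suc K)) → midAt (toℕ i))             ≡⟨ sum-swap (λ (i : Fin (suc K)) u → ind (In i u) * deg u) ⟩
      ∑ (λ u → ∑ (λ (i : Fin (suc K)) → ind (In i u) * deg u)) ≡⟨ sum-cong (λ u → trans (sum-*ʳ (deg u) _) (cong (_* deg u) (≡sym (#-sum _)))) ⟩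
      ∑ (λ u → # (λ (i : Fin (suc K)) → In i u) * deg u)  ≤⟨ sum-mono (λ u → ≤-trans (*-monoˡ-≤ (deg u) (#≤1 (one u))) (≤-reflexive (+-identityʳ _))) ⟩
      ∑ deg                                               ≡⟨ ≡sym handshake-deg ⟩
      edges G + edges G                                   ∎)
      where
      open ≤-Reasoning
      In : Fin (suc K) → Fin n → Bool
      In i u = Levels.Mid (ω (toℕ i)) (ω (suc (toℕ i))) (pos (toℕ i)) (inc (toℕ i)) u
      lo : ∀ i u → In i u ≡ true → ω (toℕ i) ≤ deg u
      lo i u p = does-e (ω (toℕ i) ≤? deg u) (∧-l p)
      hi : ∀ i u → In i u ≡ true → deg u < ω (suc (toℕ i))
      hi i u p = ≰⇒> (does-ne (ω (suc (toℕ i)) ≤? deg u) (not-e (∧-r {does (ω (toℕ i) ≤? deg u)} p)))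
      clashing : ∀ u i j → In i u ≡ true → In j u ≡ true → toℕ i < toℕ j → ⊥
      clashing u i j p q r = <⇒≱ (hi i u p) (≤-trans (mono r) (lo j u q))
      one : ∀ u i j → In i u ≡ true → In j u ≡ true → i ≡ j
      one u i j p q with <-cmp (toℕ i) (toℕ j)
      ... | tri< a _ _ = ⊥-elim (clashing u i j p q a)
      ... | tri≈ _ e _ = toℕ-injective e
      ... | tri> _ _ c = ⊥-elim (clashing u j i q p c)

halve : ∀ {a b} → a + a ≤ b + b → a ≤ b
halve {a} {b} p = ≮⇒≥ (λ q → <⇒≱ (+-mono-< q q) p)

-- Bounds `exc` of a clear vertex: itself, at most ω neighbours, and at most ω vertices through each
-- neighbour outside the core. Such a neighbour is low because clear vertices have no neighbour in
-- the middle range.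
excBound : ℕ → ℕ
excBound ω = 1 + (ω + ω * ω)

-- Choice of the degree cutoffs

module Scale (c′ κ : ℕ) (Fb : ℕ → ℕ) where
  c : ℕ
  c = suc c′

  -- The gap is such that `# C * ω (suc i) ≤ 2 * c * n` makes even `suc (Fb (ω i))` times the core
  -- at most n / (4κ).
  ω : ℕ → ℕ
  ω zero    = 1
  ω (suc i) = ω i + suc (Fb (ω i)) * κ * (8 * c)

  inc : ∀ i → ω i ≤ ω (suc i)
  inc i = m≤m+n _ _

  pos : ∀ i → 1 ≤ ω i
  pos zero    = ≤-refl
  pos (suc i) = ≤-trans (pos i) (inc i)

  levels : ℕ
  levels = κ * (16 * c)

  threshold : ℕ
  threshold = ∑ (λ (i : Fin (suc levels)) → 4 * κ * Fb (ω (toℕ i)))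

  loss : ∀ {n} → Graph n → ℕ → ℕ
  loss G i = # C + (mid + mid) + Fb (ω i) * suc (# C)
    where open Degrees.Levels G (ω i) (ω (suc i)) (pos i) (inc i)

  -- The loss has a part proportional to the core, a part from the middle range and a constant part.
  -- The gap, the number of levels and the threshold make each at most n / (4κ).
  scale : ∀ {n} (G : Graph n) → threshold ≤ n → edges G ≤ c * n → ∃ λ i → κ * loss G i ≤ n
  scale {n} G N≤n few with Degrees.Scales.sparse-range G ω inc pos levels
  ... | i , small = toℕ i , quarter
    where
    open Degrees.Levels G (ω (toℕ i)) (ω (suc (toℕ i))) (pos (toℕ i)) (inc (toℕ i))
    F = Fb (ω (toℕ i))
    2e≤ : edges G + edges G ≤ 2 * c * n
    2e≤ = ≤-trans (+-mono-≤ few few) (≤-reflexive (eq c n))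
      where
      eq : ∀ c n → c * n + c * n ≡ 2 * c * n
      eq = solve-∀
    q₁ : 4 * (κ * (suc F * # C)) ≤ n
    q₁ = *-cancelˡ-≤ (2 * c) (begin
      2 * c * (4 * (κ * (suc F * # C)))      ≡⟨ eq c κ (suc F) (# C) ⟩
      # C * (suc F * κ * (8 * c))            ≤⟨ *-monoʳ-≤ (# C) (m≤n+m _ (ω (toℕ i))) ⟩
      # C * ω (suc (toℕ i))                  ≤⟨ #C-bound ⟩
      edges G + edges G                      ≤⟨ 2e≤ ⟩
      2 * c * n                              ∎)
      where
      open ≤-Reasoning
      eq : ∀ c κ f x → 2 * c * (4 * (κ * (f * x))) ≡ x * (f * κ * (8 * c))
      eq = solve-∀
    q₂ : 4 * (κ * (mid + mid)) ≤ n
    q₂ = *-cancelˡ-≤ (2 * c) (begin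
      2 * c * (4 * (κ * (mid + mid)))        ≡⟨ eq c κ mid ⟩
      levels * mid                           ≤⟨ *-monoˡ-≤ mid (n≤1+n levels) ⟩
      suc levels * mid                       ≤⟨ small ⟩
      edges G + edges G                      ≤⟨ 2e≤ ⟩
      2 * c * n                              ∎)
      where
      open ≤-Reasoning
      eq : ∀ c κ x → 2 * c * (4 * (κ * (x + x))) ≡ κ * (16 * c) * x
      eq = solve-∀
    q₃ : 4 * (κ * F) ≤ n
    q₃ = ≤-trans (≤-reflexive (≡sym (*-assoc 4 κ F))) (≤-trans (term≤sum (λ (i : Fin (suc levels)) → 4 * κ * Fb (ω (toℕ i))) i) N≤n)
    quarter : κ * (# C + (mid + mid) + F * suc (# C)) ≤ n
    quarter = *-cancelˡ-≤ 4 (begin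
      4 * (κ * (# C + (mid + mid) + F * suc (# C)))                              ≡⟨ eq κ (# C) mid F ⟩
      4 * (κ * (suc F * # C)) + 4 * (κ * (mid + mid)) + 4 * (κ * F)              ≤⟨ +-mono-≤ (+-mono-≤ q₁ q₂) q₃ ⟩
      n + n + n                                                                  ≤⟨ m≤m+n (n + n + n) n ⟩
      n + n + n + n                                                              ≡⟨ eq′ n ⟩
      4 * n                                                                      ∎)
      where
      open ≤-Reasoning
      eq : ∀ κ x m f → 4 * (κ * (x + (m + m) + f * suc x)) ≡ 4 * (κ * (suc f * x)) + 4 * (κ * (m + m)) + 4 * (κ * f)
      eq = solve-∀
      eq′ : ∀ n → n + n + n + n ≡ 4 * n
      eq′ = solve-∀

-- The lower bound (r + 2)n

module Setup {n : ℕ} (G : Graph n) (ρ : ℕ) (sat : KSaturated (3 + ρ) G) (tf : TwinFree G)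
             (ω Ω : ℕ) (1≤ω : 1 ≤ ω) (ω≤Ω : ω ≤ Ω) where
  open Cliques G
  open Degrees G
  open Levels ω Ω 1≤ω ω≤Ω
  K : ℕ
  K = excBound ω
  open Traces G ρ sat tf C K
  open Sparse G ρ sat tf C K

  exc-bound : ∀ {v} → Clear v ≡ true → # (exc v) ≤ K
  exc-bound {v} cl = begin
    # (exc v)                                     ≤⟨ #-∨ {g = λ u → does (u ≟ v)} {h = λ u → adj G v u ∨ far u} (λ u p → ∨-e (trans (≡sym (exc-def v u)) p)) ⟩
    # (λ u → does (u ≟ v)) + # (λ u → adj G v u ∨ far u) ≤⟨ +-mono-≤ (#≤1 (λ i j p q → trans (does-e (i ≟ v) p) (≡sym (does-e (j ≟ v) q)))) (#-∨ {g = adj G v} {h = far} (λ u → ∨-e)) ⟩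
    1 + (deg v + # far)                           ≤⟨ +-monoʳ-≤ 1 (+-mono-≤ low (≤-trans #far (*-monoˡ-≤ ω low))) ⟩
    1 + (ω + ω * ω)                               ∎
    where
    open ≤-Reasoning
    far : Fin n → Bool
    far u = anyB (λ t → (adj G v t ∧ not (C t)) ∧ adj G t u)
    low : deg v ≤ ω
    low = <⇒≤ (Low⇒< {v} (∧-l cl))
    #far : # far ≤ deg v * ω
    #far = ≤-trans (#-anyB-sum (λ t → adj G v t ∧ not (C t)) (λ u t → adj G t u))
             (≤-trans (sum-mono step) (≤-reflexive (trans (sum-*ʳ ω (ind ∘ adj G v)) (cong (_* ω) (≡sym (#-sum (adj G v)))))))
      where
      step : ∀ t → ind (adj G v t ∧ not (C t)) * deg t ≤ ind (adj G v t) * ω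
      step t with decide (adj G v t ∧ not (C t))
      ... | inj₂ p rewrite p = z≤n
      ... | inj₁ p = *-mono-≤ (ind-mono {adj G v t ∧ not (C t)} {adj G v t} ∧-l) (<⇒≤ (Clear-nbr cl (∧-l p) (not-e (∧-r {adj G v t} p))))

  crossing : ℕ
  crossing = ∑ (λ u → ind (Clear u) * # (S u))

  -- As `Clear` and `C` are disjoint, the two orders of a pair together carry weight at most 1.
  crossing≤edges : crossing ≤ edges G
  crossing≤edges = halve (subst (_≤ edges G + edges G) (trans (total-+ f (λ u w → f w u)) (cong₂ _+_ (total-∧ Clear C) (trans (total-sym f) (total-∧ Clear C))))
      (total-≤ (λ u w → f u w + f w u) (λ u w _ → one u w)))
    where
    f : Fin n → Fin n → ℕ
    f u w = ind (Clear u ∧ C w)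
    one : ∀ u w → f u w + f w u ≤ 1
    ≤1 : ∀ b → ind b ≤ 1
    ≤1 true  = ≤-refl
    ≤1 false = z≤n
    one u w with decide (Clear u) | decide (Clear w)
    ... | inj₂ p | _ rewrite p = ≤1 (Clear w ∧ C u)
    ... | inj₁ p | inj₂ q rewrite p | q = ≤-trans (≤-reflexive (+-identityʳ _)) (≤1 (C w))
    ... | inj₁ p | inj₁ q rewrite p | q | Clear⇒¬C {u} p | Clear⇒¬C {w} q = z≤n

  few-light : # (λ v → Clear v ∧ does (# (S v) ≤? 4 + ρ)) ≤ few-bound ρ K * suc (# C)
  few-light = few (λ v p → exc-bound {v} (∧-l p)) (λ v p → does-e (# (S v) ≤? 4 + ρ) (∧-r {Clear v} p))

  -- All but few clear vertices send at least r + 2 edges to the core, and no edge is counted twice.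
  lower₁ : (5 + ρ) * n ≤ edges G + (5 + ρ) * (# C + (mid + mid) + few-bound ρ K * suc (# C))
  lower₁ = begin
    c * n                                                     ≤⟨ *-monoʳ-≤ c unclear ⟩
    c * (# Clear + (# C + (mid + mid)))                       ≡⟨ cong (λ x → c * (x + (# C + (mid + mid)))) (#-split Clear light) ⟩
    c * (# Bl + # Bh + (# C + (mid + mid)))                   ≤⟨ *-monoʳ-≤ c (+-monoˡ-≤ (# C + (mid + mid)) (+-monoˡ-≤ (# Bh) few-light)) ⟩
    c * (F + # Bh + (# C + (mid + mid)))                      ≡⟨ eq c F (# Bh) (# C + (mid + mid)) ⟩
    c * # Bh + c * (# C + (mid + mid) + F)                    ≤⟨ +-monoˡ-≤ _ (≤-trans heavy crossing≤edges) ⟩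
    edges G + c * (# C + (mid + mid) + F)                     ∎
    where
    open ≤-Reasoning
    c = 5 + ρ
    F = few-bound ρ K * suc (# C)
    light Bl Bh : Fin n → Bool
    light v = does (# (S v) ≤? 4 + ρ)
    Bl v = Clear v ∧ light v
    Bh v = Clear v ∧ not (light v)
    eq : ∀ c f b x → c * (f + b + x) ≡ c * b + c * (x + f)
    eq = solve-∀
    heavy : c * # Bh ≤ crossing
    heavy = begin
      c * # Bh                     ≡⟨ cong (c *_) (#-sum Bh) ⟩
      c * ∑ (ind ∘ Bh)             ≡⟨ ≡sym (sum-* c (ind ∘ Bh)) ⟩
      ∑ (λ v → c * ind (Bh v))     ≤⟨ sum-mono step ⟩
      crossing                     ∎
      where
      step : ∀ v → c * ind (Bh v) ≤ ind (Clear v) * # (S v)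
      step v with decide (Bh v)
      ... | inj₂ p = ≤-trans (≤-reflexive (trans (cong (λ b → c * ind b) p) (*-zeroʳ c))) z≤n
      ... | inj₁ p = ≤-trans (≤-reflexive (trans (cong (λ b → c * ind b) p) (*-identityʳ c)))
              (≤-trans (≰⇒> (does-ne (# (S v) ≤? 4 + ρ) (not-e (∧-r {Clear v} p)))) (≤-reflexive (≡sym (trans (cong (λ b → ind b * # (S v)) (∧-l {Clear v} p)) (+-identityʳ _)))))

conclude₁ : ∀ c s n e x → c * n ≤ e + c * x → s * c * x ≤ n → c * s * n ≤ s * e + n
conclude₁ c s n e x p q = begin
  c * s * n              ≡⟨ rearrange c s n ⟩
  s * (c * n)            ≤⟨ *-monoʳ-≤ s p ⟩
  s * (e + c * x)        ≡⟨ distrib s c e x ⟩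
  s * e + s * c * x      ≤⟨ +-monoʳ-≤ (s * e) q ⟩
  s * e + n              ∎
  where
  open ≤-Reasoning
  rearrange : ∀ c s n → c * s * n ≡ s * (c * n)
  rearrange = solve-∀
  distrib : ∀ s c e x → s * (e + c * x) ≡ s * e + s * c * x
  distrib = solve-∀

module LowerBound (ρ k : ℕ) where
  Fb : ℕ → ℕ
  Fb ω = few-bound ρ (excBound ω)

  module Sc = Scale (4 + ρ) (suc k * (5 + ρ)) Fb

  dense : ∀ n e → (5 + ρ) * n ≤ e → (5 + ρ) * suc k * n ≤ suc k * e + n
  dense n e p = conclude₁ (5 + ρ) (suc k) n e 0 (≤-trans p (m≤m+n e _)) (≤-trans (≤-reflexive (*-zeroʳ (suc k * (5 + ρ)))) z≤n)

  sparse : ∀ {n} (G : Graph n) → TwinFree G → KSaturated (3 + ρ) G →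
    (∃ λ i → suc k * (5 + ρ) * Sc.loss G i ≤ n) →
    (5 + ρ) * suc k * n ≤ suc k * edges G + n
  sparse {n} G tf sat (i , small) = conclude₁ (5 + ρ) (suc k) n (edges G) (Sc.loss G i)
    (Setup.lower₁ G ρ sat tf (Sc.ω i) (Sc.ω (suc i)) (Sc.pos i) (Sc.inc i)) small

  -- With (r + 2)n edges or more the bound is immediate. Otherwise the number of edges is linear in
  -- n, which the choice of cutoffs requires.
  bound : ∀ n → Sc.threshold ≤ n → (G : Graph n) → TwinFree G → KSaturated (3 + ρ) G →
    (5 + ρ) * suc k * n ≤ suc k * edges G + n
  bound n N≤n G tf sat = [ dense n (edges G) , (λ few → sparse G tf sat (Sc.scale G N≤n few)) ]′ (≤-total ((5 + ρ) * n) (edges G))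

-- The case r = 3: hubs and four-element sets

opaque
  -- Costs of homogenizing over a trace of five elements, and in `family₃` over a base of two.
  p₅ p₁₅ : ℕ
  p₅ = 2 ^ 5
  p₁₅ = 2 ^ (3 * 2 + 9)

  p₅-def : p₅ ≡ 2 ^ 5
  p₅-def = refl

  p₁₅-def : p₁₅ ≡ 2 ^ (3 * 2 + 9)
  p₁₅-def = refl

hub-bound : ℕ → ℕ
hub-bound K = K + p₅ * (K + p₅ * (p₁₅ * (core-bound 0 K * 3)))

hub-widen : ∀ K c → K + p₅ * (K + p₅ * (p₁₅ * (core-bound 0 K * (3 * c)))) ≤ hub-bound K * suc c
hub-widen K c = widen K p₅ p₁₅ (core-bound 0 K) c
  where
  widen : ∀ a p t u c → a + p * (a + p * (t * (u * (3 * c)))) ≤ (a + p * (a + p * (t * (u * 3)))) * suc c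
  widen a p t u c = subst (a + p * (a + p * (t * (u * (3 * c)))) ≤_) (≡sym (eq a p t u c)) (m≤m+n _ _)
    where
    eq : ∀ a p t u c → (a + p * (a + p * (t * (u * 3)))) * suc c ≡ a + p * (a + p * (t * (u * (3 * c)))) + (p * (p * (t * (u * 3))) + (a + p * a) * c)
    eq = solve-∀

amgm-≤ : ∀ {a b} → a ≤ b → 2 * (a * b) ≤ a * a + b * b
amgm-≤ {a} {b} p with m≤n⇒∃[o]m+o≡n p
... | c , refl = subst (2 * (a * (a + c)) ≤_) (≡sym (eq a c)) (m≤m+n _ (c * c))
  where
  eq : ∀ a c → a * a + (a + c) * (a + c) ≡ 2 * (a * (a + c)) + c * c
  eq = solve-∀

amgm : ∀ a b → 2 * (a * b) ≤ a * a + b * b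
amgm a b with ≤-total a b
... | inj₁ p = amgm-≤ p
... | inj₂ p = subst₂ _≤_ (cong (2 *_) (*-comm b a)) (+-comm (b * b) (a * a)) (amgm-≤ p)

-- With t = m - d this is t (15 d - t) <= 9 d (d + t), i.e. (3 d - t)^2 >= 0; the slack 64 contributes at most 1024 d.
degree-trade : ∀ g d m → d ≤ m → g + d ≤ m + 64 → 16 * (g * d) ≤ g * m + (9 * m + 1024) * d
degree-trade g d m d≤m h with ≤-total (16 * d) m
... | inj₁ p = ≤-trans (≤-reflexive (eq g d)) (≤-trans (*-monoʳ-≤ g p) (m≤m+n _ _))
  where
  eq : ∀ g d → 16 * (g * d) ≡ g * (16 * d)
  eq = solve-∀
... | inj₂ p with m≤n⇒∃[o]m+o≡n p | m≤n⇒∃[o]m+o≡n d≤m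
...   | s , ms | t , refl = begin
  16 * (g * d)                              ≡⟨ e₁ g d ⟩
  g * (16 * d)                              ≡⟨ cong (g *_) (≡sym ms) ⟩
  g * (d + t + s)                           ≡⟨ *-distribˡ-+ g (d + t) s ⟩
  g * (d + t) + g * s                       ≤⟨ +-monoʳ-≤ (g * (d + t)) (*-monoˡ-≤ s g≤) ⟩
  g * (d + t) + (t + 64) * s                ≡⟨ cong (g * (d + t) +_) (*-distribʳ-+ s t 64) ⟩
  g * (d + t) + (t * s + 64 * s)            ≤⟨ +-monoʳ-≤ (g * (d + t)) (+-mono-≤ ts (≤-trans (*-monoʳ-≤ 64 s≤) (≤-reflexive (e₂ d)))) ⟩
  g * (d + t) + (9 * (d + t) * d + 1024 * d) ≡⟨ cong (g * (d + t) +_) (≡sym (*-distribʳ-+ d (9 * (d + t)) 1024)) ⟩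
  g * (d + t) + (9 * (d + t) + 1024) * d    ∎
  where
  open ≤-Reasoning
  e₁ : ∀ g d → 16 * (g * d) ≡ g * (16 * d)
  e₁ = solve-∀
  e₂ : ∀ d → 64 * (16 * d) ≡ 1024 * d
  e₂ = solve-∀
  e₃ : ∀ d t → d + t + 64 ≡ t + 64 + d
  e₃ = solve-∀
  g≤ : g ≤ t + 64
  g≤ = +-cancelʳ-≤ d g (t + 64) (≤-trans h (≤-reflexive (e₃ d t)))
  s≤ : s ≤ 16 * d
  s≤ = ≤-trans (m≤n+m s (d + t)) (≤-reflexive ms)
  t+s : t + s ≡ 15 * d
  t+s = +-cancelˡ-≡ d _ _ (trans (≡sym (+-assoc d t s)) (trans ms (e₄ d)))
    where
    e₄ : ∀ d → 16 * d ≡ d + 15 * d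
    e₄ = solve-∀
  ts : t * s ≤ 9 * (d + t) * d
  ts = +-cancelˡ-≤ (t * t) _ _ (begin
    t * t + t * s                        ≡⟨ ≡sym (*-distribˡ-+ t t s) ⟩
    t * (t + s)                          ≡⟨ cong (t *_) t+s ⟩
    t * (15 * d)                         ≡⟨ e₅ t d ⟩
    2 * ((3 * d) * t) + 9 * (t * d)      ≤⟨ +-monoˡ-≤ (9 * (t * d)) (amgm (3 * d) t) ⟩
    3 * d * (3 * d) + t * t + 9 * (t * d) ≡⟨ e₆ t d ⟩
    t * t + 9 * (d + t) * d              ∎)
    where
    e₅ : ∀ t d → t * (15 * d) ≡ 2 * ((3 * d) * t) + 9 * (t * d)
    e₅ = solve-∀
    e₆ : ∀ t d → 3 * d * (3 * d) + t * t + 9 * (t * d) ≡ t * t + 9 * (d + t) * d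
    e₆ = solve-∀

module Setup₃ {n : ℕ} (G : Graph n) (sat : KSaturated 3 G) (tf : TwinFree G)
             (ω Ω : ℕ) (1≤ω : 1 ≤ ω) (ω≤Ω : ω ≤ Ω) where
  open Cliques G
  open Degrees G
  open Levels ω Ω 1≤ω ω≤Ω
  open Setup G 0 sat tf ω Ω 1≤ω ω≤Ω
  open Traces G 0 sat tf C K
  open Sparse G 0 sat tf C K

  tri : ∀ {u v w} → u ~ v → u ~ w → v ~ w → ⊥
  tri uv uw vw = ban3 uv uw vw (clique (λ ()) (λ ()) (λ ()))

  common-neighbour : ∀ {u v} → u ≢ v → adj G u v ≡ false → ∃ λ t → u ~ t × v ~ t
  common-neighbour p q = let c = common p q in vertex c zero , member c zero

  B₅ : Fin n → Bool
  B₅ v = Clear v ∧ does (# (S v) ≟ℕ 5)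

  B₅-size : ∀ {v} → B₅ v ≡ true → # (S v) ≡ 5
  B₅-size {v} p = does-e (# (S v) ≟ℕ 5) (∧-r {Clear v} p)

  Shared : (Fin n → Bool) → Fin n → Set
  Shared B v₀ = Σ (Fin n → Bool) λ B′ → (∀ v → B′ v ≡ true → B v ≡ true) × # B ≤ K + p₅ * # B′ ×
    (∀ w → B′ w ≡ true → ∃ λ h → S v₀ h ≡ true × (∀ v → B′ v ≡ true → v ~ h))

  -- Outside `exc v₀` each member sees one of the five elements of the trace of `v₀`; homogenizing
  -- over these makes it common to all. The conclusion is stated per member to cover an empty `B′`.
  shared : ∀ B v₀ → B₅ v₀ ≡ true → Shared B v₀
  shared B v₀ b₀ = go (homogenize tests B₁)
    where
    B₁ : Fin n → Bool
    B₁ w = B w ∧ not (exc v₀ w)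
    tests : List (Fin n → Bool)
    tests = map (λ s w → adj G w s) (elems (S v₀))
    len : length tests ≡ 5
    len = trans (length-map _ (elems (S v₀))) (trans (length-elems (S v₀)) (B₅-size {v₀} b₀))
    go : Homogeneous tests B₁ → Shared B v₀
    go (B′ , sub , le , hom) = B′ , (λ v p → ∧-l (sub v p)) ,
        ≤-trans (≤-reflexive (#-split B (exc v₀))) (+-mono-≤ (≤-trans (#-mono (λ w → ∧-r {B w})) (exc-bound {v₀} (∧-l b₀)))
          (subst (λ l → # B₁ ≤ l * # B′) (trans (cong (2 ^_) len) (≡sym p₅-def)) le)) ,
        (λ w b → let c = dominated (not-e (∧-r {B w} (sub w b)))
                     s , wt = member c zero
                 in vertex c zero , s , (λ v b′ → trans (All.lookup (AllP.map⁻ hom) (elems-∈ _ s) v w b′ b) wt))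

  empty-or : ∀ (B : Fin n → Bool) → # B ≡ 0 ⊎ (∃ λ v → B v ≡ true)
  empty-or B with any? (λ v → B v ≟ᵇ true)
  ... | yes p = inj₂ p
  ... | no p = inj₁ (#-none (λ v → ¬true⇒false (λ q → p (v , q))))

  T₃ : ℕ
  T₃ = p₁₅ * (core-bound 0 K * (3 * # C))

  -- Two common elements form a base over which the five-element traces have remainders of size
  -- three.
  two-hubs : ∀ {B h h′} → (∀ v → B v ≡ true → B₅ v ≡ true) → C h ≡ true → C h′ ≡ true → h ≢ h′ →
    (∀ v → B v ≡ true → v ~ h) → (∀ v → B v ≡ true → v ~ h′) → # B ≤ T₃
  two-hubs {B} {h} {h′} sub ch ch′ ne bh bh′ = subst (λ x → # B ≤ x * (core-bound 0 K * (3 * # C))) (≡sym p₁₅-def) (family₃ 2 (λ _ _ _ → clique (λ ()) (λ ()) (λ ())) (#-image q) fam)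
    where
    q : Fin 2 → Fin n
    q zero    = h
    q (suc _) = h′
    in-S : ∀ v → B v ≡ true → ∀ i → S v (q i) ≡ true
    in-S v b zero    = ∧-i (bh v b) ch
    in-S v b (suc _) = ∧-i (bh′ v b) ch′
    base-q : ∀ v → B v ≡ true → ∀ u → image q u ≡ true → S v u ≡ true
    base-q v b u p = let i , e = image-e {q = q} p in subst (λ x → S v x ≡ true) (≡sym e) (in-S v b i)
    distinct : ∀ i j → i ≢ j → q i ≢ q j
    distinct zero zero r = ⊥-elim (r refl)
    distinct zero (suc j) r = ne
    distinct (suc i) zero r = ne ∘ ≡sym
    distinct (suc zero) (suc zero) r = ⊥-elim (r refl)
    #q : # (image q) ≡ 2
    #q = ≤-antisym (#-image q) (#-image≥ q distinct)
    fam : Family (image q) 3 B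
    fam = record
      { good = λ v b → exc-bound {v} (∧-l (sub v b))
      ; base = base-q
      ; size = λ v b → +-cancelˡ-≡ 2 _ _ (trans (cong (_+ # (R (image q) v)) (≡sym #q)) (trans (≡sym (#-S v (base-q v b))) (B₅-size {v} (sub v b)))) }

  Hub : Set
  Hub = (# B₅ ≤ hub-bound K * suc (# C)) ⊎ (∃ λ h → C h ≡ true × (∀ v → B₅ v ≡ true → v ~ h))

  -- Up to `K` members, a fixed proportion of `B₅` shares an element `h`. If some `v′` in `B₅`
  -- misses `h`, then a fixed proportion of that part also shares an element of the trace of `v′`;
  -- it differs from `h`, so `two-hubs` bounds everything.
  hub : Hub
  hub = [ (λ e → inj₁ (≤-trans (≤-reflexive e) z≤n)) , (λ { (v₀ , b₀) → stage₁ v₀ (shared B₅ v₀ b₀) }) ]′ (empty-or B₅)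
    where
    conclude : # B₅ ≤ K + p₅ * (K + p₅ * T₃) → Hub
    conclude p = inj₁ (≤-trans p (hub-widen K (# C)))
    stage₂ : ∀ v₀ → (r : Shared B₅ v₀) → (∃ λ h → S v₀ h ≡ true × (∀ v → proj₁ r v ≡ true → v ~ h)) → Hub
    stage₂ v₀ (B′ , sub , le , _) (h , s , bh) = [ found , (λ none → inj₂ (h , ch , all none)) ]′ (search (any? (λ v → (B₅ v ≟ᵇ true) ×-dec (adj G v h ≟ᵇ false))))
      where
      ch : C h ≡ true
      ch = ∧-r {adj G v₀ h} s
      Missing : Fin n → Set
      Missing v = B₅ v ≡ true × adj G v h ≡ false
      search : Dec (∃ Missing) → (∃ Missing) ⊎ ¬ (∃ Missing)
      search (yes p) = inj₁ p
      search (no p) = inj₂ p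
      all : ¬ (∃ Missing) → ∀ v → B₅ v ≡ true → v ~ h
      all none v b = [ id , (λ q → ⊥-elim (none (v , b , q))) ]′ (decide (adj G v h))
      small : ∀ v′ → B₅ v′ ≡ true → adj G v′ h ≡ false → Shared B′ v′ → # B′ ≤ K + p₅ * T₃
      small v′ b′ na (B″ , sub″ , le″ , nbr) = ≤-trans le″ (+-monoʳ-≤ K (*-monoʳ-≤ p₅ ([ (λ e → ≤-trans (≤-reflexive e) z≤n) , (λ { (w , bw) → use (nbr w bw) }) ]′ (empty-or B″))))
        where
        use : (∃ λ h′ → S v′ h′ ≡ true × (∀ v → B″ v ≡ true → v ~ h′)) → # B″ ≤ T₃
        use (h′ , s′ , bh′) = two-hubs (λ v p → sub v (sub″ v p)) ch (∧-r {adj G v′ h′} s′) (λ { refl → clash (∧-l {adj G v′ h} s′) na }) (λ v p → bh v (sub″ v p)) bh′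
      found : ∃ Missing → Hub
      found (v′ , b′ , na) = conclude (≤-trans le (+-monoʳ-≤ K (*-monoʳ-≤ p₅ (small v′ b′ na (shared B′ v′ b′)))))
    stage₁ : ∀ v₀ → Shared B₅ v₀ → Hub
    stage₁ v₀ r@(B′ , sub , le , nbr) = [ (λ e → conclude (≤-trans le (+-monoʳ-≤ K (*-monoʳ-≤ p₅ (≤-trans (≤-reflexive e) z≤n)))))
                                        , (λ { (w , bw) → stage₂ v₀ r (nbr w bw) }) ]′ (empty-or B′)

  G₆ : Fin n → Bool
  G₆ v = Clear v ∧ does (6 ≤? # (S v))

  light : Fin n → Bool
  light v = Clear v ∧ does (# (S v) ≤? 4)

  by-size : # Clear ≤ # light + (# B₅ + # G₆)
  by-size = ≤-trans (#-∨ {g = light} {h = λ v → B₅ v ∨ G₆ v} which) (+-monoʳ-≤ (# light) (#-∨ {g = B₅} {h = G₆} (λ v → ∨-e)))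
    where
    which : ∀ v → Clear v ≡ true → light v ≡ true ⊎ B₅ v ∨ G₆ v ≡ true
    which v c with <-cmp (# (S v)) 5
    ... | tri< a _ _ = inj₁ (∧-i c (does-i (# (S v) ≤? 4) (≤-pred a)))
    ... | tri≈ _ e _ = inj₂ (∨-l (∧-i c (does-i (# (S v) ≟ℕ 5) e)))
    ... | tri> _ _ g = inj₂ (∨-r {B₅ v} (∧-i c (does-i (6 ≤? # (S v)) g)))

  crossing≥ : 5 * # B₅ + 6 * # G₆ ≤ crossing
  crossing≥ = begin
    5 * # B₅ + 6 * # G₆                             ≡⟨ cong₂ (λ a b → 5 * a + 6 * b) (#-sum B₅) (#-sum G₆) ⟩
    5 * ∑ (ind ∘ B₅) + 6 * ∑ (ind ∘ G₆)             ≡⟨ cong₂ _+_ (≡sym (sum-* 5 (ind ∘ B₅))) (≡sym (sum-* 6 (ind ∘ G₆))) ⟩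
    ∑ (λ v → 5 * ind (B₅ v)) + ∑ (λ v → 6 * ind (G₆ v)) ≡⟨ ≡sym (sum-+ _ _) ⟩
    ∑ (λ v → 5 * ind (B₅ v) + 6 * ind (G₆ v))       ≤⟨ sum-mono step ⟩
    crossing                                        ∎
    where
    open ≤-Reasoning
    clear-term : ∀ v → Clear v ≡ true → ind (Clear v) * # (S v) ≡ # (S v)
    clear-term v c = trans (cong (λ b → ind b * # (S v)) c) (+-identityʳ _)
    step : ∀ v → 5 * ind (B₅ v) + 6 * ind (G₆ v) ≤ ind (Clear v) * # (S v)
    step v with decide (B₅ v) | decide (G₆ v)
    ... | inj₁ p | inj₁ q = ⊥-elim (1+n≰n (subst (6 ≤_) (B₅-size {v} p) (does-e (6 ≤? # (S v)) (∧-r {Clear v} q))))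
    ... | inj₁ p | inj₂ q = ≤-trans (≤-reflexive (cong₂ (λ a b → 5 * ind a + 6 * ind b) p q)) (≤-reflexive (≡sym (trans (clear-term v (∧-l p)) (B₅-size {v} p))))
    ... | inj₂ p | inj₁ q = ≤-trans (≤-reflexive (cong₂ (λ a b → 5 * ind a + 6 * ind b) p q)) (≤-trans (does-e (6 ≤? # (S v)) (∧-r {Clear v} q)) (≤-reflexive (≡sym (clear-term v (∧-l q)))))
    ... | inj₂ p | inj₂ q = ≤-trans (≤-reflexive (cong₂ (λ a b → 5 * ind a + 6 * ind b) p q)) z≤n

  vertices : n ≤ # B₅ + # G₆ + (# C + (mid + mid) + few-bound 0 K * suc (# C))
  vertices = begin
    n                                                              ≤⟨ unclear ⟩
    # Clear + (# C + (mid + mid))                                  ≤⟨ +-monoˡ-≤ _ (≤-trans by-size (+-monoˡ-≤ (# B₅ + # G₆) few-light)) ⟩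
    F + (# B₅ + # G₆) + (# C + (mid + mid))                        ≡⟨ eq F (# B₅ + # G₆) (# C + (mid + mid)) ⟩
    # B₅ + # G₆ + (# C + (mid + mid) + F)                          ∎
    where
    open ≤-Reasoning
    F = few-bound 0 K * suc (# C)
    eq : ∀ f b x → f + b + x ≡ b + (x + f)
    eq = solve-∀

  no-hub : # B₅ ≤ hub-bound K * suc (# C) → 6 * n ≤ edges G + 6 * (# C + (mid + mid) + (few-bound 0 K + hub-bound K) * suc (# C))
  no-hub p = begin
    6 * n                                                          ≤⟨ *-monoʳ-≤ 6 vertices ⟩
    6 * (# B₅ + # G₆ + (M + F * sC))                               ≤⟨ *-monoʳ-≤ 6 (+-monoˡ-≤ (M + F * sC) (+-monoˡ-≤ (# G₆) p)) ⟩
    6 * (H * sC + # G₆ + (M + F * sC))                             ≡⟨ eq H sC (# G₆) M F ⟩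
    6 * # G₆ + 6 * (M + (F + H) * sC)                              ≤⟨ +-monoˡ-≤ _ (≤-trans (≤-trans (m≤n+m _ (5 * # B₅)) crossing≥) crossing≤edges) ⟩
    edges G + 6 * (M + (F + H) * sC)                               ∎
    where
    open ≤-Reasoning
    H = hub-bound K
    F = few-bound 0 K
    sC = suc (# C)
    M = # C + (mid + mid)
    eq : ∀ h s g m f → 6 * (h * s + g + (m + f * s)) ≡ 6 * g + 6 * (m + (f + h) * s)
    eq = solve-∀

  module WithHub (h : Fin n) (Ch : C h ≡ true) (at-h : ∀ v → B₅ v ≡ true → v ~ h) where

    -- A vertex of `B₀` sees only the hub and four core vertices, and these four-sets live in `X`. A
    -- vertex of `B₅` with further neighbours has them in `Out`.
    B₀ X Out : Fin n → Bool
    B₀ v = B₅ v ∧ does (deg v ≟ℕ 5)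
    X u = anyB (λ v → B₀ v ∧ adj G v u) ∧ not (does (u ≟ h))
    Out u = not (C u) ∧ not (B₅ u)

    dX : Fin n → ℕ
    dX x = # (λ u → adj G x u ∧ X u)

    DX n₀ m : ℕ
    DX = ∑ (λ x → ind (X x) * dX x)
    n₀ = # B₀
    m = # X

    B₀⇒B₅ : ∀ {v} → B₀ v ≡ true → B₅ v ≡ true
    B₀⇒B₅ {v} p = ∧-l p

    B₀-C : ∀ {v} → B₀ v ≡ true → ∀ u → v ~ u → C u ≡ true
    B₀-C {v} p u vu = ∧-r {adj G v u} (trans (#-⊂-eq {f = S v} {adj G v} (λ i → ∧-l) (trans (B₅-size {v} (∧-l p)) (≡sym (does-e (deg v ≟ℕ 5) (∧-r {B₅ v} p)))) u) vu)

    X-e : ∀ {u} → X u ≡ true → ∃ λ v → B₀ v ≡ true × v ~ u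
    X-e {u} p = let v , q = anyB-e {f = λ v → B₀ v ∧ adj G v u} (∧-l p) in v , ∧-l q , ∧-r {B₀ v} q

    X≢h : ∀ {u} → X u ≡ true → u ≢ h
    X≢h {u} p = does-ne (u ≟ h) (not-e (∧-r {anyB (λ v → B₀ v ∧ adj G v u)} p))

    X-i : ∀ {u v} → B₀ v ≡ true → v ~ u → u ≢ h → X u ≡ true
    X-i {u} {v} b vu ne = ∧-i (anyB-i {f = λ v → B₀ v ∧ adj G v u} v (∧-i b vu)) (not-i (does-ni (u ≟ h) ne))

    X⇒C : ∀ {u} → X u ≡ true → C u ≡ true
    X⇒C {u} p = let v , b , vu = X-e p in B₀-C b u vu

    h≁X : ∀ {u} → X u ≡ true → ¬ h ~ u
    h≁X p hu = let v , b , vu = X-e p in tri (at-h v (B₀⇒B₅ b)) vu hu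

    independent : ∀ {u v} → B₅ u ≡ true → B₅ v ≡ true → ¬ u ~ v
    independent {u} {v} bu bv uv = tri uv (at-h u bu) (at-h v bv)

    outward : ℕ
    outward = ∑ (λ v → ind (B₅ v) * # (λ w → adj G v w ∧ Out w))

    -- Edges from clear vertices to the core, edges inside `X` and edges from `B₅` to `Out` are of
    -- three disjoint kinds; `table` checks this on the membership bits of the two ends.
    edge-split : (crossing + crossing + DX) + (outward + outward) ≤ edges G + edges G
    edge-split = subst (_≤ edges G + edges G) totals (total-≤ F one)
      where
      f₁ f₂ f₃ : Fin n → Fin n → ℕ
      f₁ u w = ind (Clear u ∧ C w)
      f₂ u w = ind (X u ∧ X w)
      f₃ u w = ind (B₅ u ∧ Out w)
      F : Fin n → Fin n → ℕ
      F u w = (f₁ u w + f₁ w u + f₂ u w) + (f₃ u w + f₃ w u)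
      totals : total F ≡ (crossing + crossing + DX) + (outward + outward)
      totals = trans (total-+ (λ u w → f₁ u w + f₁ w u + f₂ u w) (λ u w → f₃ u w + f₃ w u)) (cong₂ _+_
        (trans (total-+ (λ u w → f₁ u w + f₁ w u) f₂) (cong₂ _+_ (trans (total-+ f₁ (λ u w → f₁ w u)) (cong₂ _+_ (total-∧ Clear C) (trans (total-sym f₁) (total-∧ Clear C)))) (total-∧ X X)))
        (trans (total-+ f₃ (λ u w → f₃ w u)) (cong₂ _+_ (total-∧ B₅ Out) (trans (total-sym f₃) (total-∧ B₅ Out)))))
      table : ∀ cu xu gu bu cw xw gw bw → (cu ≡ true → gu ≡ false) → (xu ≡ true → cu ≡ true) → (bu ≡ true → gu ≡ true) →
        (cw ≡ true → gw ≡ false) → (xw ≡ true → cw ≡ true) → (bw ≡ true → gw ≡ true) →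
        (ind (gu ∧ cw) + ind (gw ∧ cu) + ind (xu ∧ xw)) + (ind (bu ∧ (not cw ∧ not bw)) + ind (bw ∧ (not cu ∧ not bu))) ≤ 1
      table true xu gu bu true xw gw bw p₁ p₂ p₃ q₁ q₂ q₃ rewrite p₁ refl | q₁ refl with decide bu | decide bw
      ... | inj₁ b | _ = ⊥-elim (clash (p₃ b) refl)
      ... | _ | inj₁ b = ⊥-elim (clash (q₃ b) refl)
      ... | inj₂ b | inj₂ b′ rewrite b | b′ = bit (xu ∧ xw)
        where
        bit : ∀ b → ind b + 0 ≤ 1
        bit true  = ≤-refl
        bit false = z≤n
      table true xu gu bu false xw gw bw p₁ p₂ p₃ q₁ q₂ q₃ rewrite p₁ refl with decide bu | decide xw
      ... | inj₁ b | _ = ⊥-elim (clash (p₃ b) refl)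
      ... | _ | inj₁ b = ⊥-elim (clash (q₂ b) refl)
      ... | inj₂ b | inj₂ x rewrite b | x = bits gw xu bw
        where
        bits : ∀ g x b → (ind (g ∧ true) + ind (x ∧ false)) + ind (b ∧ false) ≤ 1
        bits true  true  true  = ≤-refl
        bits true  true  false = ≤-refl
        bits true  false true  = ≤-refl
        bits true  false false = ≤-refl
        bits false true  true  = z≤n
        bits false true  false = z≤n
        bits false false true  = z≤n
        bits false false false = z≤n
      table false xu gu bu true xw gw bw p₁ p₂ p₃ q₁ q₂ q₃ rewrite q₁ refl with decide bw | decide xu
      ... | inj₁ b | _ = ⊥-elim (clash (q₃ b) refl)
      ... | _ | inj₁ b = ⊥-elim (clash (p₂ b) refl)
      ... | inj₂ b | inj₂ x rewrite b | x = bits gu bu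
        where
        bits : ∀ g b → (ind (g ∧ true) + 0 + 0) + (ind (b ∧ false) + 0) ≤ 1
        bits true  true  = ≤-refl
        bits true  false = ≤-refl
        bits false true  = z≤n
        bits false false = z≤n
      table false xu gu bu false xw gw bw p₁ p₂ p₃ q₁ q₂ q₃ with decide xu
      ... | inj₁ b = ⊥-elim (clash (p₂ b) refl)
      ... | inj₂ x rewrite x = bits gu gw bu bw
        where
        bits : ∀ g g′ b b′ → (ind (g ∧ false) + ind (g′ ∧ false) + 0) + (ind (b ∧ (true ∧ not b′)) + ind (b′ ∧ (true ∧ not b))) ≤ 1
        inner : ∀ b b′ → ind (b ∧ (true ∧ not b′)) + ind (b′ ∧ (true ∧ not b)) ≤ 1
        inner true  true  = z≤n
        inner true  false = ≤-refl
        inner false true  = ≤-refl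
        inner false false = z≤n
        bits true  true  b b′ = inner b b′
        bits true  false b b′ = inner b b′
        bits false true  b b′ = inner b b′
        bits false false b b′ = inner b b′
      one : ∀ u w → u ~ w → F u w ≤ 1
      one u w _ = table (C u) (X u) (Clear u) (B₅ u) (C w) (X w) (Clear w) (B₅ w)
        (c⇒ u) X⇒C ∧-l (c⇒ w) X⇒C ∧-l
        where
        c⇒ : ∀ u → C u ≡ true → Clear u ≡ false
        c⇒ u p = ¬true⇒false (λ q → clash p (Clear⇒¬C {u} q))

    -- A vertex of `B₅` outside `B₀` has a neighbour outside the core. It is not in `B₅`, because
    -- vertices of `B₅` share the hub.
    #B₅≤ : # B₅ ≤ n₀ + outward
    #B₅≤ = ≤-trans (≤-reflexive (#-split B₅ (λ v → does (deg v ≟ℕ 5)))) (+-monoʳ-≤ n₀ (≤-trans (≤-reflexive (#-sum _)) (sum-mono step)))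
      where
      step : ∀ v → ind (B₅ v ∧ not (does (deg v ≟ℕ 5))) ≤ ind (B₅ v) * # (λ w → adj G v w ∧ Out w)
      step v with decide (B₅ v ∧ not (does (deg v ≟ℕ 5)))
      ... | inj₂ p = ≤-trans (≤-reflexive (cong ind p)) z≤n
      ... | inj₁ p = ≤-trans (≤-reflexive (cong ind p)) (≤-trans (positive (#-pos outside)) (≤-reflexive (≡sym (trans (cong (λ b → ind b * # (λ w → adj G v w ∧ Out w)) bv) (+-identityʳ _)))))
        where
        bv : B₅ v ≡ true
        bv = ∧-l p
        outside : 0 < # (λ w → adj G v w ∧ not (C w))
        outside = ≢0 (λ e → does-ne (deg v ≟ℕ 5) (not-e (∧-r {B₅ v} p)) (trans (#-split (adj G v) C) (trans (cong (# (S v) +_) e) (trans (+-identityʳ _) (B₅-size {v} bv)))))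
          where
          ≢0 : ∀ {k} → k ≢ 0 → 0 < k
          ≢0 {zero} q = ⊥-elim (q refl)
          ≢0 {suc k} q = s≤s z≤n
        positive : (∃ λ w → adj G v w ∧ not (C w) ≡ true) → 1 ≤ # (λ w → adj G v w ∧ Out w)
        positive (w , q) = #-pos′ w (∧-i {adj G v w} (∧-l q) (∧-i {not (C w)} (∧-r {adj G v w} q) (not-i (¬true⇒false (λ bw → independent bv bw (∧-l q))))))

    -- In doubled form: a vertex provides six edges, except that one of `B₀` provides five, and the
    -- edges inside `X` come on top.
    with-hub : 12 * n + DX ≤ edges G + edges G + 2 * n₀ + 12 * (# C + (mid + mid) + few-bound 0 K * suc (# C))
    with-hub = begin
      12 * n + DX                                              ≤⟨ +-monoˡ-≤ DX (*-monoʳ-≤ 12 vertices) ⟩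
      12 * (# B₅ + # G₆ + L) + DX                              ≡⟨ e₁ (# B₅) (# G₆) L DX ⟩
      (2 * (5 * # B₅ + 6 * # G₆) + DX) + 2 * # B₅ + 12 * L     ≤⟨ +-monoˡ-≤ (12 * L) (+-mono-≤ (+-monoˡ-≤ DX (*-monoʳ-≤ 2 crossing≥)) (*-monoʳ-≤ 2 #B₅≤)) ⟩
      (2 * crossing + DX) + 2 * (n₀ + outward) + 12 * L        ≡⟨ e₂ crossing DX n₀ outward (12 * L) ⟩
      ((crossing + crossing + DX) + (outward + outward)) + 2 * n₀ + 12 * L ≤⟨ +-monoˡ-≤ (12 * L) (+-monoˡ-≤ (2 * n₀) edge-split) ⟩
      edges G + edges G + 2 * n₀ + 12 * L                      ∎
      where
      open ≤-Reasoning
      L = # C + (mid + mid) + few-bound 0 K * suc (# C)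
      e₁ : ∀ b g l x → 12 * (b + g + l) + x ≡ (2 * (5 * b + 6 * g) + x) + 2 * b + 12 * l
      e₁ = solve-∀
      e₂ : ∀ c x b o l → (2 * c + x) + 2 * (b + o) + l ≡ ((c + c + x) + (o + o)) + 2 * b + l
      e₂ = solve-∀

    agree⇒≡ : ∀ {v w} → B₀ v ≡ true → B₀ w ≡ true → (∀ u → X u ≡ true → adj G v u ≡ adj G w u) → v ≡ w
    agree⇒≡ {v} {w} bv bw ag = [ id , (λ ne → ⊥-elim (tf v w (ne , twin))) ]′ (dec (v ≟ w))
      where
      dec : Dec (v ≡ w) → v ≡ w ⊎ v ≢ w
      dec (yes p) = inj₁ p
      dec (no p) = inj₂ p
      twin : ∀ u → adj G v u ≡ adj G w u
      twin u = [ ag u , (λ x → outside x (u ≟ h)) ]′ (decide (X u))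
        where
        outside : X u ≡ false → Dec (u ≡ h) → adj G v u ≡ adj G w u
        outside x (yes e) = subst (λ z → adj G v z ≡ adj G w z) (≡sym e) (trans (at-h v (B₀⇒B₅ bv)) (≡sym (at-h w (B₀⇒B₅ bw))))
        outside x (no ne) = trans (off bv) (≡sym (off bw))
          where
          off : ∀ {v} → B₀ v ≡ true → adj G v u ≡ false
          off b = ¬true⇒false (λ p → clash (X-i b p ne) x)

    n₀≤2^m : n₀ ≤ 2 ^ m
    n₀≤2^m = #-traces B₀ X (adj G) (λ v w → agree⇒≡)

    four : ∀ {v} → B₀ v ≡ true → # (λ u → X u ∧ adj G v u) ≡ 4
    four {v} b = cong pred (trans (≡sym (trans (#-del (adj G v) h (at-h v (B₀⇒B₅ b))) (cong suc (#-cong eq)))) (does-e (deg v ≟ℕ 5) (∧-r {B₅ v} b)))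
      where
      eq : ∀ u → adj G v u ∧ not (does (u ≟ h)) ≡ X u ∧ adj G v u
      eq u = bool-ext (λ p → ∧-i (X-i b (∧-l p) (does-ne (u ≟ h) (not-e (∧-r {adj G v u} p)))) (∧-l p))
                      (λ p → ∧-i (∧-r {X u} p) (not-i (does-ni (u ≟ h) (X≢h (∧-l p)))))

    -- The hub sees no vertex of `X`, so the common neighbour is itself in `X`.
    meets : ∀ {v u} → B₀ v ≡ true → X u ≡ true → adj G v u ≡ false → ∃ λ t → X t ≡ true × v ~ t × u ~ t
    meets {v} {u} b x na with common-neighbour {v} {u} (λ { refl → clash (X⇒C x) (Clear⇒¬C {v} (∧-l (B₀⇒B₅ b))) }) na
    ... | t , vt , ut = t , X-i b vt (λ { refl → h≁X x (~-sym ut) }) , vt , ut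

    spread : ∀ {v} → B₀ v ≡ true → m ≤ 4 + ∑ (λ x → ind (X x ∧ adj G v x) * dX x)
    spread {v} b = ≤-trans (≤-reflexive (#-split X (adj G v))) (+-mono-≤ (≤-reflexive (four b))
      (≤-trans (#-mono cover) (#-anyB-sum (λ x → X x ∧ adj G v x) (λ u x → adj G x u ∧ X u))))
      where
      cover : ∀ u → X u ∧ not (adj G v u) ≡ true → anyB (λ x → (X x ∧ adj G v x) ∧ (adj G x u ∧ X u)) ≡ true
      cover u p = let t , xt , vt , ut = meets b (∧-l p) (not-e (∧-r {X u} p))
                  in anyB-i {f = λ x → (X x ∧ adj G v x) ∧ (adj G x u ∧ X u)} t (∧-i (∧-i xt vt) (∧-i (~-sym ut) (∧-l p)))

    g : Fin n → ℕ
    g x = # (λ v → B₀ v ∧ adj G v x)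

    dX≤m : ∀ x → dX x ≤ m
    dX≤m x = #-mono (λ u → ∧-r {adj G x u})

    -- Deleting `x` from the four-sets through it leaves triples that are independent and dominating
    -- in the part of `X` not adjacent to `x`, so `ExactTriples` applies.
    link-bound : ∀ {x} → X x ≡ true → g x + dX x ≤ m + 64
    link-bound {x} xx = begin
      g x + dX x               ≤⟨ +-monoˡ-≤ (dX x) ExactTriplesX.#T≤#Y+64 ⟩
      # Y + 64 + dX x          ≡⟨ eq (# Y) (dX x) ⟩
      dX x + # Y + 64          ≤⟨ +-monoˡ-≤ 64 (≤-trans (+-mono-≤ (#-mono {g = λ u → X u ∧ adj G x u} (λ u p → ∧-i (∧-r {adj G x u} p) (∧-l p))) (#-mono {g = λ u → X u ∧ not (adj G x u)} (λ u → ∧-l))) (≤-reflexive (≡sym (#-split X (adj G x))))) ⟩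
      m + 64                   ∎
      where
      open ≤-Reasoning
      eq : ∀ y d → y + 64 + d ≡ d + y + 64
      eq = solve-∀
      T Y : Fin n → Bool
      T v = B₀ v ∧ adj G v x
      Y u = (X u ∧ not (adj G x u)) ∧ not (does (u ≟ x))
      inc : Fin n → Fin n → Bool
      inc v u = (X u ∧ adj G v u) ∧ not (does (u ≟ x))
      inc-X : ∀ {v u} → inc v u ≡ true → X u ≡ true
      inc-X {v} {u} p = ∧-l (∧-l {X u ∧ adj G v u} p)
      inc-~ : ∀ {v u} → inc v u ≡ true → v ~ u
      inc-~ {v} {u} p = ∧-r {X u} (∧-l {X u ∧ adj G v u} p)
      inc-≢ : ∀ {v u} → inc v u ≡ true → not (does (u ≟ x)) ≡ true
      inc-≢ {v} {u} p = ∧-r {X u ∧ adj G v u} p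
      size : ∀ {v} → T v ≡ true → # (inc v) ≡ 3
      size {v} t = cong pred (trans (≡sym (#-del (λ u → X u ∧ adj G v u) x (∧-i xx (∧-r {B₀ v} t)))) (four (∧-l t)))
      inY : ∀ {v u} → T v ≡ true → inc v u ≡ true → Y u ≡ true
      inY {v} {u} t i = ∧-i (∧-i (inc-X {v} i) (not-i (¬true⇒false (λ xu → tri (∧-r {B₀ v} t) (inc-~ {v} i) xu)))) (inc-≢ {v} i)
      indep : ∀ {v u w} → T v ≡ true → inc v u ≡ true → inc v w ≡ true → adj G u w ≡ false
      indep {v} t i j = ¬true⇒false (λ p → tri (inc-~ {v} i) (inc-~ {v} j) p)
      domin : ∀ {v u} → T v ≡ true → Y u ≡ true → inc v u ≡ false → ∃ λ t → inc v t ≡ true × u ~ t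
      domin {v} {u} t y i with meets {v} {u} (∧-l t) (∧-l (∧-l {X u ∧ not (adj G x u)} y))
             (¬true⇒false (λ vu → clash (∧-i (∧-i (∧-l (∧-l {X u ∧ not (adj G x u)} y)) vu) (∧-r {X u ∧ not (adj G x u)} y)) i))
      ... | s , xs , vs , us = s , ∧-i (∧-i xs vs) (not-i (does-ni (s ≟ x) (λ { refl → clash (~-sym us) (not-e (∧-r {X u} (∧-l {X u ∧ not (adj G x u)} y))) }))) , us
      sep : ∀ {v w} → T v ≡ true → T w ≡ true → (∀ u → inc v u ≡ inc w u) → v ≡ w
      sep {v} {w} t t′ ag = agree⇒≡ (∧-l t) (∧-l t′) go
        where
        go : ∀ u → X u ≡ true → adj G v u ≡ adj G w u
        go u xu = dec (u ≟ x)
          where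
          half : ∀ v w → (∀ u → inc v u ≡ inc w u) → u ≢ x → v ~ u → w ~ u
          half v w ag ne vu = inc-~ {w} (trans (≡sym (ag u)) (∧-i (∧-i xu vu) (not-i (does-ni (u ≟ x) ne))))
          dec : Dec (u ≡ x) → adj G v u ≡ adj G w u
          dec (yes e) = subst (λ z → adj G v z ≡ adj G w z) (≡sym e) (trans (∧-r {B₀ v} t) (≡sym (∧-r {B₀ w} t′)))
          dec (no ne) = bool-ext (half v w ag ne) (half w v (λ u → ≡sym (ag u)) ne)
      module ExactTriplesX = ExactTriples G T Y inc tri size (λ {v} {u} → inY {v} {u}) (λ {v} {u} {w} → indep {v} {u} {w}) (λ {v} {u} → domin {v} {u}) sep

    reorder : ∀ b x a d → ind b * (ind (x ∧ a) * d) ≡ ind x * d * ind (b ∧ a)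
    reorder true  true  true  d = trans (+-identityʳ (d + 0)) (≡sym (*-identityʳ (d + 0)))
    reorder true  true  false d = ≡sym (*-zeroʳ (d + 0))
    reorder true  false a     d = refl
    reorder false true  a     d = ≡sym (*-zeroʳ (d + 0))
    reorder false false a     d = refl

    weight : ℕ
    weight = ∑ (λ x → ind (X x) * dX x * g x)

    -- Each four-set dominates `X`; sum this over `B₀` and exchange the sums.
    total-spread : n₀ * m ≤ n₀ * 4 + weight
    total-spread = begin
      n₀ * m                                                          ≡⟨ cong (_* m) (#-sum B₀) ⟩
      ∑ (ind ∘ B₀) * m                                                ≡⟨ ≡sym (sum-*ʳ m (ind ∘ B₀)) ⟩
      ∑ (λ v → ind (B₀ v) * m)                                        ≤⟨ sum-mono step ⟩
      ∑ (λ v → ind (B₀ v) * 4 + ind (B₀ v) * W v)                     ≡⟨ sum-+ _ _ ⟩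
      ∑ (λ v → ind (B₀ v) * 4) + ∑ (λ v → ind (B₀ v) * W v)           ≡⟨ cong₂ _+_ (trans (sum-*ʳ 4 (ind ∘ B₀)) (cong (_* 4) (≡sym (#-sum B₀)))) swapped ⟩
      n₀ * 4 + weight                                                 ∎
      where
      open ≤-Reasoning
      W : Fin n → ℕ
      W v = ∑ (λ x → ind (X x ∧ adj G v x) * dX x)
      step : ∀ v → ind (B₀ v) * m ≤ ind (B₀ v) * 4 + ind (B₀ v) * W v
      step v with decide (B₀ v)
      ... | inj₂ p = ≤-trans (≤-reflexive (cong (λ b → ind b * m) p)) z≤n
      ... | inj₁ p = ≤-trans (*-monoʳ-≤ (ind (B₀ v)) (spread p)) (≤-reflexive (*-distribˡ-+ (ind (B₀ v)) 4 (W v)))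
      swapped : ∑ (λ v → ind (B₀ v) * W v) ≡ weight
      swapped = trans (sum-cong (λ v → ≡sym (sum-* (ind (B₀ v)) _))) (trans (sum-swap (λ v x → ind (B₀ v) * (ind (X x ∧ adj G v x) * dX x)))
        (sum-cong (λ x → trans (sum-cong (λ v → reorder (B₀ v) (X x) (adj G v x) (dX x))) (trans (sum-* (ind (X x) * dX x) _) (cong (ind (X x) * dX x *_) (≡sym (#-sum _)))))))

    total-degree : ∑ (λ x → ind (X x) * g x) ≡ n₀ * 4
    total-degree = begin
      ∑ (λ x → ind (X x) * g x)                                       ≡⟨ sum-cong (λ x → trans (cong (ind (X x) *_) (#-sum _)) (≡sym (sum-* (ind (X x)) _))) ⟩
      ∑ (λ x → ∑ (λ v → ind (X x) * ind (B₀ v ∧ adj G v x)))          ≡⟨ sum-swap _ ⟩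
      ∑ (λ v → ∑ (λ x → ind (X x) * ind (B₀ v ∧ adj G v x)))          ≡⟨ sum-cong (λ v → trans (sum-cong (λ x → re (X x) (B₀ v) (adj G v x))) (trans (sum-* (ind (B₀ v)) _) (cong (ind (B₀ v) *_) (≡sym (#-sum _))))) ⟩
      ∑ (λ v → ind (B₀ v) * # (λ x → X x ∧ adj G v x))                ≡⟨ sum-cong step ⟩
      ∑ (λ v → ind (B₀ v) * 4)                                        ≡⟨ trans (sum-*ʳ 4 (ind ∘ B₀)) (cong (_* 4) (≡sym (#-sum B₀))) ⟩
      n₀ * 4                                                          ∎
      where
      open ≡-Reasoning
      re : ∀ x b a → ind x * ind (b ∧ a) ≡ ind b * ind (x ∧ a)
      re true true a = refl
      re true false a = refl
      re false true a = refl
      re false false a = refl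
      step : ∀ v → ind (B₀ v) * # (λ x → X x ∧ adj G v x) ≡ ind (B₀ v) * 4
      step v with decide (B₀ v)
      ... | inj₂ p = trans (cong (λ b → ind b * # (λ x → X x ∧ adj G v x)) p) (≡sym (cong (λ b → ind b * 4) p))
      ... | inj₁ p = cong (ind (B₀ v) *_) (four p)

    trade : 16 * weight ≤ n₀ * 4 * m + (9 * m + 1024) * DX
    trade = begin
      16 * weight                                                             ≡⟨ ≡sym (sum-* 16 _) ⟩
      ∑ (λ x → 16 * (ind (X x) * dX x * g x))                                 ≤⟨ sum-mono step ⟩
      ∑ (λ x → ind (X x) * g x * m + (9 * m + 1024) * (ind (X x) * dX x))     ≡⟨ sum-+ _ _ ⟩
      ∑ (λ x → ind (X x) * g x * m) + ∑ (λ x → (9 * m + 1024) * (ind (X x) * dX x)) ≡⟨ cong₂ _+_ (trans (sum-*ʳ m _) (cong (_* m) total-degree)) (sum-* (9 * m + 1024) _) ⟩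
      n₀ * 4 * m + (9 * m + 1024) * DX                                        ∎
      where
      open ≤-Reasoning
      one : ∀ {b} → b ≡ true → ∀ d e → ind b * d * e ≡ d * e
      one refl d e = cong (_* e) (+-identityʳ d)
      step : ∀ x → 16 * (ind (X x) * dX x * g x) ≤ ind (X x) * g x * m + (9 * m + 1024) * (ind (X x) * dX x)
      step x with decide (X x)
      ... | inj₂ p = ≤-trans (≤-reflexive (cong (λ b → 16 * (ind b * dX x * g x)) p)) z≤n
      ... | inj₁ p = ≤-trans (≤-reflexive (cong (16 *_) (trans (one p (dX x) (g x)) (*-comm (dX x) (g x)))))
          (≤-trans (degree-trade (g x) (dX x) m (dX≤m x) (link-bound p))
            (≤-reflexive (≡sym (cong₂ (λ a c → a + (9 * m + 1024) * c) (one p (g x) m) (trans (cong (λ b → ind b * dX x) p) (+-identityʳ _))))))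

    -- Domination contributes `16 * n₀ * m`, and `trade` gives back `4 * n₀ * m`. Comparing the
    -- remaining 12 with 9 yields `DX` about 4/3 of `n₀`, twice the desired number of edges.
    core-edges : n₀ * (12 * m) ≤ n₀ * 64 + (9 * m + 1024) * DX
    core-edges = +-cancelˡ-≤ (n₀ * 4 * m) _ _ (begin
      n₀ * 4 * m + n₀ * (12 * m)                       ≡⟨ e₁ n₀ m ⟩
      16 * (n₀ * m)                                    ≤⟨ *-monoʳ-≤ 16 total-spread ⟩
      16 * (n₀ * 4 + weight)                           ≡⟨ e₂ n₀ weight ⟩
      n₀ * 64 + 16 * weight                            ≤⟨ +-monoʳ-≤ (n₀ * 64) trade ⟩
      n₀ * 64 + (n₀ * 4 * m + (9 * m + 1024) * DX)     ≡⟨ e₃ (n₀ * 64) (n₀ * 4 * m) _ ⟩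
      n₀ * 4 * m + (n₀ * 64 + (9 * m + 1024) * DX)     ∎)
      where
      open ≤-Reasoning
      e₁ : ∀ b m → b * 4 * m + b * (12 * m) ≡ 16 * (b * m)
      e₁ = solve-∀
      e₂ : ∀ b w → 16 * (b * 4 + w) ≡ b * 64 + 16 * w
      e₂ = solve-∀
      e₃ : ∀ a b c → a + (b + c) ≡ b + (a + c)
      e₃ = solve-∀

-- Closing arithmetic for r = 3

core-edges-large : ∀ b m x s → 477 * s ≤ m → 1 ≤ m → b * (12 * m) ≤ b * 64 + (9 * m + 1024) * x →
  s * (4 * b) ≤ s * (3 * x) + b
core-edges-large b m@(suc m′) x s big _ h with ≤-total (4 * b) (3 * x)
... | inj₁ p = ≤-trans (*-monoʳ-≤ s p) (m≤m+n _ b)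
-- Here `3 * x ≤ 4 * b`, so the error is at most `(192 + 1024 * 4) * b`, that is `4288 * b`, and 477
-- is the least integer with `9 * 477 ≥ 4288`.
... | inj₂ p = *-cancelˡ-≤ (9 * m) (begin
  9 * m * (s * (4 * b))                                  ≡⟨ e₁ m s b ⟩
  s * (3 * (b * (12 * m)))                               ≤⟨ *-monoʳ-≤ s (*-monoʳ-≤ 3 h) ⟩
  s * (3 * (b * 64 + (9 * m + 1024) * x))                ≡⟨ e₂ s b m x ⟩
  9 * m * (s * (3 * x)) + s * (192 * b + 1024 * (3 * x)) ≤⟨ +-monoʳ-≤ (9 * m * (s * (3 * x))) (*-monoʳ-≤ s (+-monoʳ-≤ (192 * b) (*-monoʳ-≤ 1024 p))) ⟩
  9 * m * (s * (3 * x)) + s * (192 * b + 1024 * (4 * b)) ≤⟨ +-monoʳ-≤ (9 * m * (s * (3 * x))) last ⟩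
  9 * m * (s * (3 * x)) + 9 * m * b                      ≡⟨ ≡sym (*-distribˡ-+ (9 * m) (s * (3 * x)) b) ⟩
  9 * m * (s * (3 * x) + b)                              ∎)
  where
  open ≤-Reasoning
  e₁ : ∀ m s b → 9 * m * (s * (4 * b)) ≡ s * (3 * (b * (12 * m)))
  e₁ = solve-∀
  e₂ : ∀ s b m x → s * (3 * (b * 64 + (9 * m + 1024) * x)) ≡ 9 * m * (s * (3 * x)) + s * (192 * b + 1024 * (3 * x))
  e₂ = solve-∀
  e₃ : ∀ s b → s * (192 * b + 1024 * (4 * b)) + 5 * (s * b) ≡ 9 * (477 * s) * b
  e₃ = solve-∀
  last : s * (192 * b + 1024 * (4 * b)) ≤ 9 * m * b
  last = ≤-trans (≤-trans (m≤m+n _ (5 * (s * b))) (≤-reflexive (e₃ s b))) (*-monoˡ-≤ b (*-monoʳ-≤ 9 big))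

finish-dense : ∀ s n e → 6 * n ≤ e → 17 * s * n ≤ 3 * s * e + 3 * n
finish-dense s n e p = begin
  17 * s * n                ≤⟨ m≤m+n _ (s * n) ⟩
  17 * s * n + s * n        ≡⟨ e₁ s n ⟩
  3 * s * (6 * n)           ≤⟨ *-monoʳ-≤ (3 * s) p ⟩
  3 * s * e                 ≤⟨ m≤m+n _ (3 * n) ⟩
  3 * s * e + 3 * n         ∎
  where
  open ≤-Reasoning
  e₁ : ∀ s n → 17 * s * n + s * n ≡ 3 * s * (6 * n)
  e₁ = solve-∀

finish-no-hub : ∀ s n e l → 6 * n ≤ e + 6 * l → s * 12 * l ≤ n → 17 * s * n ≤ 3 * s * e + 3 * n
finish-no-hub s n e l p q = begin
  17 * s * n                ≤⟨ m≤m+n _ (s * n) ⟩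
  17 * s * n + s * n        ≡⟨ e₁ s n ⟩
  3 * s * (6 * n)           ≤⟨ *-monoʳ-≤ (3 * s) p ⟩
  3 * s * (e + 6 * l)       ≤⟨ m≤m+n _ (s * 18 * l) ⟩
  3 * s * (e + 6 * l) + s * 18 * l ≡⟨ e₂ s e l ⟩
  3 * s * e + 3 * (s * 12 * l) ≤⟨ +-monoʳ-≤ (3 * s * e) (*-monoʳ-≤ 3 q) ⟩
  3 * s * e + 3 * n         ∎
  where
  open ≤-Reasoning
  e₁ : ∀ s n → 17 * s * n + s * n ≡ 3 * s * (6 * n)
  e₁ = solve-∀
  e₂ : ∀ s e l → 3 * s * (e + 6 * l) + s * 18 * l ≡ 3 * s * e + 3 * (s * 12 * l)
  e₂ = solve-∀

-- Up to errors, `x ≥ 4 * b / 3` turns `12 * n - 2 * b + x` into at least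
-- `12 * n - 2 * b / 3 ≥ 34 * n / 3`, which is twice the claim.
finish-hub : ∀ s n e l b x → 12 * n + x ≤ e + e + 2 * b + 12 * l → s * 12 * l ≤ n → b ≤ n → s * (4 * b) ≤ s * (3 * x) + n →
  17 * s * n ≤ 3 * s * e + 3 * n
finish-hub s n e l b x p q r t = *-cancelˡ-≤ 2 (+-cancelˡ-≤ (s * (2 * b)) _ _ (+-cancelˡ-≤ (s * (3 * x) + s * (4 * b)) _ _ (begin
  (s * (3 * x) + s * (4 * b)) + (s * (2 * b) + 2 * (17 * s * n))            ≤⟨ +-monoˡ-≤ (s * (2 * b) + 2 * (17 * s * n)) (+-monoʳ-≤ (s * (3 * x)) t) ⟩
  (s * (3 * x) + (s * (3 * x) + n)) + (s * (2 * b) + 2 * (17 * s * n))      ≤⟨ +-monoʳ-≤ (s * (3 * x) + (s * (3 * x) + n)) (+-monoˡ-≤ (2 * (17 * s * n)) (*-monoʳ-≤ s (*-monoʳ-≤ 2 r))) ⟩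
  (s * (3 * x) + (s * (3 * x) + n)) + (s * (2 * n) + 2 * (17 * s * n))      ≡⟨ e₁ s n x ⟩
  (s * (3 * x) + n) + 3 * s * (12 * n + x)                                  ≤⟨ +-monoʳ-≤ (s * (3 * x) + n) (*-monoʳ-≤ (3 * s) p) ⟩
  (s * (3 * x) + n) + 3 * s * (e + e + 2 * b + 12 * l)                      ≡⟨ e₂ s n e b x l ⟩
  (s * (3 * x) + s * (4 * b)) + (s * (2 * b) + 6 * s * e + n) + 3 * (s * 12 * l) ≤⟨ +-mono-≤ (+-monoʳ-≤ (s * (3 * x) + s * (4 * b)) (+-monoʳ-≤ (s * (2 * b) + 6 * s * e) (m≤m+n n (2 * n)))) (*-monoʳ-≤ 3 q) ⟩
  (s * (3 * x) + s * (4 * b)) + (s * (2 * b) + 6 * s * e + (n + 2 * n)) + 3 * n ≡⟨ e₃ (s * (3 * x) + s * (4 * b)) (s * (2 * b)) s e n ⟩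
  (s * (3 * x) + s * (4 * b)) + (s * (2 * b) + 2 * (3 * s * e + 3 * n))     ∎)))
  where
  open ≤-Reasoning
  e₁ : ∀ s n x → (s * (3 * x) + (s * (3 * x) + n)) + (s * (2 * n) + 2 * (17 * s * n)) ≡ (s * (3 * x) + n) + 3 * s * (12 * n + x)
  e₁ = solve-∀
  e₂ : ∀ s n e b x l → (s * (3 * x) + n) + 3 * s * (e + e + 2 * b + 12 * l) ≡ (s * (3 * x) + s * (4 * b)) + (s * (2 * b) + 6 * s * e + n) + 3 * (s * 12 * l)
  e₂ = solve-∀
  e₃ : ∀ y z s e n → y + (z + 6 * s * e + (n + 2 * n)) + 3 * n ≡ y + (z + 2 * (3 * s * e + 3 * n))
  e₃ = solve-∀

module LowerBound₃ (k : ℕ) where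
  Fb : ℕ → ℕ
  Fb ω = few-bound 0 (excBound ω) + hub-bound (excBound ω)

  module Sc = Scale 5 (suc k * 12) Fb

  opaque
    -- If `X` is smaller than `core-size`, then `n₀` is at most `2 ^ core-size`, and the threshold
    -- absorbs it.
    core-size small-core : ℕ
    core-size = suc (477 * suc k)
    small-core = suc k * (4 * 2 ^ core-size)

    core-size-≥ : 477 * suc k ≤ core-size × 1 ≤ core-size
    core-size-≥ = n≤1+n _ , s≤s z≤n

    small-core-def : small-core ≡ suc k * (4 * 2 ^ core-size)
    small-core-def = refl

  module _ {n : ℕ} (G : Graph n) (tf : TwinFree G) (sat : KSaturated 3 G) (i : ℕ) (small : suc k * 12 * Sc.loss G i ≤ n) (N≤n : small-core ≤ n) where
    open Setup₃ G sat tf (Sc.ω i) (Sc.ω (suc i)) (Sc.pos i) (Sc.inc i)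
    open Degrees.Levels G (Sc.ω i) (Sc.ω (suc i)) (Sc.pos i) (Sc.inc i)

    loss₀ : ℕ
    loss₀ = # C + (mid + mid) + few-bound 0 (excBound (Sc.ω i)) * suc (# C)

    loss₀≤ : loss₀ ≤ Sc.loss G i
    loss₀≤ = +-monoʳ-≤ (# C + (mid + mid)) (*-monoˡ-≤ (suc (# C)) (m≤m+n (few-bound 0 (excBound (Sc.ω i))) (hub-bound (excBound (Sc.ω i)))))

    hub-case : (h : Fin n) → C h ≡ true → (∀ v → B₅ v ≡ true → adj G v h ≡ true) → 17 * suc k * n ≤ 3 * suc k * edges G + 3 * n
    hub-case h ch at-h = finish-hub (suc k) n (edges G) loss₀ n₀ DX with-hub (≤-trans (*-monoʳ-≤ (suc k * 12) loss₀≤) small) n₀≤n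
        ([ large , tiny ]′ (≤-total core-size m))
      where
      open WithHub h ch at-h
      n₀≤n : n₀ ≤ n
      n₀≤n = ≤-trans (#-mono {g = λ _ → true} (λ _ _ → refl)) (≤-reflexive (#-all n))
      large : core-size ≤ m → suc k * (4 * n₀) ≤ suc k * (3 * DX) + n
      large p = ≤-trans (core-edges-large n₀ m DX (suc k) (≤-trans (proj₁ core-size-≥) p) (≤-trans (proj₂ core-size-≥) p) core-edges) (+-monoʳ-≤ (suc k * (3 * DX)) n₀≤n)
      tiny : m ≤ core-size → suc k * (4 * n₀) ≤ suc k * (3 * DX) + n
      tiny p = ≤-trans (*-monoʳ-≤ (suc k) (*-monoʳ-≤ 4 (≤-trans n₀≤2^m (^-monoʳ-≤ 2 p)))) (≤-trans (≤-reflexive (≡sym small-core-def)) (≤-trans N≤n (m≤n+m n _)))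

    result : 17 * suc k * n ≤ 3 * suc k * edges G + 3 * n
    result = [ (λ p → finish-no-hub (suc k) n (edges G) (Sc.loss G i) (no-hub p) small) , (λ { (h , ch , at-h) → hub-case h ch at-h }) ]′ hub

  threshold : ℕ
  threshold = Sc.threshold + small-core

  bound : ∀ n → threshold ≤ n → (G : Graph n) → TwinFree G → KSaturated 3 G → 17 * suc k * n ≤ 3 * suc k * edges G + 3 * n
  bound n N≤n G tf sat = [ finish-dense (suc k) n (edges G)
    , (λ few → let i , small = Sc.scale G (≤-trans (m≤m+n Sc.threshold small-core) N≤n) few in result G tf sat i small (≤-trans (m≤n+m small-core Sc.threshold) N≤n)) ]′ (≤-total (6 * n) (edges G))

-- Concatenation of finite sequences

infixr 5 _⊹_
_⊹_ : ∀ {a b} {W : Set} → (Fin a → W) → (Fin b → W) → Fin (a + b) → W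
_⊹_ {a} F H i = [ F , H ]′ (splitAt a i)

⊹-all : ∀ {a b} {W : Set} (P : W → Set) (F : Fin a → W) (H : Fin b → W) → (∀ i → P (F i)) → (∀ j → P (H j)) → ∀ k → P ((F ⊹ H) k)
⊹-all {a} P F H p r k with splitAt a k
... | inj₁ i = p i
... | inj₂ j = r j

⊹-left : ∀ {a b} {W : Set} {u : W} (F : Fin a → W) (H : Fin b → W) → (∃ λ i → F i ≡ u) → ∃ λ k → (F ⊹ H) k ≡ u
⊹-left {a} {b} F H (i , e) = i ↑ˡ b , trans (cong [ F , H ]′ (splitAt-↑ˡ a i b)) e

⊹-right : ∀ {a b} {W : Set} {u : W} (F : Fin a → W) (H : Fin b → W) → (∃ λ j → H j ≡ u) → ∃ λ k → (F ⊹ H) k ≡ u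
⊹-right {a} {b} F H (j , e) = a ↑ʳ j , trans (cong [ F , H ]′ (splitAt-↑ʳ a b j)) e

splitAt-injective : ∀ a {b} (i j : Fin (a + b)) → splitAt a i ≡ splitAt a j → i ≡ j
splitAt-injective a {b} i j e = trans (≡sym (join-splitAt a b i)) (trans (cong (join a b) e) (join-splitAt a b j))

⊹-inj : ∀ {a b} {W : Set} (F : Fin a → W) (H : Fin b → W) → (∀ i j → F i ≡ F j → i ≡ j) → (∀ i j → H i ≡ H j → i ≡ j) →
  (∀ i j → F i ≢ H j) → ∀ k l → (F ⊹ H) k ≡ (F ⊹ H) l → k ≡ l
⊹-inj {a} F H fi hi dj k l e = splitAt-injective a k l (go (splitAt a k) (splitAt a l) e)
  where
  go : ∀ s s′ → [ F , H ]′ s ≡ [ F , H ]′ s′ → s ≡ s′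
  go (inj₁ i) (inj₁ j) e = cong inj₁ (fi i j e)
  go (inj₁ i) (inj₂ j) e = ⊥-elim (dj i j e)
  go (inj₂ i) (inj₁ j) e = ⊥-elim (dj j i (≡sym e))
  go (inj₂ i) (inj₂ j) e = cong inj₂ (hi i j e)

opaque
  unfolding ∑
  sum-split : ∀ a {b} (F : Fin (a + b) → ℕ) → ∑ F ≡ ∑ (λ i → F (i ↑ˡ b)) + ∑ (λ j → F (a ↑ʳ j))
  sum-split zero F = refl
  sum-split (suc a) {b} F = trans (cong (F zero +_) (sum-split a (F ∘ suc))) (≡sym (+-assoc (F zero) _ _))

sum-⊹ : ∀ {a b} {W : Set} (Φ : W → ℕ) (F : Fin a → W) (H : Fin b → W) → ∑ (λ k → Φ ((F ⊹ H) k)) ≡ ∑ (λ i → Φ (F i)) + ∑ (λ j → Φ (H j))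
sum-⊹ {a} {b} Φ F H = trans (sum-split a (λ k → Φ ((F ⊹ H) k))) (cong₂ _+_
  (sum-cong (λ i → cong (λ s → Φ ([ F , H ]′ s)) (splitAt-↑ˡ a i b))) (sum-cong (λ j → cong (λ s → Φ ([ F , H ]′ s)) (splitAt-↑ʳ a b j))))

saturated₃ : ∀ {n} (G : Graph n) → (∀ u w z → adj G u w ≡ true → adj G u z ≡ true → adj G w z ≡ true → ⊥) →
  (∀ u w → u ≢ w → adj G u w ≡ false → ∃ λ t → adj G u t ≡ true × adj G w t ≡ true) → KSaturated 3 G
saturated₃ {n} G tri nbr = (λ { (f , _ , a) → tri (f zero) (f (suc zero)) (f (suc (suc zero))) (a _ _ (λ ())) (a _ _ (λ ())) (a _ _ (λ ())) }) , new
  where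
  new : ∀ u w → u ≢ w → adj G u w ≡ false → ContainsK 3 (addEdge G u w)
  new u w u≢w na with nbr u w u≢w na
  ... | t , ut , wt = F , F-inj , F-adj
    where
    F : Fin 3 → Fin n
    F zero             = u
    F (suc zero)       = w
    F (suc (suc zero)) = t
    old : ∀ {a b} → adj G a b ≡ true → addEdge G u w a b ≡ true
    old = ∨-l
    loop : ∀ a → ¬ adj G a a ≡ true
    loop a p = clash p (irrefl G a)
    flip : ∀ {a b} → adj G a b ≡ true → adj G b a ≡ true
    flip {a} {b} p = trans (sym G b a) p
    F-inj : ∀ {i j} → F i ≡ F j → i ≡ j
    F-inj {zero} {zero} e = refl
    F-inj {zero} {suc zero} e = ⊥-elim (u≢w e)
    F-inj {zero} {suc (suc zero)} refl = ⊥-elim (loop u ut)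
    F-inj {suc zero} {zero} e = ⊥-elim (u≢w (≡sym e))
    F-inj {suc zero} {suc zero} e = refl
    F-inj {suc zero} {suc (suc zero)} refl = ⊥-elim (loop w wt)
    F-inj {suc (suc zero)} {zero} refl = ⊥-elim (loop u ut)
    F-inj {suc (suc zero)} {suc zero} refl = ⊥-elim (loop w wt)
    F-inj {suc (suc zero)} {suc (suc zero)} e = refl
    F-adj : ∀ i j → i ≢ j → addEdge G u w (F i) (F j) ≡ true
    F-adj zero zero q = ⊥-elim (q refl)
    F-adj zero (suc zero) q = ∨-r {adj G u w} (∨-l (∧-i (does-i (u ≟ u) refl) (does-i (w ≟ w) refl)))
    F-adj zero (suc (suc zero)) q = old ut
    F-adj (suc zero) zero q = ∨-r {adj G w u} (∨-r {does (w ≟ u) ∧ does (u ≟ w)} (∧-i (does-i (w ≟ w) refl) (does-i (u ≟ u) refl)))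
    F-adj (suc zero) (suc zero) q = ⊥-elim (q refl)
    F-adj (suc zero) (suc (suc zero)) q = old wt
    F-adj (suc (suc zero)) zero q = old (flip ut)
    F-adj (suc (suc zero)) (suc zero) q = old (flip wt)
    F-adj (suc (suc zero)) (suc (suc zero)) q = ⊥-elim (q refl)

avoid2 : ∀ {m} (i j : Fin (3 + m)) → ∃ λ k → k ≢ i × k ≢ j
avoid2 i j with zero ≟ i | zero ≟ j
... | no p | no q = zero , p , q
... | no p | yes refl with suc zero ≟ i
...   | no r = suc zero , r , λ ()
...   | yes refl = suc (suc zero) , (λ ()) , λ ()
avoid2 i j | yes refl | no q with suc zero ≟ j
...   | no r = suc zero , (λ ()) , r
...   | yes refl = suc (suc zero) , (λ ()) , λ ()
avoid2 i j | yes refl | yes refl = suc zero , (λ ()) , λ ()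

-- The construction. The hub is joined to n - o(n) vertices v t; v t selects a cell x i j of a grid, the
-- row i and the column j, and a pair c true l, c false l of a crown. A cell is joined to the rows and columns
-- not containing it, and c true l to all c false l′ with l′ ≢ l. The four vertices g make sure that grid and crown
-- vertices have common neighbours, so that the set of triples (i , j , l) in use can be almost arbitrary.
module Construction (q₀ m₀ f : ℕ) (iv jv : Fin f → Fin (3 + q₀)) (lv : Fin f → Fin (3 + m₀))
  (iv-lv-inj : ∀ s t → iv s ≡ iv t → jv s ≡ jv t → lv s ≡ lv t → s ≡ t)
  (cell-used : ∀ i j → ∃ λ t → iv t ≡ i × jv t ≡ j)
  (pair-used : ∀ l → ∃ λ t → lv t ≡ l) where

  q m : ℕ
  q = 3 + q₀
  m = 3 + m₀

  data V : Set where
    x   : Fin q → Fin q → V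
    rc  : Bool → Fin q → V
    c   : Bool → Fin m → V
    g   : Bool → Bool → V
    hub : V
    v   : Fin f → V

  -- `rc true k` is row `k` and `rc false k` is column `k`.
  coord : Bool → Fin q → Fin q → Fin q
  coord true  i j = i
  coord false i j = j

  -- Each edge is listed in one direction only. The orientation leaves few cases in the triangle
  -- check, and the edges are later counted at their tails.
  E : V → V → Bool
  E (v t)   (x i j)    = does (i ≟ iv t) ∧ does (j ≟ jv t)
  E (v t)   (rc s k)   = does (k ≟ coord s (iv t) (jv t))
  E (v t)   (c s l)    = does (l ≟ lv t)
  E (v t)   hub        = true
  E (x i j) (rc s k)   = not (does (k ≟ coord s i j))
  E (c s l) (c s′ l′)  = (s ∧ not s′) ∧ not (does (l ≟ l′))
  E (g σ τ) (x i j)    = σ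
  E (g σ τ) (rc s k)   = not σ
  E (g σ τ) (c s l)    = does (s ≟ᵇ τ)
  E (g σ τ) hub        = true
  E _       _          = false

  A : V → V → Bool
  A u w = E u w ∨ E w u

  A-sym : ∀ u w → A u w ≡ A w u
  A-sym u w = ∨-comm (E u w) (E w u)
    where open import Data.Bool.Properties using (∨-comm)

  E-irr : ∀ u → E u u ≡ false
  E-irr (x i j) = refl
  E-irr (rc s k) = refl
  E-irr (c true l) = refl
  E-irr (c false l) = refl
  E-irr (g σ τ) = refl
  E-irr hub = refl
  E-irr (v t) = refl

  A-irr : ∀ u → A u u ≡ false
  A-irr u rewrite E-irr u = refl

  infix 4 _—_ _—̸_
  _—_ _—̸_ : V → V → Set
  u — w = A u w ≡ true
  u —̸ w = A u w ≡ false

  into-v : ∀ u {t} → E u (v t) ≡ true → ⊥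
  into-v (x i j) ()
  into-v (rc s k) ()
  into-v (c s l) ()
  into-v (g σ τ) ()
  into-v hub ()
  into-v (v t) ()

  into-g : ∀ u {σ τ} → E u (g σ τ) ≡ true → ⊥
  into-g (x i j) ()
  into-g (rc s k) ()
  into-g (c s l) ()
  into-g (g σ τ) ()
  into-g hub ()
  into-g (v t) ()

  out-x : ∀ {i j} z → E (x i j) z ≡ true → ∃ λ s → ∃ λ k → z ≡ rc s k × k ≢ coord s i j
  out-x (x _ _) ()
  out-x {i} {j} (rc s k) p = s , k , refl , does-ne (k ≟ coord s i j) (not-e p)
  out-x (c s l) ()
  out-x (g σ τ) ()
  out-x hub ()
  out-x (v t) ()

  out-c : ∀ {s l} z → E (c s l) z ≡ true → ∃ λ l′ → s ≡ true × z ≡ c false l′ × l ≢ l′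
  out-c (x i j) ()
  out-c (rc s k) ()
  out-c {true} {l} (c true l′) ()
  out-c {true} {l} (c false l′) p = l′ , refl , refl , does-ne (l ≟ l′) (not-e p)
  out-c {false} {l} (c s′ l′) ()
  out-c (g σ τ) ()
  out-c hub ()
  out-c (v t) ()

  -- `w` has both an incoming and an outgoing edge, so it is a cell or on the `true` side of the
  -- crown, and its successor is a line of the grid or on the `false` side.
  transitive : ∀ u w z → E u w ≡ true → E u z ≡ true → E w z ≡ true → ⊥
  transitive u (rc s k) z p r ()
  transitive u hub z p r ()
  transitive u (v t) z p r _ = into-v u p
  transitive u (g σ τ) z p r _ = into-g u p
  transitive u (x i j) z p r w→z with out-x z w→z
  transitive (x _ _) (x i j) z () r w→z | s , k , refl , ne
  transitive (rc _ _) (x i j) z () r w→z | s , k , refl , ne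
  transitive (c _ _) (x i j) z () r w→z | s , k , refl , ne
  transitive hub (x i j) z () r w→z | s , k , refl , ne
  transitive (g true τ) (x i j) z p () w→z | s , k , refl , ne
  transitive (g false τ) (x i j) z () r w→z | s , k , refl , ne
  transitive (v t) (x i j) z p r w→z | s , k , refl , ne
    with does-e (i ≟ iv t) (∧-l p) | does-e (j ≟ jv t) (∧-r {does (i ≟ iv t)} p) | does-e (k ≟ coord s (iv t) (jv t)) r
  ... | refl | refl | refl = ne refl
  transitive u (c s l) z p r w→z with out-c z w→z
  transitive (x _ _) (c s l) z () r w→z | l′ , refl , refl , ne
  transitive (rc _ _) (c s l) z () r w→z | l′ , refl , refl , ne
  transitive hub (c s l) z () r w→z | l′ , refl , refl , ne
  transitive (c true _) (c s l) z () r w→z | l′ , refl , refl , ne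
  transitive (c false _) (c s l) z () r w→z | l′ , refl , refl , ne
  transitive (g σ true) (c s l) z p () w→z | l′ , refl , refl , ne
  transitive (g σ false) (c s l) z () r w→z | l′ , refl , refl , ne
  transitive (v t) (c s l) z p r w→z | l′ , refl , refl , ne = ne (trans (does-e (l ≟ lv t) p) (≡sym (does-e (l′ ≟ lv t) r)))

  cyclic : ∀ u w z → E u w ≡ true → E w z ≡ true → E z u ≡ true → ⊥
  cyclic u (rc s k) z p () r
  cyclic u hub z p () r
  cyclic u (v t) z p w→z r = into-v u p
  cyclic u (g σ τ) z p w→z r = into-g u p
  cyclic u (x i j) z p w→z r with out-x z w→z
  cyclic u (x i j) z p w→z () | s , k , refl , ne
  cyclic u (c s l) z p w→z r with out-c z w→z
  ... | l′ , refl , refl , ne with out-c u r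
  ...   | _ , () , _

  triangle-free : ∀ u w z → u — w → u — z → w — z → ⊥
  triangle-free u w z uw uz wz with ∨-e {E u w} uw | ∨-e {E u z} uz | ∨-e {E w z} wz
  ... | inj₁ a | inj₁ b | inj₁ d = transitive u w z a b d
  ... | inj₁ a | inj₁ b | inj₂ d = transitive u z w b a d
  ... | inj₁ a | inj₂ b | inj₁ d = cyclic u w z a d b
  ... | inj₁ a | inj₂ b | inj₂ d = transitive z u w b d a
  ... | inj₂ a | inj₁ b | inj₁ d = transitive w u z a d b
  ... | inj₂ a | inj₁ b | inj₂ d = cyclic w u z a b d
  ... | inj₂ a | inj₂ b | inj₁ d = transitive w z u d a b
  ... | inj₂ a | inj₂ b | inj₂ d = transitive z w u d b a

  x-rc : ∀ i j {s k} → k ≢ coord s i j → x i j — rc s k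
  x-rc i j {s} {k} p = ∨-l (not-i (does-ni (k ≟ coord s i j) p))

  rc-x : ∀ i j {s k} → k ≢ coord s i j → rc s k — x i j
  rc-x i j {s} {k} p = not-i (does-ni (k ≟ coord s i j) p)

  v-x : ∀ {i j t} → iv t ≡ i → jv t ≡ j → v t — x i j
  v-x {i} {j} {t} p r = ∨-l (∧-i (does-i (i ≟ iv t) (≡sym p)) (does-i (j ≟ jv t) (≡sym r)))

  x-v : ∀ {i j t} → iv t ≡ i → jv t ≡ j → x i j — v t
  x-v {i} {j} {t} p r = ∧-i (does-i (i ≟ iv t) (≡sym p)) (does-i (j ≟ jv t) (≡sym r))

  v-rc : ∀ {s k t} → k ≡ coord s (iv t) (jv t) → v t — rc s k
  v-rc {s} {k} {t} p = ∨-l (does-i (k ≟ coord s (iv t) (jv t)) p)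

  rc-v : ∀ {s k t} → k ≡ coord s (iv t) (jv t) → rc s k — v t
  rc-v {s} {k} {t} p = does-i (k ≟ coord s (iv t) (jv t)) p

  v-c : ∀ {s l t} → l ≡ lv t → v t — c s l
  v-c {s} {l} {t} p = ∨-l (does-i (l ≟ lv t) p)

  c-v : ∀ {s l t} → l ≡ lv t → c s l — v t
  c-v {s} {l} {t} p = does-i (l ≟ lv t) p

  c-c : ∀ s {l l′} → l ≢ l′ → c s l — c (not s) l′
  c-c true  {l} {l′} p = ∨-l (not-i (does-ni (l ≟ l′) p))
  c-c false {l} {l′} p = not-i (does-ni (l′ ≟ l) (p ∘ ≡sym))

  c-c-same : ∀ s l → c s l —̸ c (not s) l
  c-c-same true  l rewrite does-i (l ≟ l) refl = refl
  c-c-same false l rewrite does-i (l ≟ l) refl = refl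

  g-c : ∀ σ τ l → g σ τ — c τ l
  g-c σ τ l = ∨-l (does-i (τ ≟ᵇ τ) refl)

  c-g : ∀ σ τ l → c τ l — g σ τ
  c-g σ τ l = does-i (τ ≟ᵇ τ) refl

  Common : V → V → Set
  Common u w = ∃ λ t → u — t × w — t

  flipC : ∀ u w → Common u w → Common w u
  flipC u w (t , p , r) = t , r , p

  —̸-sym : ∀ u w → u —̸ w → w —̸ u
  —̸-sym u w p = trans (A-sym w u) p

  coord-diag : ∀ s k → coord s k k ≡ k
  coord-diag true  k = refl
  coord-diag false k = refl

  near-x-rc : ∀ {i j s k} → x i j —̸ rc s k → Common (x i j) (rc s k)
  near-x-rc {i} {j} {s} {k} p with k ≟ coord s i j | cell-used i j
  ... | yes refl | t , refl , refl = v t , x-v {t = t} refl refl , rc-v {s} {_} {t} refl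

  near-x-v : ∀ {i j t} → x i j —̸ v t → Common (x i j) (v t)
  near-x-v {i} {j} {t} p with iv t ≟ i | jv t ≟ j
  ... | no a | _ = rc true (iv t) , x-rc i j {s = true} a , v-rc {true} {t = t} refl
  ... | yes _ | no b = rc false (jv t) , x-rc i j {s = false} b , v-rc {false} {t = t} refl
  ... | yes a | yes b = ⊥-elim (clash (x-v {t = t} a b) p)

  near-rc-rc : ∀ {s k s′ k′} → Common (rc s k) (rc s′ k′)
  near-rc-rc {s} {k} {s′} {k′} = let i , p , r = avoid2 k k′ in
    x i i , rc-x i i {s = s} (λ e → p (≡sym (trans e (coord-diag s i)))) , rc-x i i {s = s′} (λ e → r (≡sym (trans e (coord-diag s′ i))))

  other : ∀ {a b} → a ≢ b → not a ≡ b
  other {true}  {true}  p = ⊥-elim (p refl)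
  other {true}  {false} p = refl
  other {false} {true}  p = refl
  other {false} {false} p = ⊥-elim (p refl)

  near-c-c : ∀ {s l s′ l′} → c s l —̸ c s′ l′ → Common (c s l) (c s′ l′)
  near-c-c {s} {l} {s′} {l′} p = sides (s ≟ᵇ s′)
    where
    opposite : s ≢ s′ → Dec (l ≡ l′) → Common (c s l) (c s′ l′)
    opposite ne (yes e) = let t , et = pair-used l in v t , c-v {s} {t = t} (≡sym et) , c-v {s′} {t = t} (≡sym (trans et e))
    opposite ne (no nl) = ⊥-elim (clash (subst (λ z → c s l — c z l′) (other ne) (c-c s nl)) p)
    sides : Dec (s ≡ s′) → Common (c s l) (c s′ l′)
    sides (yes refl) = let k , a , b = avoid2 l l′ in c (not s) k , c-c s (a ∘ ≡sym) , c-c s (b ∘ ≡sym)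
    sides (no ne) = opposite ne (l ≟ l′)

  near-c-g : ∀ {s l σ τ} → c s l —̸ g σ τ → Common (c s l) (g σ τ)
  near-c-g {true}  {l} {σ} {true}  ()
  near-c-g {true}  {l} {σ} {false} p = let k , a , _ = avoid2 l l in c false k , c-c true (a ∘ ≡sym) , g-c σ false k
  near-c-g {false} {l} {σ} {true}  p = let k , a , _ = avoid2 l l in c true k , c-c false (a ∘ ≡sym) , g-c σ true k
  near-c-g {false} {l} {σ} {false} ()

  near-c-v : ∀ {s l t} → c s l —̸ v t → Common (c s l) (v t)
  near-c-v {s} {l} {t} p with l ≟ lv t
  ... | no ne = c (not s) (lv t) , c-c s ne , v-c {not s} {t = t} refl

  near-x-g : ∀ {i j σ τ} → x i j —̸ g σ τ → Common (x i j) (g σ τ)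
  near-x-g {i} {j} {false} p = let k , a , _ = avoid2 i i in rc true k , x-rc i j {s = true} a , refl

  near-rc-g : ∀ {s k σ τ} → rc s k —̸ g σ τ → Common (rc s k) (g σ τ)
  near-rc-g {s} {k} {true} p = let i , a , _ = avoid2 k k in x i i , rc-x i i {s = s} (λ e → a (≡sym (trans e (coord-diag s i)))) , refl

  near-rc-v : ∀ {s k t} → rc s k —̸ v t → Common (rc s k) (v t)
  near-rc-v {s} {k} {t} p with k ≟ coord s (iv t) (jv t)
  ... | no ne = x (iv t) (jv t) , rc-x (iv t) (jv t) {s = s} ne , v-x {t = t} refl refl

  -- Grid and crown meet through the vertices `g`. A cell and a line through it meet in some `v t`
  -- on that cell, and `c true l` and `c false l` in some `v t` selecting `l`; this is what
  -- `cell-used` and `pair-used` are for.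
  near : ∀ u w → u —̸ w → Common u w
  near (x i j) (x i′ j′) p = let k , a , b = avoid2 i i′ in rc true k , x-rc i j {s = true} a , x-rc i′ j′ {s = true} b
  near (x i j) (rc s k) p = near-x-rc p
  near (x i j) (c s l) p = g true s , refl , c-g true s l
  near (x i j) (g σ τ) p = near-x-g p
  near (x i j) hub p = g true true , refl , refl
  near (x i j) (v t) p = near-x-v {t = t} p
  near (rc s k) (x i j) p = flipC (x i j) (rc s k) (near-x-rc (—̸-sym (rc s k) (x i j) p))
  near (rc s k) (rc s′ k′) p = near-rc-rc
  near (rc s k) (c s′ l) p = g false s′ , refl , c-g false s′ l
  near (rc s k) (g σ τ) p = near-rc-g {s} {k} {σ} {τ} p
  near (rc s k) hub p = g false true , refl , refl
  near (rc s k) (v t) p = near-rc-v {s} {k} {t} p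
  near (c s l) (x i j) p = g true s , c-g true s l , refl
  near (c s l) (rc s′ k) p = g false s , c-g false s l , refl
  near (c s l) (c s′ l′) p = near-c-c p
  near (c s l) (g σ τ) p = near-c-g {s} {l} {σ} {τ} p
  near (c s l) hub p = g true s , c-g true s l , refl
  near (c s l) (v t) p = near-c-v {s} {l} {t} p
  near (g σ τ) (x i j) p = flipC (x i j) (g σ τ) (near-x-g (—̸-sym (g σ τ) (x i j) p))
  near (g σ τ) (rc s k) p = flipC (rc s k) (g σ τ) (near-rc-g {s} {k} {σ} {τ} (—̸-sym (g σ τ) (rc s k) p))
  near (g σ τ) (c s l) p = flipC (c s l) (g σ τ) (near-c-g {s} {l} {σ} {τ} (—̸-sym (g σ τ) (c s l) p))
  near (g σ τ) (g σ′ τ′) p = hub , refl , refl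
  near (g σ τ) (v t) p = hub , refl , refl
  near hub (x i j) p = g true true , refl , refl
  near hub (rc s k) p = g false true , refl , refl
  near hub (c s l) p = g true s , refl , c-g true s l
  near hub hub p = g true true , refl , refl
  near (v t) (x i j) p = flipC (x i j) (v t) (near-x-v {t = t} (—̸-sym (v t) (x i j) p))
  near (v t) (rc s k) p = flipC (rc s k) (v t) (near-rc-v {s} {k} {t} (—̸-sym (v t) (rc s k) p))
  near (v t) (c s l) p = flipC (c s l) (v t) (near-c-v {s} {l} {t} (—̸-sym (v t) (c s l) p))
  near (v t) (g σ τ) p = hub , refl , refl
  near (v t) (v t′) p = hub , refl , refl

  Twin : V → V → Set
  Twin u w = ∀ z → A u z ≡ A w z

  not-twin : ∀ {u w} z → u — z → w —̸ z → ¬ Twin u w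
  not-twin z p r T = clash (trans (≡sym (T z)) p) r

  not-twin′ : ∀ {u w} z → u —̸ z → w — z → ¬ Twin u w
  not-twin′ z p r T = clash (trans (T z) r) p

  x≁rc : ∀ s i j → x i j —̸ rc s (coord s i j)
  x≁rc s i j rewrite does-i (coord s i j ≟ coord s i j) refl = refl

  rc≁x : ∀ s i j {k} → k ≡ coord s i j → rc s k —̸ x i j
  rc≁x s i j {k} e rewrite does-i (k ≟ coord s i j) e = refl

  c≁g : ∀ s σ l → c s l —̸ g σ (not s)
  c≁g true  σ l = refl
  c≁g false σ l = refl

  g≁c : ∀ σ τ l → g σ τ —̸ c (not τ) l
  g≁c σ true  l = refl
  g≁c σ false l = refl

  twins⇒≡ : ∀ u w → Twin u w → u ≡ w
  twins⇒≡ (x i j) (x i′ j′) T with i ≟ i′ | j ≟ j′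
  ... | yes refl | yes refl = refl
  ... | no p | _ = ⊥-elim (not-twin′ {x i j} {x i′ j′} (rc true i) (x≁rc true i j) (x-rc i′ j′ {s = true} p) T)
  ... | yes _ | no p = ⊥-elim (not-twin′ {x i j} {x i′ j′} (rc false j) (x≁rc false i j) (x-rc i′ j′ {s = false} p) T)
  twins⇒≡ (x i j) (rc s k) T = ⊥-elim (not-twin {x i j} {rc s k} (g true true) refl refl T)
  twins⇒≡ (x i j) (c s l) T = ⊥-elim (not-twin {x i j} {c s l} (g true (not s)) refl (c≁g s true l) T)
  twins⇒≡ (x i j) (g σ τ) T = ⊥-elim (not-twin′ {x i j} {g σ τ} hub refl refl T)
  twins⇒≡ (x i j) hub T = ⊥-elim (not-twin′ {x i j} {hub} (g false true) refl refl T)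
  twins⇒≡ (x i j) (v t) T = ⊥-elim (not-twin′ {x i j} {v t} hub refl refl T)
  twins⇒≡ (rc s k) (x i j) T = ⊥-elim (not-twin′ {rc s k} {x i j} (g true true) refl refl T)
  twins⇒≡ (rc true k) (rc true k′) T with k ≟ k′
  ... | yes refl = refl
  ... | no p = ⊥-elim (not-twin′ {rc true k} {rc true k′} (x k k) (rc≁x true k k refl) (rc-x k k {s = true} (p ∘ ≡sym)) T)
  twins⇒≡ (rc false k) (rc false k′) T with k ≟ k′
  ... | yes refl = refl
  ... | no p = ⊥-elim (not-twin′ {rc false k} {rc false k′} (x k k) (rc≁x false k k refl) (rc-x k k {s = false} (p ∘ ≡sym)) T)
  twins⇒≡ (rc true k) (rc false k′) T = let i , a , _ = avoid2 k′ k′ in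
    ⊥-elim (not-twin′ {rc true k} {rc false k′} (x k i) (rc≁x true k i refl) (rc-x k i {s = false} (a ∘ ≡sym)) T)
  twins⇒≡ (rc false k) (rc true k′) T = let i , a , _ = avoid2 k′ k′ in
    ⊥-elim (not-twin′ {rc false k} {rc true k′} (x i k) (rc≁x false i k refl) (rc-x i k {s = true} (a ∘ ≡sym)) T)
  twins⇒≡ (rc s k) (c s′ l) T = ⊥-elim (not-twin {rc s k} {c s′ l} (g false (not s′)) refl (c≁g s′ false l) T)
  twins⇒≡ (rc s k) (g σ τ) T = ⊥-elim (not-twin′ {rc s k} {g σ τ} hub refl refl T)
  twins⇒≡ (rc s k) hub T = ⊥-elim (not-twin′ {rc s k} {hub} (g true true) refl refl T)
  twins⇒≡ (rc s k) (v t) T = ⊥-elim (not-twin′ {rc s k} {v t} hub refl refl T)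
  twins⇒≡ (c s l) (x i j) T = ⊥-elim (not-twin′ {c s l} {x i j} (g true (not s)) (c≁g s true l) refl T)
  twins⇒≡ (c s l) (rc s′ k) T = ⊥-elim (not-twin′ {c s l} {rc s′ k} (g false (not s)) (c≁g s false l) refl T)
  twins⇒≡ (c true l) (c false l′) T = ⊥-elim (not-twin {c true l} {c false l′} (g true true) refl refl T)
  twins⇒≡ (c false l) (c true l′) T = ⊥-elim (not-twin′ {c false l} {c true l′} (g true true) refl refl T)
  twins⇒≡ (c true l) (c true l′) T with l ≟ l′
  ... | yes refl = refl
  ... | no p = ⊥-elim (not-twin′ {c true l} {c true l′} (c false l) (c-c-same true l) (c-c true (p ∘ ≡sym)) T)
  twins⇒≡ (c false l) (c false l′) T with l ≟ l′
  ... | yes refl = refl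
  ... | no p = ⊥-elim (not-twin′ {c false l} {c false l′} (c true l) (c-c-same false l) (c-c false (p ∘ ≡sym)) T)
  twins⇒≡ (c s l) (g σ τ) T = ⊥-elim (not-twin′ {c s l} {g σ τ} hub refl refl T)
  twins⇒≡ (c s l) hub T = ⊥-elim (not-twin′ {c s l} {hub} (g true (not s)) (c≁g s true l) refl T)
  twins⇒≡ (c s l) (v t) T = ⊥-elim (not-twin′ {c s l} {v t} hub refl refl T)
  twins⇒≡ (g σ τ) (x i j) T = ⊥-elim (not-twin {g σ τ} {x i j} hub refl refl T)
  twins⇒≡ (g σ τ) (rc s k) T = ⊥-elim (not-twin {g σ τ} {rc s k} hub refl refl T)
  twins⇒≡ (g σ τ) (c s l) T = ⊥-elim (not-twin {g σ τ} {c s l} hub refl refl T)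
  twins⇒≡ (g σ τ) (g σ′ τ′) T = cong₂ g (trans (≡sym (∨-identityʳ σ)) (trans (T (x zero zero)) (∨-identityʳ σ′))) (same-τ τ τ′ (T (c true zero)))
    where
    same-τ : ∀ τ τ′ → A (g σ τ) (c true zero) ≡ A (g σ′ τ′) (c true zero) → τ ≡ τ′
    same-τ true  true  e = refl
    same-τ true  false ()
    same-τ false true  ()
    same-τ false false e = refl
  twins⇒≡ (g σ τ) hub T = ⊥-elim (not-twin {g σ τ} {hub} hub refl refl T)
  twins⇒≡ (g σ τ) (v t) T = ⊥-elim (not-twin′ {g σ τ} {v t} (c (not τ) (lv t)) (g≁c σ τ (lv t)) (v-c {not τ} {t = t} refl) T)
  twins⇒≡ hub (x i j) T = ⊥-elim (not-twin {hub} {x i j} (g false true) refl refl T)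
  twins⇒≡ hub (rc s k) T = ⊥-elim (not-twin {hub} {rc s k} (g true true) refl refl T)
  twins⇒≡ hub (c s l) T = ⊥-elim (not-twin {hub} {c s l} (g true (not s)) refl (c≁g s true l) T)
  twins⇒≡ hub (g σ τ) T = ⊥-elim (not-twin′ {hub} {g σ τ} hub refl refl T)
  twins⇒≡ hub hub T = refl
  twins⇒≡ hub (v t) T = ⊥-elim (not-twin′ {hub} {v t} hub refl refl T)
  twins⇒≡ (v t) (x i j) T = ⊥-elim (not-twin {v t} {x i j} hub refl refl T)
  twins⇒≡ (v t) (rc s k) T = ⊥-elim (not-twin {v t} {rc s k} hub refl refl T)
  twins⇒≡ (v t) (c s l) T = ⊥-elim (not-twin {v t} {c s l} hub refl refl T)
  twins⇒≡ (v t) (g σ τ) T = ⊥-elim (not-twin {v t} {g σ τ} (c (not τ) (lv t)) (v-c {not τ} {t = t} refl) (g≁c σ τ (lv t)) T)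
  twins⇒≡ (v t) hub T = ⊥-elim (not-twin {v t} {hub} hub refl refl T)
  twins⇒≡ (v t) (v t′) T = cong v (iv-lv-inj t t′ (from-rc true) (from-rc false)
      (does-e (lv t ≟ lv t′) (trans (≡sym (∨-identityʳ _)) (trans (≡sym (T (c true (lv t)))) (v-c {true} {t = t} refl)))))
    where
    from-rc : ∀ s → coord s (iv t) (jv t) ≡ coord s (iv t′) (jv t′)
    from-rc s = does-e (coord s (iv t) (jv t) ≟ coord s (iv t′) (jv t′)) (trans (≡sym (∨-identityʳ _)) (trans (≡sym (T (rc s (coord s (iv t) (jv t))))) (v-rc {s} {t = t} refl)))

  xd : Fin (q * q) → V
  xd p = x (proj₁ (remQuot {q} q p)) (proj₂ (remQuot {q} q p))

  gd : Fin 4 → V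
  gd zero                   = g true true
  gd (suc zero)             = g true false
  gd (suc (suc zero))       = g false true
  gd (suc (suc (suc zero))) = g false false

  rd : Fin (q + q) → V
  rd = rc true ⊹ rc false

  cd : Fin (m + m) → V
  cd = c true ⊹ c false

  hd : Fin 1 → V
  hd _ = hub

  size : ℕ
  size = q * q + ((q + q) + ((m + m) + (4 + (1 + f))))

  dec₅ : Fin (1 + f) → V
  dec₅ = hd ⊹ v
  dec₄ : Fin (4 + (1 + f)) → V
  dec₄ = gd ⊹ dec₅
  dec₃ : Fin ((m + m) + (4 + (1 + f))) → V
  dec₃ = cd ⊹ dec₄
  dec₂ : Fin ((q + q) + ((m + m) + (4 + (1 + f)))) → V
  dec₂ = rd ⊹ dec₃
  dec : Fin size → V
  dec = xd ⊹ dec₂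

  -- The position of a block in the enumeration, used to keep the blocks apart.
  tag : V → ℕ
  tag (x _ _)  = 0
  tag (rc _ _) = 1
  tag (c _ _)  = 2
  tag (g _ _)  = 3
  tag hub      = 4
  tag (v _)    = 5

  tag₅ : ∀ j → 4 ≤ tag (dec₅ j)
  tag₅ = ⊹-all (λ w → 4 ≤ tag w) hd v (λ _ → ≤-refl) (λ _ → n≤1+n 4)
  tag₄ : ∀ j → 3 ≤ tag (dec₄ j)
  tag₄ = ⊹-all (λ w → 3 ≤ tag w) gd dec₅ tg (λ j → ≤-trans (n≤1+n 3) (tag₅ j))
    where
    tg : ∀ i → 3 ≤ tag (gd i)
    tg zero = ≤-refl
    tg (suc zero) = ≤-refl
    tg (suc (suc zero)) = ≤-refl
    tg (suc (suc (suc zero))) = ≤-refl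
  tag₃ : ∀ j → 2 ≤ tag (dec₃ j)
  tag₃ = ⊹-all (λ w → 2 ≤ tag w) cd dec₄ (⊹-all (λ w → 2 ≤ tag w) (c true) (c false) (λ _ → ≤-refl) (λ _ → ≤-refl)) (λ j → ≤-trans (n≤1+n 2) (tag₄ j))
  tag₂ : ∀ j → 1 ≤ tag (dec₂ j)
  tag₂ = ⊹-all (λ w → 1 ≤ tag w) rd dec₃ (⊹-all (λ w → 1 ≤ tag w) (rc true) (rc false) (λ _ → ≤-refl) (λ _ → ≤-refl)) (λ j → ≤-trans (n≤1+n 1) (tag₃ j))

  apart : ∀ {a b k} {F : Fin a → V} {H : Fin b → V} → (∀ i → tag (F i) ≤ k) → (∀ j → suc k ≤ tag (H j)) → ∀ i j → F i ≢ H j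
  apart lo hi i j e = <⇒≱ (hi j) (≤-trans (≤-reflexive (cong tag (≡sym e))) (lo i))

  dec-inj : ∀ i j → dec i ≡ dec j → i ≡ j
  dec-inj = ⊹-inj xd dec₂ xd-inj (⊹-inj rd dec₃ (⊹-inj (rc true) (rc false) (λ { _ _ refl → refl }) (λ { _ _ refl → refl }) (λ _ _ ()))
      (⊹-inj cd dec₄ (⊹-inj (c true) (c false) (λ { _ _ refl → refl }) (λ { _ _ refl → refl }) (λ _ _ ()))
        (⊹-inj gd dec₅ gd-inj (⊹-inj hd v (λ { zero zero _ → refl }) (λ { _ _ refl → refl }) (λ _ _ ()))
          (apart tg tag₅)) (apart (⊹-all (λ w → tag w ≤ 2) (c true) (c false) (λ _ → ≤-refl) (λ _ → ≤-refl)) tag₄))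
        (apart (⊹-all (λ w → tag w ≤ 1) (rc true) (rc false) (λ _ → ≤-refl) (λ _ → ≤-refl)) tag₃)) (apart (λ _ → ≤-refl) tag₂)
    where
    x-i : ∀ {i j i′ j′} → x i j ≡ x i′ j′ → i ≡ i′ × j ≡ j′
    x-i refl = refl , refl
    xd-inj : ∀ p p′ → xd p ≡ xd p′ → p ≡ p′
    xd-inj p p′ e = trans (≡sym (combine-remQuot {q} q p)) (trans (cong₂ combine (proj₁ (x-i e)) (proj₂ (x-i e))) (combine-remQuot {q} q p′))
    tg : ∀ i → tag (gd i) ≤ 3
    tg zero = ≤-refl
    tg (suc zero) = ≤-refl
    tg (suc (suc zero)) = ≤-refl
    tg (suc (suc (suc zero))) = ≤-refl
    ge : V → Fin 4
    ge (g true true)  = zero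
    ge (g true false) = suc zero
    ge (g false true) = suc (suc zero)
    ge _              = suc (suc (suc zero))
    ge-gd : ∀ i → ge (gd i) ≡ i
    ge-gd zero = refl
    ge-gd (suc zero) = refl
    ge-gd (suc (suc zero)) = refl
    ge-gd (suc (suc (suc zero))) = refl
    gd-inj : ∀ i j → gd i ≡ gd j → i ≡ j
    gd-inj i j e = trans (≡sym (ge-gd i)) (trans (cong ge e) (ge-gd j))

  Hit : ∀ {a} → (Fin a → V) → V → Set
  Hit F u = ∃ λ i → F i ≡ u

  dec-onto : ∀ u → Hit dec u
  dec-onto (x i j) = ⊹-left xd dec₂ (combine i j , cong₂ x (cong proj₁ (remQuot-combine i j)) (cong proj₂ (remQuot-combine i j)))
  dec-onto (rc true k) = ⊹-right xd dec₂ (⊹-left rd dec₃ (⊹-left (rc true) (rc false) (k , refl)))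
  dec-onto (rc false k) = ⊹-right xd dec₂ (⊹-left rd dec₃ (⊹-right (rc true) (rc false) (k , refl)))
  dec-onto (c true l) = ⊹-right xd dec₂ (⊹-right rd dec₃ (⊹-left cd dec₄ (⊹-left (c true) (c false) (l , refl))))
  dec-onto (c false l) = ⊹-right xd dec₂ (⊹-right rd dec₃ (⊹-left cd dec₄ (⊹-right (c true) (c false) (l , refl))))
  dec-onto (g σ τ) = ⊹-right xd dec₂ (⊹-right rd dec₃ (⊹-right cd dec₄ (⊹-left gd dec₅ (gs σ τ))))
    where
    gs : ∀ σ τ → Hit gd (g σ τ)
    gs true  true  = zero , refl
    gs true  false = suc zero , refl
    gs false true  = suc (suc zero) , refl
    gs false false = suc (suc (suc zero)) , refl
  dec-onto hub = ⊹-right xd dec₂ (⊹-right rd dec₃ (⊹-right cd dec₄ (⊹-right gd dec₅ (⊹-left hd v (zero , refl)))))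
  dec-onto (v t) = ⊹-right xd dec₂ (⊹-right rd dec₃ (⊹-right cd dec₄ (⊹-right gd dec₅ (⊹-right hd v (t , refl)))))

  graph : Graph size
  graph = record { adj = λ i j → A (dec i) (dec j) ; sym = λ i j → A-sym (dec i) (dec j) ; irrefl = λ i → A-irr (dec i) }

  twin-free : TwinFree graph
  twin-free i j (i≢j , T) = i≢j (dec-inj i j (twins⇒≡ (dec i) (dec j) T′))
    where
    T′ : Twin (dec i) (dec j)
    T′ z = let k , e = dec-onto z in subst (λ z → A (dec i) z ≡ A (dec j) z) e (T k)

  saturated : KSaturated 3 graph
  saturated = saturated₃ graph (λ u w z → triangle-free (dec u) (dec w) (dec z)) nbr
    where
    nbr : ∀ u w → u ≢ w → adj graph u w ≡ false → ∃ λ t → adj graph u t ≡ true × adj graph w t ≡ true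
    nbr u w _ p = let z , a , b = near (dec u) (dec w) p
                      k , e = dec-onto z
                  in k , subst (λ z → A (dec u) z ≡ true) (≡sym e) a , subst (λ z → A (dec w) z ≡ true) (≡sym e) b

  sum-V : ∀ (F : V → ℕ) → ∑ (λ i → F (dec i)) ≡
    ∑ (λ p → F (xd p)) + (∑ (λ k → F (rd k)) + (∑ (λ l → F (cd l)) + (∑ (λ i → F (gd i)) + (∑ (λ i → F (hd i)) + ∑ (λ t → F (v t))))))
  sum-V F = trans (sum-⊹ F xd dec₂) (cong (∑ (λ p → F (xd p)) +_) (trans (sum-⊹ F rd dec₃) (cong (∑ (λ k → F (rd k)) +_)
    (trans (sum-⊹ F cd dec₄) (cong (∑ (λ l → F (cd l)) +_) (trans (sum-⊹ F gd dec₅) (cong (∑ (λ i → F (gd i)) +_) (sum-⊹ F hd v))))))))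

  out : V → ℕ
  out u = ∑ (λ j → ind (E u (dec j)))

  edges≤ : edges graph ≤ ∑ (λ i → out (dec i))
  edges≤ = halve (begin
    edges graph + edges graph                                    ≡⟨ Degrees.handshake graph ⟩
    ∑ (λ i → ∑ (λ j → ind (A (dec i) (dec j))))                  ≤⟨ sum-mono (λ i → sum-mono (λ j → ∨-sum (E (dec i) (dec j)) (E (dec j) (dec i)))) ⟩
    ∑ (λ i → ∑ (λ j → ε i j + ε j i))                            ≡⟨ sum-cong (λ i → sum-+ _ _) ⟩
    ∑ (λ i → ∑ (λ j → ε i j) + ∑ (λ j → ε j i))                  ≡⟨ sum-+ _ _ ⟩
    ∑ (λ i → ∑ (λ j → ε i j)) + ∑ (λ i → ∑ (λ j → ε j i))        ≡⟨ cong (∑ (λ i → ∑ (λ j → ε i j)) +_) (sum-swap (λ i j → ε j i)) ⟩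
    ∑ (λ i → out (dec i)) + ∑ (λ i → out (dec i))                ∎)
    where
    open ≤-Reasoning
    ε : Fin size → Fin size → ℕ
    ε i j = ind (E (dec i) (dec j))
    ∨-sum : ∀ a b → ind (a ∨ b) ≤ ind a + ind b
    ∨-sum true  b = s≤s z≤n
    ∨-sum false b = ≤-refl

  core : ℕ
  core = q * q + ((q + q) + ((m + m) + 1))

  blocks : ∀ u {a₁ a₂ a₃ a₄ a₅ a₆} → ∑ (λ p → ind (E u (xd p))) ≤ a₁ → ∑ (λ k → ind (E u (rd k))) ≤ a₂ → ∑ (λ l → ind (E u (cd l))) ≤ a₃ →
    ∑ (λ i → ind (E u (gd i))) ≤ a₄ → ∑ (λ i → ind (E u (hd i))) ≤ a₅ → ∑ (λ t → ind (E u (v t))) ≤ a₆ →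
    out u ≤ a₁ + (a₂ + (a₃ + (a₄ + (a₅ + a₆))))
  blocks u b₁ b₂ b₃ b₄ b₅ b₆ = ≤-trans (≤-reflexive (sum-V (λ w → ind (E u w)))) (+-mono-≤ b₁ (+-mono-≤ b₂ (+-mono-≤ b₃ (+-mono-≤ b₄ (+-mono-≤ b₅ b₆)))))

  none : ∀ {a} {F : Fin a → Bool} → (∀ i → F i ≡ false) → ∑ (λ i → ind (F i)) ≤ 0
  none {a} h = ≤-reflexive (trans (sum-cong (λ i → cong ind (h i))) (trans (sum-const a 0) (*-zeroʳ a)))

  all≤ : ∀ {a} (F : Fin a → Bool) → ∑ (λ i → ind (F i)) ≤ a
  all≤ {a} F = ≤-trans (sum-mono (λ i → ind-mono {F i} {true} (λ _ → refl))) (≤-reflexive (trans (sum-const a 1) (*-identityʳ a)))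

  once : ∀ {a} (F : Fin a → Bool) → (∀ i j → F i ≡ true → F j ≡ true → i ≡ j) → ∑ (λ i → ind (F i)) ≤ 1
  once F h = subst (_≤ 1) (#-sum F) (#≤1 h)

  into-g-none : ∀ u i → E u (gd i) ≡ false
  into-g-none u zero = ¬true⇒false (into-g u)
  into-g-none u (suc zero) = ¬true⇒false (into-g u)
  into-g-none u (suc (suc zero)) = ¬true⇒false (into-g u)
  into-g-none u (suc (suc (suc zero))) = ¬true⇒false (into-g u)

  into-v-none : ∀ u t → E u (v t) ≡ false
  into-v-none u t = ¬true⇒false (into-v u)

  -- One cell, one row, one column, two crown vertices and the hub.
  out-v≤ : ∀ t → out (v t) ≤ 6
  out-v≤ t = blocks (v t) (once _ cell)
      (two-once (rc true) (rc false) (λ k k′ a b → trans (does-e (k ≟ _) a) (≡sym (does-e (k′ ≟ _) b))) (λ k k′ a b → trans (does-e (k ≟ _) a) (≡sym (does-e (k′ ≟ _) b))))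
      (two-once (c true) (c false) (λ k k′ a b → trans (does-e (k ≟ _) a) (≡sym (does-e (k′ ≟ _) b))) (λ k k′ a b → trans (does-e (k ≟ _) a) (≡sym (does-e (k′ ≟ _) b))))
      (none (into-g-none (v t))) (all≤ _) (none (into-v-none (v t)))
    where
    two-once : ∀ {a} (F H : Fin a → V) → (∀ k k′ → E (v t) (F k) ≡ true → E (v t) (F k′) ≡ true → k ≡ k′) →
      (∀ k k′ → E (v t) (H k) ≡ true → E (v t) (H k′) ≡ true → k ≡ k′) → ∑ (λ k → ind (E (v t) ((F ⊹ H) k))) ≤ 2
    two-once F H a b = ≤-trans (≤-reflexive (sum-⊹ (λ w → ind (E (v t) w)) F H)) (+-mono-≤ (once _ a) (once _ b))
    cell : ∀ p p′ → E (v t) (xd p) ≡ true → E (v t) (xd p′) ≡ true → p ≡ p′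
    r₁ r₂ : Fin (q * q) → Fin q
    r₁ p = proj₁ (remQuot {q} q p)
    r₂ p = proj₂ (remQuot {q} q p)
    cell p p′ a b = trans (≡sym (combine-remQuot {q} q p)) (trans (cong₂ combine {r₁ p} {r₁ p′} {r₂ p} {r₂ p′}
        (trans (does-e (r₁ p ≟ iv t) (∧-l a)) (≡sym (does-e (r₁ p′ ≟ iv t) (∧-l b))))
        (trans (does-e (r₂ p ≟ jv t) (∧-r {does (r₁ p ≟ iv t)} a)) (≡sym (does-e (r₂ p′ ≟ jv t) (∧-r {does (r₁ p′ ≟ iv t)} b)))))
        (combine-remQuot {q} q p′))

  out-x≤ : ∀ i j → out (x i j) ≤ q + q
  out-x≤ i j = ≤-trans (blocks (x i j) (none (λ _ → refl)) (all≤ _) (none (⊹-all (λ w → E (x i j) w ≡ false) (c true) (c false) (λ _ → refl) (λ _ → refl))) (none (into-g-none (x i j))) (none (λ _ → refl)) (none (λ _ → refl)))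
      (≤-reflexive (+-identityʳ (q + q)))

  out-c≤ : ∀ s l → out (c s l) ≤ m + m
  out-c≤ s l = ≤-trans (blocks (c s l) (none (λ _ → refl)) (none (⊹-all (λ w → E (c s l) w ≡ false) (rc true) (rc false) (λ _ → refl) (λ _ → refl))) (all≤ _) (none (into-g-none (c s l))) (none (λ _ → refl)) (none (λ _ → refl)))
      (≤-reflexive (+-identityʳ (m + m)))

  out-g≤ : ∀ i → out (gd i) ≤ core
  out-g≤ i = ≤-trans (blocks (gd i) (all≤ _) (all≤ _) (all≤ _) (none (into-g-none (gd i))) (all≤ _) (none (into-v-none (gd i)))) ≤-refl

  out-rc≤ : ∀ s k → out (rc s k) ≤ 0
  out-rc≤ s k = none (λ _ → refl)

  out-hub≤ : out hub ≤ 0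
  out-hub≤ = none (λ _ → refl)

  edge-bound : edges graph ≤ f * 6 + (q * q * (q + q) + ((m + m) * (m + m) + 4 * core))
  edge-bound = begin
    edges graph                              ≤⟨ edges≤ ⟩
    ∑ (λ i → out (dec i))                    ≡⟨ sum-V out ⟩
    _                                        ≤⟨ +-mono-≤ (below (λ p → out-x≤ _ _)) (+-mono-≤ (below (⊹-all (λ w → out w ≤ 0) (rc true) (rc false) (out-rc≤ true) (out-rc≤ false)))
                                                  (+-mono-≤ (below (⊹-all (λ w → out w ≤ m + m) (c true) (c false) (out-c≤ true) (out-c≤ false)))
                                                    (+-mono-≤ (below out-g≤) (+-mono-≤ (below (λ _ → out-hub≤)) (below out-v≤))))) ⟩
    q * q * (q + q) + ((q + q) * 0 + ((m + m) * (m + m) + (4 * core + (1 * 0 + f * 6)))) ≡⟨ eq (q * q * (q + q)) (q + q) ((m + m) * (m + m)) (4 * core) (f * 6) ⟩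
    f * 6 + (q * q * (q + q) + ((m + m) * (m + m) + 4 * core)) ∎
    where
    open ≤-Reasoning
    below : ∀ {a b} {F : Fin a → ℕ} → (∀ i → F i ≤ b) → ∑ F ≤ a * b
    below {a} {b} h = ≤-trans (sum-mono h) (≤-reflexive (sum-const a b))
    eq : ∀ a b c d e → a + (b * 0 + (c + (d + (1 * 0 + e)))) ≡ e + (a + (c + d))
    eq = solve-∀

-- Enumeration of the triples in use

module Coordinates (q₀ m₀ f′ : ℕ) (le : f′ ≤ ((2 + q₀) + (2 + q₀) * (3 + q₀)) * (2 + m₀)) where
  -- `suc s′` reduces to `q * q`, so that non-zero cell numbers are successors of elements of
  -- `Fin s′`.
  q m s′ m′ f : ℕ
  q = 3 + q₀
  m = 3 + m₀
  s′ = (2 + q₀) + (2 + q₀) * (3 + q₀)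
  m′ = 2 + m₀
  f = q * q + (m′ + f′)

  Pair : Set
  Pair = Fin (suc s′) × Fin m

  first : Fin (suc s′) → Pair
  first e = e , zero

  second : Fin m′ → Pair
  second l = zero , suc l

  rest : Fin f′ → Pair
  rest p = suc (proj₁ (remQuot {s′} m′ (inject≤ p le))) , suc (proj₂ (remQuot {s′} m′ (inject≤ p le)))

  -- Every cell with pair zero, every other pair with cell zero, then `f′` triples with both parts
  -- non-zero. Thus all cells and pairs are used, nothing repeats, and `f′` can adjust the number of
  -- vertices to n.
  co : Fin f → Pair
  co = first ⊹ (second ⊹ rest)

  co-inj : ∀ s t → co s ≡ co t → s ≡ t
  co-inj = ⊹-inj first (second ⊹ rest) (λ { _ _ refl → refl })
    (⊹-inj second rest (λ { _ _ refl → refl }) rest-inj (λ _ _ ()))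
    (λ i j e → 0≢1+n (trans (cong proj₂ e) (proj₂ (⊹-all (λ w → ∃ λ l → proj₂ w ≡ suc l) second rest (λ l → l , refl) (λ p → _ , refl) j))))
    where
    rest-inj : ∀ i j → rest i ≡ rest j → i ≡ j
    rest-inj i j e = inject≤-injective le le i j (trans (≡sym (combine-remQuot {s′} m′ (inject≤ i le))) (trans (cong₂ combine
      (suc-injective (cong proj₁ e)) (suc-injective (cong proj₂ e))) (combine-remQuot {s′} m′ (inject≤ j le))))

  iv jv : Fin f → Fin q
  iv t = proj₁ (remQuot {q} q (proj₁ (co t)))
  jv t = proj₂ (remQuot {q} q (proj₁ (co t)))

  lv : Fin f → Fin m
  lv t = proj₂ (co t)

  coords-inj : ∀ s t → iv s ≡ iv t → jv s ≡ jv t → lv s ≡ lv t → s ≡ t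
  coords-inj s t a b d = co-inj s t (cong₂ _,_ (trans (≡sym (combine-remQuot {q} q (proj₁ (co s)))) (trans (cong₂ combine a b) (combine-remQuot {q} q (proj₁ (co t))))) d)

  cell-used : ∀ i j → ∃ λ t → iv t ≡ i × jv t ≡ j
  cell-used i j with ⊹-left first (second ⊹ rest) (combine i j , refl)
  ... | t , e = t , trans (cong (λ w → proj₁ (remQuot {q} q (proj₁ w))) e) (cong proj₁ (remQuot-combine i j)) ,
                    trans (cong (λ w → proj₂ (remQuot {q} q (proj₁ w))) e) (cong proj₂ (remQuot-combine i j))

  pair-used : ∀ l → ∃ λ t → lv t ≡ l
  pair-used zero with ⊹-left first (second ⊹ rest) (zero , refl)
  ... | t , e = t , cong proj₂ e
  pair-used (suc l) with ⊹-right first (second ⊹ rest) (⊹-left second rest (l , refl))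
  ... | t , e = t , cong proj₂ e

-- Choice of the parameters of the construction

p₆ p₇ : ℕ → ℕ
p₆ t = t * t * (t * t * (t * t))
p₇ t = t * p₆ t

p₆-mono : ∀ {a b} → a ≤ b → p₆ a ≤ p₆ b
p₆-mono p = *-mono-≤ (*-mono-≤ p p) (*-mono-≤ (*-mono-≤ p p) (*-mono-≤ p p))

p₇-mono : ∀ {a b} → a ≤ b → p₇ a ≤ p₇ b
p₇-mono p = *-mono-≤ p (p₆-mono p)

p₇-strict : ∀ u → p₇ u < p₇ (suc u)
p₇-strict u = ≤-trans (s≤s (m≤m+n _ _)) (≤-reflexive (≡sym (eq u)))
  where
  eq : ∀ u → ((suc u) * ((suc u) * (suc u) * ((suc u) * (suc u) * ((suc u) * (suc u))))) ≡ suc ((u * (u * u * (u * u * (u * u)))) + (7 * (u * u * u * u * u * u) + 21 * (u * u * u * u * u) + 35 * (u * u * u * u) + 35 * (u * u * u) + 21 * (u * u) + 7 * u))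
  eq = solve-∀

seventh-root : ∀ n → ∃ λ u → p₇ u ≤ n × n < p₇ (suc u)
seventh-root zero = 0 , z≤n , s≤s z≤n
seventh-root (suc n) with seventh-root n
... | u , lo , hi with m≤n⇒m<n∨m≡n hi
...   | inj₁ p = u , m≤n⇒m≤1+n lo , p
...   | inj₂ e = suc u , ≤-reflexive (≡sym e) , subst (_< p₇ (suc (suc u))) (≡sym e) (p₇-strict (suc u))

-- Take `t = suc u` for the integer seventh root `u`. Then `p₆ t ≤ p₆ (2 * u)`, which is
-- `64 * p₆ u`, and `u ≥ 64 * W` absorbs the factor.
scale-choice : ∀ W n → 1 ≤ W → p₇ (64 * W) ≤ n → ∃ λ t → 1 ≤ t × W * p₆ t ≤ n × n ≤ p₇ t
scale-choice W n W≥1 N≤n with seventh-root n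
... | u , lo , hi = suc u , s≤s z≤n , W≤ , <⇒≤ hi
  where
  u≥ : 64 * W ≤ u
  u≥ = ≤-pred (≰⇒> (λ p → <⇒≱ hi (≤-trans (p₇-mono p) N≤n)))
  1≤u : 1 ≤ u
  1≤u = ≤-trans (≤-trans W≥1 (m≤n*m W 64)) u≥
  W≤ : W * p₆ (suc u) ≤ n
  W≤ = begin
    W * p₆ (suc u)          ≤⟨ *-monoʳ-≤ W (p₆-mono (≤-trans (+-monoˡ-≤ u 1≤u) (≤-reflexive (cong (u +_) (≡sym (+-identityʳ u)))))) ⟩
    W * p₆ (2 * u)          ≡⟨ eq W u ⟩
    64 * W * p₆ u           ≤⟨ *-monoˡ-≤ (p₆ u) u≥ ⟩
    p₇ u                    ≤⟨ lo ⟩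
    n                       ∎
    where
    open ≤-Reasoning
    eq : ∀ w u → w * (2 * u * (2 * u) * (2 * u * (2 * u) * (2 * u * (2 * u)))) ≡ 64 * w * (u * u * (u * u * (u * u)))
    eq = solve-∀

-- The terms of `edge-bound` beyond `f * 6`, and the number of vertices beyond `f′`.
extraOf baseOf : ℕ → ℕ → ℕ
extraOf q₀ m₀ = (3 + q₀) * (3 + q₀) * ((3 + q₀) + (3 + q₀)) + (((3 + m₀) + (3 + m₀)) * ((3 + m₀) + (3 + m₀)) +
  4 * ((3 + q₀) * (3 + q₀) + (((3 + q₀) + (3 + q₀)) + (((3 + m₀) + (3 + m₀)) + 1))))
baseOf q₀ m₀ = (3 + q₀) * (3 + q₀) + (((3 + q₀) + (3 + q₀)) + (((3 + m₀) + (3 + m₀)) + (4 + (1 + ((3 + q₀) * (3 + q₀) + (2 + m₀))))))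

-- With grid side 3 + t^2 and crown size 3 + t^3 the core has O(t^6) edges, and there are at least t^7 triples (i , j , l).
module Sizes (t : ℕ) (1≤t : 1 ≤ t) where
  T₂ T₃ q m core : ℕ
  T₂ = t * t
  T₃ = t * (t * t)
  q = 3 + T₂
  m = 3 + T₃
  core = q * q + ((q + q) + ((m + m) + 1))

  1≤T₂ : 1 ≤ T₂
  1≤T₂ = *-mono-≤ 1≤t 1≤t
  1≤T₃ : 1 ≤ T₃
  1≤T₃ = *-mono-≤ 1≤t 1≤T₂

  quadruple : ∀ a → 1 ≤ a → 3 + a ≤ 4 * a
  quadruple a p = ≤-trans (+-monoˡ-≤ a (*-monoʳ-≤ 3 p)) (≤-reflexive (eq a))
    where
    eq : ∀ a → 3 * a + a ≡ 4 * a
    eq = solve-∀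

  q≤ : q ≤ 4 * T₂
  q≤ = quadruple T₂ 1≤T₂
  m≤ : m ≤ 4 * T₃
  m≤ = quadruple T₃ 1≤T₃

  P : ℕ
  P = p₆ t

  T₂≤P : T₂ ≤ P
  T₂≤P = ≤-trans (≤-reflexive (≡sym (*-identityʳ T₂))) (*-monoʳ-≤ T₂ (*-mono-≤ 1≤T₂ 1≤T₂))
  T₂T₂≤P : T₂ * T₂ ≤ P
  T₂T₂≤P = *-monoʳ-≤ T₂ (≤-trans (≤-reflexive (≡sym (*-identityʳ T₂))) (*-monoʳ-≤ T₂ 1≤T₂))
  T₃T₃ : ∀ t → t * (t * t) * (t * (t * t)) ≡ (t * t * (t * t * (t * t)))
  T₃T₃ = solve-∀
  T₃≤P : T₃ ≤ P
  T₃≤P = ≤-trans (≤-trans (≤-reflexive (≡sym (*-identityʳ T₃))) (*-monoʳ-≤ T₃ 1≤T₃)) (≤-reflexive (T₃T₃ t))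
  1≤P : 1 ≤ P
  1≤P = ≤-trans 1≤T₂ T₂≤P

  qq≤ : q * q ≤ 16 * P
  qq≤ = ≤-trans (*-mono-≤ q≤ q≤) (≤-trans (≤-reflexive (eq T₂)) (*-monoʳ-≤ 16 T₂T₂≤P))
    where
    eq : ∀ a → 4 * a * (4 * a) ≡ 16 * (a * a)
    eq = solve-∀
  q+q≤ : q + q ≤ 8 * P
  q+q≤ = ≤-trans (+-mono-≤ q≤ q≤) (≤-trans (≤-reflexive (eq T₂)) (*-monoʳ-≤ 8 T₂≤P))
    where
    eq : ∀ a → 4 * a + 4 * a ≡ 8 * a
    eq = solve-∀
  m+m≤ : m + m ≤ 8 * P
  m+m≤ = ≤-trans (+-mono-≤ m≤ m≤) (≤-trans (≤-reflexive (eq T₃)) (*-monoʳ-≤ 8 T₃≤P))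
    where
    eq : ∀ a → 4 * a + 4 * a ≡ 8 * a
    eq = solve-∀

  core≤ : core ≤ 33 * P
  core≤ = ≤-trans (+-mono-≤ qq≤ (+-mono-≤ q+q≤ (+-mono-≤ m+m≤ 1≤P))) (≤-reflexive (eq P))
    where
    eq : ∀ a → 16 * a + (8 * a + (8 * a + a)) ≡ 33 * a
    eq = solve-∀

  extra≤ : extraOf T₂ T₃ ≤ 324 * P
  extra≤ = ≤-trans (+-mono-≤ (*-mono-≤ (*-mono-≤ q≤ q≤) (+-mono-≤ q≤ q≤)) (+-mono-≤ (*-mono-≤ (+-mono-≤ m≤ m≤) (+-mono-≤ m≤ m≤)) (*-monoʳ-≤ 4 core≤))) (≤-reflexive (eq t))
    where
    eq : ∀ t → 4 * (t * t) * (4 * (t * t)) * (4 * (t * t) + 4 * (t * t)) + ((4 * (t * (t * t)) + 4 * (t * (t * t))) * (4 * (t * (t * t)) + 4 * (t * (t * t))) + 4 * (33 * (t * t * (t * t * (t * t))))) ≡ 324 * (t * t * (t * t * (t * t)))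
    eq = solve-∀

  base≤ : baseOf T₂ T₃ ≤ 324 * P
  base≤ = ≤-trans (+-mono-≤ qq≤ (+-mono-≤ q+q≤ (+-mono-≤ m+m≤ (+-mono-≤ (*-monoʳ-≤ 4 1≤P) (+-mono-≤ 1≤P (+-mono-≤ qq≤ (+-mono-≤ (*-monoʳ-≤ 2 1≤P) T₃≤P)))))))
            (≤-trans (m≤m+n _ (268 * P)) (≤-reflexive (eq P)))
    where
    eq : ∀ a → 16 * a + (8 * a + (8 * a + (4 * a + (a + (16 * a + (2 * a + a)))))) + 268 * a ≡ 324 * a
    eq = solve-∀

  capacity : p₇ t ≤ ((2 + T₂) + (2 + T₂) * (3 + T₂)) * (2 + T₃)
  capacity = ≤-trans (m≤m+n _ _) (≤-reflexive (≡sym (eq t)))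
    where
    eq : ∀ t → ((2 + t * t) + (2 + t * t) * (3 + t * t)) * (2 + t * (t * t)) ≡
      (t * (t * t * (t * t * (t * t)))) + (2 * (t * t * t * t) + (8 + 6 * (t * t)) * (2 + t * (t * t)))
    eq = solve-∀

-- The upper bound for r = 3

Witness : ℕ → ℕ → ℕ → Set
Witness ρ k n = Σ (Graph n) λ G → TwinFree G × KSaturated (3 + ρ) G × (suc k * edges G ≤ (6 + ρ) * suc k * n + n)

module Build (k q₀ m₀ f′ : ℕ) (le : f′ ≤ ((2 + q₀) + (2 + q₀) * (3 + q₀)) * (2 + m₀)) (small : suc k * extraOf q₀ m₀ ≤ baseOf q₀ m₀ + f′) where
  module Co = Coordinates q₀ m₀ f′ le
  module G = Construction q₀ m₀ Co.f Co.iv Co.jv Co.lv Co.coords-inj Co.cell-used Co.pair-used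

  size-eq : G.size ≡ baseOf q₀ m₀ + f′
  size-eq = eq ((3 + q₀) * (3 + q₀)) ((3 + q₀) + (3 + q₀)) ((3 + m₀) + (3 + m₀)) (2 + m₀) f′
    where
    eq : ∀ s a b m′ f′ → s + (a + (b + (4 + (1 + (s + (m′ + f′)))))) ≡ s + (a + (b + (4 + (1 + (s + m′))))) + f′
    eq = solve-∀

  f≤size : Co.f ≤ G.size
  f≤size = ≤-trans (m≤n+m Co.f 1) (≤-trans (m≤n+m (1 + Co.f) 4) (≤-trans (m≤n+m (4 + (1 + Co.f)) ((3 + m₀) + (3 + m₀)))
    (≤-trans (m≤n+m _ ((3 + q₀) + (3 + q₀))) (m≤n+m _ ((3 + q₀) * (3 + q₀))))))

  count-edges : ∀ s e f x n → e ≤ f * 6 + x → f ≤ n → s * x ≤ n → s * e ≤ 6 * s * n + n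
  count-edges s e f x n p r t = begin
    s * e                      ≤⟨ *-monoʳ-≤ s p ⟩
    s * (f * 6 + x)            ≡⟨ eq s f x ⟩
    6 * s * f + s * x          ≤⟨ +-mono-≤ (*-monoʳ-≤ (6 * s) r) t ⟩
    6 * s * n + n              ∎
    where
    open ≤-Reasoning
    eq : ∀ s f x → s * (f * 6 + x) ≡ 6 * s * f + s * x
    eq = solve-∀

  witness : Witness 0 k (baseOf q₀ m₀ + f′)
  witness = subst (Witness 0 k) size-eq (G.graph , G.twin-free , G.saturated ,
    count-edges (suc k) (edges G.graph) Co.f (extraOf q₀ m₀) G.size G.edge-bound f≤size (≤-trans small (≤-reflexive (≡sym size-eq))))

module Upper₃ (k : ℕ) where
  W : ℕ
  W = suc k * 324

  opaque
    threshold : ℕ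
    threshold = p₇ (64 * W)

    threshold-def : threshold ≡ p₇ (64 * W)
    threshold-def = refl

  W≥1 : 1 ≤ W
  W≥1 = s≤s z≤n

  build : ∀ n t → 1 ≤ t → W * p₆ t ≤ n → n ≤ p₇ t → Witness 0 k n
  build n t 1≤t lo hi = go (m≤n⇒∃[o]m+o≡n (≤-trans base≤ (≤-trans (*-monoˡ-≤ (p₆ t) (m≤n*m 324 (suc k))) lo)))
    where
    open Sizes t 1≤t
    extra-small : suc k * extraOf T₂ T₃ ≤ n
    extra-small = ≤-trans (*-monoʳ-≤ (suc k) extra≤) (≤-trans (≤-reflexive (≡sym (*-assoc (suc k) 324 (p₆ t)))) lo)
    go : (∃ λ f′ → baseOf T₂ T₃ + f′ ≡ n) → Witness 0 k n
    go (f′ , e) = subst (Witness 0 k) e (Build.witness k T₂ T₃ f′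
      (≤-trans (m≤n+m f′ (baseOf T₂ T₃)) (≤-trans (≤-reflexive e) (≤-trans hi capacity))) (≤-trans extra-small (≤-reflexive (≡sym e))))

  upper₃ : ∀ n → threshold ≤ n → Witness 0 k n
  upper₃ n N≤n = let t , 1≤t , lo , hi = scale-choice W n W≥1 (≤-trans (≤-reflexive (≡sym threshold-def)) N≤n) in build n t 1≤t lo hi

-- Adding a dominating vertex

cone : ∀ {n} → Graph n → Graph (suc n)
cone {n} G = record { adj = a ; sym = a-sym ; irrefl = a-irr }
  where
  a : Fin (suc n) → Fin (suc n) → Bool
  a zero    zero    = false
  a zero    (suc j) = true
  a (suc i) zero    = true
  a (suc i) (suc j) = adj G i j
  a-sym : ∀ i j → a i j ≡ a j i
  a-sym zero    zero    = refl
  a-sym zero    (suc j) = refl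
  a-sym (suc i) zero    = refl
  a-sym (suc i) (suc j) = sym G i j
  a-irr : ∀ i → a i i ≡ false
  a-irr zero    = refl
  a-irr (suc i) = irrefl G i

module Cone {n : ℕ} (G : Graph n) where

  -- The apex separates itself from the old vertices: they see it, and it does not see itself.
  cone-twin-free : TwinFree G → TwinFree (cone G)
  cone-twin-free tf zero zero (ne , _) = ne refl
  cone-twin-free tf zero (suc j) (_ , T) = clash refl (≡sym (T zero))
  cone-twin-free tf (suc i) zero (_ , T) = clash refl (T zero)
  cone-twin-free tf (suc i) (suc j) (ne , T) = tf i j ((λ e → ne (cong suc e)) , (λ x → T (suc x)))

  -- Remove the apex from the clique if it is there, and the vertex with index zero otherwise.
  cone-free : ∀ {s} → ¬ ContainsK s (adj G) → ¬ ContainsK (suc s) (adj (cone G))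
  cone-free {s} no-clique (f , inj , a) with any? (λ i → f i ≟ zero)
  ... | yes (i , fi) = no-clique (below-all (λ k → f (punchIn i k)) (λ e → punchIn-injective i _ _ (inj e)) (λ k l ne → a _ _ (ne ∘ punchIn-injective i k l))
          (λ k e → punchInᵢ≢i i k (inj (trans e (≡sym fi)))))
    where
    below-all : (h : Fin s → Fin (suc n)) → (∀ {k l} → h k ≡ h l → k ≡ l) → (∀ k l → k ≢ l → adj (cone G) (h k) (h l) ≡ true) →
      (∀ k → h k ≢ zero) → ContainsK s (adj G)
    below-all h h-inj h-adj h≢0 = lower , (λ {k} {l} e → h-inj (trans (≡sym (lower-eq k)) (trans (cong suc e) (lower-eq l)))) ,
        (λ k l ne → subst₂ (λ x y → adj (cone G) x y ≡ true) (≡sym (lower-eq k)) (≡sym (lower-eq l)) (h-adj k l ne))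
      where
      lower : Fin s → Fin n
      lower k = punchOut (h≢0 k ∘ ≡sym)
      lower-eq : ∀ k → suc (lower k) ≡ h k
      lower-eq k = punchIn-punchOut (h≢0 k ∘ ≡sym)
  ... | no miss = no-clique (lower , (λ {k} {l} e → suc-injective (inj (trans (≡sym (lower-eq k)) (trans (cong suc e) (lower-eq l))))) ,
        (λ k l ne → subst₂ (λ x y → adj (cone G) x y ≡ true) (≡sym (lower-eq k)) (≡sym (lower-eq l)) (a (suc k) (suc l) (ne ∘ suc-injective))))
    where
    nz : ∀ k → f (suc k) ≢ zero
    nz k e = miss (suc k , e)
    lower : Fin s → Fin n
    lower k = punchOut (nz k ∘ ≡sym)
    lower-eq : ∀ k → suc (lower k) ≡ f (suc k)
    lower-eq k = punchIn-punchOut (nz k ∘ ≡sym)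

  cone-saturated : ∀ {s} → KSaturated s G → KSaturated (suc s) (cone G)
  cone-saturated {s} (free , sat) = cone-free free , new
    where
    new : ∀ u v → u ≢ v → adj (cone G) u v ≡ false → ContainsK (suc s) (addEdge (cone G) u v)
    new zero zero ne na = ⊥-elim (ne refl)
    new (suc u) (suc v) ne na with sat u v (ne ∘ cong suc) na
    ... | f , inj , a = h , h-inj , h-adj
      where
      h : Fin (suc s) → Fin (suc n)
      h zero    = zero
      h (suc k) = suc (f k)
      h-inj : ∀ {k l} → h k ≡ h l → k ≡ l
      h-inj {zero} {zero} e = refl
      h-inj {suc k} {suc l} e = cong suc (inj (suc-injective e))
      h-adj : ∀ k l → k ≢ l → addEdge (cone G) (suc u) (suc v) (h k) (h l) ≡ true
      h-adj zero zero ne = ⊥-elim (ne refl)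
      h-adj zero (suc l) ne = refl
      h-adj (suc k) zero ne = refl
      h-adj (suc k) (suc l) ne = a k l (ne ∘ cong suc)

  cone-edges : edges (cone G) ≤ n + edges G
  cone-edges = +-mono-≤ (≤-trans (≤-reflexive (≡sym (#-def {n} _))) (≤-trans (#-mono {g = λ _ → true} (λ _ _ → refl)) (≤-reflexive (#-all n)))) ≤-refl

upper : ∀ ρ k → Σ ℕ λ N → ∀ n → N ≤ n → Witness ρ k n
upper zero k = Upper₃.threshold k , Upper₃.upper₃ k
upper (suc ρ) k with upper ρ k
... | N , w = suc N , step
  where
  arith : ∀ s c n e → s * e ≤ c * s * n + n → s * (n + e) ≤ suc c * s * suc n + suc n
  arith s c n e p = ≤-trans (≤-trans (≤-reflexive (*-distribˡ-+ s n e)) (+-monoʳ-≤ (s * n) p))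
    (≤-trans (m≤m+n _ _) (≤-reflexive (≡sym (eq s c n))))
    where
    eq : ∀ s c n → suc c * s * suc n + suc n ≡ s * n + (c * s * n + n) + suc (suc c * s)
    eq = solve-∀
  step : ∀ n → suc N ≤ n → Witness (suc ρ) k n
  step (suc n) (s≤s N≤n) with w n N≤n
  ... | G , tf , sat , e = cone G , Cone.cone-twin-free G tf , Cone.cone-saturated G sat ,
        ≤-trans (*-monoʳ-≤ (suc k) (Cone.cone-edges G)) (arith (suc k) (6 + ρ) n (edges G) e)

-- An error term o(n) is read as at most n / (k + 1), for every `k` and all n from some `N` on, with
-- denominators cleared; 5 + 2/3 appears as 17/3. The upper bounds exhibit a graph of each such
-- order.
theorem2 : ((r : ℕ) → r ≥ 3 →
    ((k : ℕ) → Σ ℕ λ N → (n : ℕ) → n ≥ N →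
    ((G : Graph n) → TwinFree G → KSaturated r G →
    (r + 2) * suc k * n ≤ suc k * edges G + n)
    × (Σ (Graph n) λ G → TwinFree G × KSaturated r G ×
    (suc k * edges G ≤ (r + 3) * suc k * n + n))))
    × ((k : ℕ) → Σ ℕ λ N → (n : ℕ) → n ≥ N →
    ((G : Graph n) → TwinFree G → KSaturated 3 G →
    17 * suc k * n ≤ 3 * suc k * edges G + 3 * n)
    × (Σ (Graph n) λ G → TwinFree G × KSaturated 3 G ×
    (suc k * edges G ≤ 6 * suc k * n + n)))
theorem2 = (λ r r≥3 k → general r k (m≤n⇒∃[o]m+o≡n r≥3)) , triangle
  where
  General : ℕ → ℕ → Set
  General r k = Σ ℕ λ N → (n : ℕ) → n ≥ N →
    ((G : Graph n) → TwinFree G → KSaturated r G → (r + 2) * suc k * n ≤ suc k * edges G + n)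
    × (Σ (Graph n) λ G → TwinFree G × KSaturated r G × (suc k * edges G ≤ (r + 3) * suc k * n + n))
  general : ∀ r k → (∃ λ ρ → 3 + ρ ≡ r) → General r k
  general r k (ρ , refl) = LowerBound.Sc.threshold ρ k + proj₁ (upper ρ k) , λ n n≥N →
    (λ G tf sat → subst (λ c → c * suc k * n ≤ suc k * edges G + n) (+-comm 2 (3 + ρ))
      (LowerBound.bound ρ k n (≤-trans (m≤m+n _ _) n≥N) G tf sat)) ,
    (let G , tf , sat , e = proj₂ (upper ρ k) n (≤-trans (m≤n+m _ (LowerBound.Sc.threshold ρ k)) n≥N)
     in G , tf , sat , subst (λ c → suc k * edges G ≤ c * suc k * n + n) (+-comm 3 (3 + ρ)) e)
  triangle : ∀ k → Σ ℕ λ N → (n : ℕ) → n ≥ N →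
    ((G : Graph n) → TwinFree G → KSaturated 3 G → 17 * suc k * n ≤ 3 * suc k * edges G + 3 * n)
    × (Σ (Graph n) λ G → TwinFree G × KSaturated 3 G × (suc k * edges G ≤ 6 * suc k * n + n))
  triangle k = LowerBound₃.threshold k + proj₁ (upper 0 k) , λ n n≥N →
    (λ G tf sat → LowerBound₃.bound k n (≤-trans (m≤m+n _ _) n≥N) G tf sat) ,
    proj₂ (upper 0 k) n (≤-trans (m≤n+m _ (LowerBound₃.threshold k)) n≥N)
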